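{- Let $q$ be a power of a prime $p$, $n\ge2$, $s\ge2$, $1\le k\le n-1$ integers, $\sigma$ a generator of $\mathrm{Gal}(\mathbb F_{q^n}/\mathbb F_q)$, $F\in\mathbb F_q[Y]$ a monic irreducible polynomial of degree $s$, and let $\mathbb F=\mathbb F_{q^s}$. The projection $$\pi:\mathrm{Aut}(\mathcal C_k(F))\longrightarrow\mathrm{Aut}_{\mathbb F_p}(\mathbb F),\qquad (M,N,\rho)\longmapsto\rho$$ has image $\mathcal H_F$, and its kernel is canonically isomorphic to $\mathrm{Aut}_{\mathbb E}(\mathcal C_k(F))$ (via $(M,N)\mapsto(M,N,\mathrm{id})$). Hence there is a short exact sequence $$1\longrightarrow\mathrm{Aut}_{\mathbb E}(\mathcal C_k(F))\longrightarrow\mathrm{Aut}(\mathcal C_k(F))\overset{\pi}{\longrightarrow}\mathcal H_F\longrightarrow1.$$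
   Context: Set-up. Let $\ell=\gcd(n,s)$, $n'=n/\ell$, $\mathbb K=\mathbb F_{q^n}$, $\mathbb L=\mathbb F_{q^{ns/\ell}}$, $\mathbb F=\mathbb F_{q^s}$, $V=\mathbb L^\ell$. Write $\sigma:\alpha\mapsto\alpha^{q^h}$ with $\gcd(h,n)=1$, and extend $\sigma$ to $\mathbb L$ by the same formula. Choose integers $c>0$, $c'$ with $\ell=cs+c'n$ and $\gcd(c,n')=1$, and put $\gamma:\mathbb L\to\mathbb L$, $\gamma(\alpha)=\alpha^{q^{hcs}}$, a generator of $\mathrm{Gal}(\mathbb L/\mathbb F)$. $V$ is an $s$-dimensional $\mathbb K$-vector space via $\alpha\cdot(x_0,\dots,x_{\ell-1})=(\alpha x_0,\alpha^{\sigma}x_1,\dots,\alpha^{\sigma^{\ell-1}}x_{\ell-1})$. For $w\in\mathbb L^\times$ let $T_{w,\sigma}(x_0,\dots,x_{\ell-1})=(x_1,\dots,x_{\ell-1},w x_0^\gamma)$; it is additive and $\sigma$-semilinear over $\mathbb K$, and $T_{w,\sigma}^n=\mathrm N_{\mathbb L/\mathbb F}(w)\,\mathrm{id}_V$ (coordinatewise multiplication). Fix $w_F\in\mathbb L^\times$ such that $u_F:=\mathrm N_{\mathbb L/\mathbb F}(w_F)$ is a root of $F$, and set $T_F:=T_{w_F,\sigma}$. Let $\mathbb E:=\mathbb F\,\mathrm{id}_V=\mathbb F_q[T_F^n]$ (coordinatewise multiplications by elements of $\mathbb F$), identified with $\mathbb F$; $V$ is an $n$-dimensional $\mathbb E$-vector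 space. The code is $$\mathcal C_k(F):=\Big\{\sum_{i=0}^{sk-1}\alpha_i\cdot T_F^i:\alpha_i\in\mathbb K\Big\}\subseteq\mathrm{End}_{\mathbb E}(V).$$ Fix an $\mathbb E$-basis of $V$; for $\rho\in\mathrm{Aut}_{\mathbb F_p}(\mathbb E)$ let $L_\rho$ be the $\rho$-semilinear map fixing the basis vectors, and put $A^\rho:=L_\rho AL_\rho^{ -1}$ and $\mathcal D^\rho:=\{A^\rho:A\in\mathcal D\}$ for $A\in\mathrm{End}_{\mathbb E}(V)$, $\mathcal D\subseteq\mathrm{End}_{\mathbb E}(V)$ (equivalently, $\rho$ acts entrywise on matrices). Define $$\mathrm{Aut}(\mathcal C_k(F)):=\{(M,N,\rho)\in\mathrm{GL}_{\mathbb E}(V)\times\mathrm{GL}_{\mathbb E}(V)\times\mathrm{Aut}_{\mathbb F_p}(\mathbb E):M\,\mathcal C_k(F)^\rho\,N=\mathcal C_k(F)\},$$ with group law $(M,N,\rho)(M',N',\rho')=(MM'^{\rho},N'^{\rho}N,\rho\rho')$, and $$\mathrm{Aut}_{\mathbb E}(\mathcal C_k(F)):=\{(M,N)\in\mathrm{GL}_{\mathbb E}(V)^2:M\,\mathcal C_k(F)\,N=\mathcal C_k(F)\}.$$ $\mathcal H_F^+:=\{\rho\in\mathrm{Aut}_{\mathbb F_p}(\mathbb F):\rho(u_F)=\lambda u_F\text{ for some }\lambda\in\mathbb F_q^\times\}$; for $n=2$, $\mathcal H_F^-:=\{\rho\in\mathrm{Aut}_{\mathbb F_p}(\mathbb F):\rho(u_F)=\lambda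 u_F^{ -1}\text{ for some }\lambda\in\mathbb F_q^\times\}$. Finally $\mathcal H_F:=\mathcal H_F^+$ if $n>2$ and $\mathcal H_F:=\mathcal H_F^+\cup\mathcal H_F^-$ if $n=2$. -}

module Defs where

open import Algebra.Bundles using (AbelianGroup; Group; CommutativeRing; RawRing; RawSemiring)
import Algebra.Construct.DirectProduct as DirectProduct
import Algebra.Construct.Flip.Op as Flip
import Algebra.Construct.Pointwise as Pointwise
import Algebra.Definitions.RawMonoid as RawMonoidOps
import Algebra.Definitions.RawSemiring as RawSemiringOps
open import Algebra.Module.Bundles using (LeftModule)
import Algebra.Module.Morphism.Construct.Composition as LinearComposition
import Algebra.Module.Morphism.Construct.Identity as LinearIdentity
import Algebra.Module.Morphism.Structures as LinearMorphisms
import Algebra.Morphism.Construct.Composition as RingComposition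
import Algebra.Morphism.Construct.Identity as RingIdentity
import Algebra.Morphism.RingMonomorphism as RingMonomorphism
open import Algebra.Morphism.Structures using (module GroupMorphisms; module RingMorphisms)
import Algebra.Properties.CommutativeMonoid.Sum as Sum
import Algebra.Properties.Group as GroupProperties
open import Data.Fin.Base using (Fin; zero; suc; toℕ; fromℕ)
open import Data.Integer.Base as ℤ using (ℤ; +_)
open import Data.List.Base as List using (List; []; _∷_)
open import Data.Nat.Base as ℕ using (ℕ; zero; suc; _≤_; _<_; _∸_)
open import Data.Nat.GCD using (gcd)
open import Data.Nat.GeneralisedArithmetic using (iterate)
open import Data.Nat.Primality using (Prime)
open import Data.Product.Base using (Σ; ∃; _×_; _,_; proj₁; proj₂)
open import Data.Sum.Base using (_⊎_)
open import Data.Vec.Functional as Vector using (Vector)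
open import Function.Base using (_∘_; id)
open import Function.Bundles using (Inverse; _⇔_)
open import Function.Definitions using (Surjective)
open import Level using (Level; _⊔_) renaming (suc to lsuc)
open import Relation.Binary.Bundles using (Setoid)
open import Relation.Binary.PropositionalEquality using (_≡_)
import Relation.Binary.PropositionalEquality as ≡
open import Relation.Binary.Definitions using (_Respects_)
import Relation.Binary.Reasoning.Setoid as SetoidReasoning
open import Relation.Nullary.Negation using (¬_)
open import Relation.Unary using (Pred; _≐_)

private
  variable
    a b a₂ b₂ a₃ b₃ r : Level

------------------------------------------------------------------------
-- Groups

record IsSubgroup (G : Group a b) (P : Pred (Group.Carrier G) r) : Set (a ⊔ b ⊔ r) where
  open Group G
  field
    resp      : P Respects _≈_
    ε-closed  : P ε
    ∙-closed  : ∀ {x y} → P x → P y → P (x ∙ y)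
    ⁻¹-closed : ∀ {x} → P x → P (x ⁻¹)

subgroup : (G : Group a b) {P : Pred (Group.Carrier G) r} → IsSubgroup G P → Group (a ⊔ r) b
subgroup G {P} P-sub = record
  { Carrier = Σ Carrier P
  ; _≈_     = λ x y → proj₁ x ≈ proj₁ y
  ; _∙_     = λ x y → proj₁ x ∙ proj₁ y , ∙-closed (proj₂ x) (proj₂ y)
  ; ε       = ε , ε-closed
  ; _⁻¹     = λ x → proj₁ x ⁻¹ , ⁻¹-closed (proj₂ x)
  ; isGroup = record
    { isMonoid = record
      { isSemigroup = record
        { isMagma = record
          { isEquivalence = record { refl = refl ; sym = sym ; trans = trans }
          ; ∙-cong        = ∙-cong
          }
        ; assoc = λ x y z → assoc (proj₁ x) (proj₁ y) (proj₁ z)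
        }
      ; identity = (λ x → identityˡ (proj₁ x)) , (λ x → identityʳ (proj₁ x))
      }
    ; inverse = (λ x → inverseˡ (proj₁ x)) , (λ x → inverseʳ (proj₁ x))
    ; ⁻¹-cong = ⁻¹-cong
    }
  }
  where
  open Group G
  open IsSubgroup P-sub

IsHom : (G : Group a b) (H : Group a₂ b₂) → (Group.Carrier G → Group.Carrier H) → Set (a ⊔ b ⊔ b₂)
IsHom G H = GroupMorphisms.IsGroupHomomorphism (Group.rawGroup G) (Group.rawGroup H)

IsIso : (G : Group a b) (H : Group a₂ b₂) → (Group.Carrier G → Group.Carrier H) → Set (a ⊔ b ⊔ a₂ ⊔ b₂)
IsIso G H = GroupMorphisms.IsGroupIsomorphism (Group.rawGroup G) (Group.rawGroup H)

module Kernel (G : Group a b) (H : Group a₂ b₂)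
              (f : Group.Carrier G → Group.Carrier H) (f-hom : IsHom G H f) where

  private
    module G = Group G
    module H = Group H
    module f = GroupMorphisms.IsGroupHomomorphism f-hom

  isSubgroup : IsSubgroup G (λ x → f x H.≈ H.ε)
  isSubgroup = record
    { resp      = λ x≈y fx≈ε → H.trans (f.⟦⟧-cong (G.sym x≈y)) fx≈ε
    ; ε-closed  = f.ε-homo
    ; ∙-closed  = λ {x} {y} fx≈ε fy≈ε →
        H.trans (f.homo x y) (H.trans (H.∙-cong fx≈ε fy≈ε) (H.identityˡ H.ε))
    ; ⁻¹-closed = λ {x} fx≈ε →
        H.trans (f.⁻¹-homo x) (H.trans (H.⁻¹-cong fx≈ε) (GroupProperties.ε⁻¹≈ε H))
    }

  kernel : Group (a ⊔ b₂) b
  kernel = subgroup G isSubgroup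

record IsShortExact (A : Group a b) (B : Group a₂ b₂) (C : Group a₃ b₃)
                    (f : Group.Carrier A → Group.Carrier B)
                    (g : Group.Carrier B → Group.Carrier C)
                    : Set (a ⊔ b ⊔ a₂ ⊔ b₂ ⊔ a₃ ⊔ b₃) where
  private
    module A = Group A
    module B = Group B
    module C = Group C
  field
    f-mono       : GroupMorphisms.IsGroupMonomorphism A.rawGroup B.rawGroup f
    g-hom        : IsHom B C g
    g-surjective : Surjective B._≈_ C._≈_ g
    exact        : ∀ y → (g y C.≈ C.ε) ⇔ ∃ λ x → f x B.≈ y

------------------------------------------------------------------------
-- Stabilisers of subsets under a group action

image : (X : Setoid a₂ b₂) → (Setoid.Carrier X → Setoid.Carrier X) →
        Pred (Setoid.Carrier X) r → Pred (Setoid.Carrier X) (a₂ ⊔ b₂ ⊔ r)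
image X f 𝒟 x = ∃ λ y → 𝒟 y × Setoid._≈_ X x (f y)

module Stabiliser
  (G : Group a b) (X : Setoid a₂ b₂)
  (act : Group.Carrier G → Setoid.Carrier X → Setoid.Carrier X)
  (act-cong : ∀ g h x y → Group._≈_ G g h → Setoid._≈_ X x y → Setoid._≈_ X (act g x) (act h y))
  (act-ε : ∀ x → Setoid._≈_ X (act (Group.ε G) x) x)
  (act-∙ : ∀ g h x → Setoid._≈_ X (act (Group._∙_ G g h) x) (act g (act h x)))
  (𝒟 : Pred (Setoid.Carrier X) r)
  (𝒟-resp : ∀ x y → Setoid._≈_ X x y → 𝒟 x → 𝒟 y)
  where

  private
    module G = Group G
    module X = Setoid X

  Stabilises : Pred G.Carrier (a₂ ⊔ b₂ ⊔ r)
  Stabilises g = image X (act g) 𝒟 ≐ 𝒟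

  isSubgroup : IsSubgroup G Stabilises
  isSubgroup = record
    { resp = λ {g} {h} g≈h s →
        (λ (y , y∈ , x≈hy) → proj₁ s (y , y∈ , X.trans x≈hy (act-cong h g y y (G.sym g≈h) X.refl))) ,
        (λ x∈ → let (y , y∈ , x≈gy) = proj₂ s x∈ in y , y∈ , X.trans x≈gy (act-cong g h y y g≈h X.refl))
    ; ε-closed =
        (λ {x} (y , y∈ , x≈εy) → 𝒟-resp y x (X.sym (X.trans x≈εy (act-ε y))) y∈) ,
        (λ {x} x∈ → x , x∈ , X.sym (act-ε x))
    ; ∙-closed = λ {g} {h} s t →
        (λ (y , y∈ , x≈ghy) →
          proj₁ s (act h y , proj₁ t (y , y∈ , X.refl) , X.trans x≈ghy (act-∙ g h y))) ,
        (λ x∈ → let (y , y∈ , x≈gy) = proj₂ s x∈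
                    (z , z∈ , y≈hz) = proj₂ t y∈
                in z , z∈ , X.trans x≈gy (X.trans (act-cong g g y (act h z) G.refl y≈hz) (X.sym (act-∙ g h z))))
    ; ⁻¹-closed = λ {g} s →
        (λ {x} (y , y∈ , x≈g⁻¹y) → let (z , z∈ , y≈gz) = proj₂ s y∈ in
          𝒟-resp z x (X.sym (X.trans x≈g⁻¹y
            (X.trans (act-cong (g G.⁻¹) (g G.⁻¹) y (act g z) G.refl y≈gz) (cancel g z)))) z∈) ,
        (λ {x} x∈ → act g x , proj₁ s (x , x∈ , X.refl) , X.sym (cancel g x))
    }
    where
    cancel : ∀ g x → act (g G.⁻¹) (act g x) X.≈ x
    cancel g x = X.trans (X.sym (act-∙ (g G.⁻¹) g x))
                 (X.trans (act-cong (g G.⁻¹ G.∙ g) G.ε x x (G.inverseˡ g) X.refl) (act-ε x))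

------------------------------------------------------------------------
-- Polynomials, as lists of coefficients with the constant term first

module Polynomial (R : CommutativeRing a b) where

  open CommutativeRing R

  Poly : Set a
  Poly = List Carrier

  coeff : Poly → ℕ → Carrier
  coeff []      i       = 0#
  coeff (x ∷ f) zero    = x
  coeff (x ∷ f) (suc i) = coeff f i

  -- Trailing zeros are allowed, so equality is equality of all coefficients.
  infix 4 _≈ₚ_
  _≈ₚ_ : Poly → Poly → Set b
  f ≈ₚ g = ∀ i → coeff f i ≈ coeff g i

  infixl 6 _+ₚ_
  _+ₚ_ : Poly → Poly → Poly
  []      +ₚ g       = g
  (x ∷ f) +ₚ []      = x ∷ f
  (x ∷ f) +ₚ (y ∷ g) = (x + y) ∷ (f +ₚ g)

  infixl 7 _*ₚ_
  _*ₚ_ : Poly → Poly → Poly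
  []      *ₚ g = []
  (x ∷ f) *ₚ g = List.map (x *_) g +ₚ (0# ∷ (f *ₚ g))

  rawSemiring : RawSemiring a b
  rawSemiring = record
    { Carrier = Poly
    ; _≈_     = _≈ₚ_
    ; _+_     = _+ₚ_
    ; _*_     = _*ₚ_
    ; 0#      = []
    ; 1#      = 1# ∷ []
    }

  open RawSemiringOps rawSemiring public using (Irreducible)

  MonicOfDegree : ℕ → Poly → Set b
  MonicOfDegree m f = coeff f m ≈ 1# × (∀ i → m < i → coeff f i ≈ 0#)

  -- The value at y of the polynomial with coefficients mapped to A by φ.
  eval : (A : CommutativeRing a₂ b₂) → (Carrier → CommutativeRing.Carrier A) →
         Poly → CommutativeRing.Carrier A → CommutativeRing.Carrier A
  eval A φ []      y = CommutativeRing.0# A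
  eval A φ (x ∷ f) y = φ x A.+ y A.* eval A φ f y
    where module A = CommutativeRing A

------------------------------------------------------------------------
-- Fields

-- Unlike HeytingField, this uses no apartness: every x with ¬ (x ≈ 0#) is
-- invertible, as is appropriate for finite fields.
record Field a b : Set (lsuc (a ⊔ b)) where
  infix 8 _⁻¹
  field
    commutativeRing : CommutativeRing a b
  open CommutativeRing commutativeRing public
  field
    1≉0         : ¬ (1# ≈ 0#)
    -- The value of 0# ⁻¹ is unspecified.
    _⁻¹         : Carrier → Carrier
    *-inverseʳ  : ∀ x → ¬ (x ≈ 0#) → x * x ⁻¹ ≈ 1#

HasOrder : Setoid a b → ℕ → Set (a ⊔ b)
HasOrder S m = Inverse S (≡.setoid (Fin m))

record Subfield (L : Field a b) r : Set (a ⊔ b ⊔ lsuc r) where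
  open Field L using (Carrier; _≈_; _+_; _*_; -_; 0#; 1#; _⁻¹)
  infix 4 _∈
  field
    _∈        : Pred Carrier r
    resp      : _∈ Respects _≈_
    +-closed  : ∀ {x y} → x ∈ → y ∈ → x + y ∈
    *-closed  : ∀ {x y} → x ∈ → y ∈ → x * y ∈
    -‿closed  : ∀ {x} → x ∈ → - x ∈
    0-closed  : 0# ∈
    1-closed  : 1# ∈
    ⁻¹-closed : ∀ {x} → ¬ (x ≈ 0#) → x ∈ → x ⁻¹ ∈

  rawRing : RawRing (a ⊔ r) b
  rawRing = record
    { Carrier = Σ Carrier _∈
    ; _≈_     = λ x y → proj₁ x ≈ proj₁ y
    ; _+_     = λ x y → proj₁ x + proj₁ y , +-closed (proj₂ x) (proj₂ y)
    ; _*_     = λ x y → proj₁ x * proj₁ y , *-closed (proj₂ x) (proj₂ y)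
    ; -_      = λ x → - proj₁ x , -‿closed (proj₂ x)
    ; 0#      = 0# , 0-closed
    ; 1#      = 1# , 1-closed
    }

  private
    inclusion : RingMorphisms.IsRingMonomorphism rawRing (Field.rawRing L) proj₁
    inclusion = record
      { isRingHomomorphism = record
        { isSemiringHomomorphism = record
          { isNearSemiringHomomorphism = record
            { +-isMonoidHomomorphism = record
              { isMagmaHomomorphism = record
                { isRelHomomorphism = record { cong = id }
                ; homo              = λ _ _ → Field.refl L
                }
              ; ε-homo = Field.refl L
              }
            ; *-homo = λ _ _ → Field.refl L
            }
          ; 1#-homo = Field.refl L
          }
        ; -‿homo = λ _ → Field.refl L
        }
      ; injective = id
      }

  commutativeRing : CommutativeRing (a ⊔ r) b
  commutativeRing = record
    { isCommutativeRing =
        RingMonomorphism.isCommutativeRing inclusion (Field.isCommutativeRing L)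
    }

  open CommutativeRing commutativeRing public using (setoid) renaming (Carrier to Elem)

------------------------------------------------------------------------
-- The group of automorphisms of E fixing the elements of P

module RingAutomorphisms (E : CommutativeRing a b) (P : Pred (CommutativeRing.Carrier E) r) where

  open CommutativeRing E
  private
    IsRingHom : (Carrier → Carrier) → Set (a ⊔ b)
    IsRingHom = RingMorphisms.IsRingHomomorphism rawRing rawRing

  record Automorphism : Set (a ⊔ b ⊔ r) where
    field
      to       : Carrier → Carrier
      from     : Carrier → Carrier
      to-hom   : IsRingHom to
      from-hom : IsRingHom from
      to∘from  : ∀ x → to (from x) ≈ x
      from∘to  : ∀ x → from (to x) ≈ x
      fixes    : ∀ {x} → P x → to x ≈ x

    open RingMorphisms.IsRingHomomorphism to-hom public
      using (+-homo; *-homo; 0#-homo; 1#-homo; -‿homo) renaming (⟦⟧-cong to to-cong)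
    open RingMorphisms.IsRingHomomorphism from-hom public
      using () renaming (⟦⟧-cong to from-cong)

  open Automorphism

  idₐ : Automorphism
  idₐ = record
    { to = id ; from = id
    ; to-hom   = RingIdentity.isRingHomomorphism rawRing refl
    ; from-hom = RingIdentity.isRingHomomorphism rawRing refl
    ; to∘from = λ _ → refl ; from∘to = λ _ → refl
    ; fixes = λ _ → refl
    }

  infixl 7 _∘ₐ_
  _∘ₐ_ : Automorphism → Automorphism → Automorphism
  ρ ∘ₐ τ = record
    { to       = to ρ ∘ to τ
    ; from     = from τ ∘ from ρ
    ; to-hom   = RingComposition.isRingHomomorphism trans (to-hom τ) (to-hom ρ)
    ; from-hom = RingComposition.isRingHomomorphism trans (from-hom ρ) (from-hom τ)
    ; to∘from  = λ x → trans (to-cong ρ (to∘from τ _)) (to∘from ρ x)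
    ; from∘to  = λ x → trans (from-cong τ (from∘to ρ _)) (from∘to τ x)
    ; fixes    = λ x∈P → trans (to-cong ρ (fixes τ x∈P)) (fixes ρ x∈P)
    }

  infix 8 _⁻¹ₐ
  _⁻¹ₐ : Automorphism → Automorphism
  ρ ⁻¹ₐ = record
    { to = from ρ ; from = to ρ
    ; to-hom = from-hom ρ ; from-hom = to-hom ρ
    ; to∘from = from∘to ρ ; from∘to = to∘from ρ
    ; fixes = λ x∈P → trans (from-cong ρ (sym (fixes ρ x∈P))) (from∘to ρ _)
    }

  infix 4 _≈ₐ_
  _≈ₐ_ : Automorphism → Automorphism → Set (a ⊔ b)
  ρ ≈ₐ τ = ∀ x → to ρ x ≈ to τ x

  ⁻¹ₐ-cong : ∀ ρ τ → ρ ≈ₐ τ → ρ ⁻¹ₐ ≈ₐ τ ⁻¹ₐ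
  ⁻¹ₐ-cong ρ τ eq x = begin
    from ρ x                   ≈⟨ from-cong ρ (to∘from τ x) ⟨
    from ρ (to τ (from τ x))   ≈⟨ from-cong ρ (eq (from τ x)) ⟨
    from ρ (to ρ (from τ x))   ≈⟨ from∘to ρ _ ⟩
    from τ x                   ∎
    where open SetoidReasoning setoid

  automorphismGroup : Group (a ⊔ b ⊔ r) (a ⊔ b)
  automorphismGroup = record
    { Carrier = Automorphism
    ; _≈_ = _≈ₐ_
    ; _∙_ = _∘ₐ_
    ; ε   = idₐ
    ; _⁻¹ = _⁻¹ₐ
    ; isGroup = record
      { isMonoid = record
        { isSemigroup = record
          { isMagma = record
            { isEquivalence = record
              { refl  = λ _ → refl
              ; sym   = λ eq x → sym (eq x)
              ; trans = λ eq eq′ x → trans (eq x) (eq′ x)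
              }
            ; ∙-cong = λ {ρ} {ρ′} {τ} {τ′} eq eq′ x → trans (to-cong ρ (eq′ x)) (eq (to τ′ x))
            }
          ; assoc = λ _ _ _ _ → refl
          }
        ; identity = (λ _ _ → refl) , (λ _ _ → refl)
        }
      ; inverse = from∘to , to∘from
      ; ⁻¹-cong = λ {ρ} {τ} → ⁻¹ₐ-cong ρ τ
      }
    }

------------------------------------------------------------------------
-- Endomorphisms of an E-module V

module Endomorphisms (E : CommutativeRing a b) (V : LeftModule (CommutativeRing.ring E) a₂ b₂) where

  open CommutativeRing E using (Carrier; _≈_; 0#)
  open LeftModule V

  record End : Set (a ⊔ a₂ ⊔ b₂) where
    field
      ⟦_⟧      : Carrierᴹ → Carrierᴹ
      isLinear : LinearMorphisms.LeftModuleMorphisms.IsLeftModuleHomomorphism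
                   rawLeftModule rawLeftModule ⟦_⟧
    open LinearMorphisms.LeftModuleMorphisms.IsLeftModuleHomomorphism isLinear public
      using (⟦⟧-cong; +ᴹ-homo; *ₗ-homo)

  open End public using (⟦_⟧)

  infix 4 _≈ₑ_
  _≈ₑ_ : End → End → Set (a₂ ⊔ b₂)
  A ≈ₑ B = ∀ v → ⟦ A ⟧ v ≈ᴹ ⟦ B ⟧ v

  endSetoid : Setoid (a ⊔ a₂ ⊔ b₂) (a₂ ⊔ b₂)
  endSetoid = record
    { _≈_ = _≈ₑ_
    ; isEquivalence = record
      { refl  = λ _ → ≈ᴹ-refl
      ; sym   = λ eq v → ≈ᴹ-sym (eq v)
      ; trans = λ eq eq′ v → ≈ᴹ-trans (eq v) (eq′ v)
      }
    }

  idₑ : End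
  idₑ = record
    { ⟦_⟧ = id ; isLinear = LinearIdentity.isLeftModuleHomomorphism rawLeftModule ≈ᴹ-refl }

  infixl 7 _∘ₑ_
  _∘ₑ_ : End → End → End
  A ∘ₑ B = record
    { ⟦_⟧      = ⟦ A ⟧ ∘ ⟦ B ⟧
    ; isLinear = LinearComposition.isLeftModuleHomomorphism ≈ᴹ-trans (End.isLinear B) (End.isLinear A)
    }

  record Invertible : Set (a ⊔ a₂ ⊔ b₂) where
    field
      to      : End
      from    : End
      to∘from : to ∘ₑ from ≈ₑ idₑ
      from∘to : from ∘ₑ to ≈ₑ idₑ

  open Invertible

  GL : Group (a ⊔ a₂ ⊔ b₂) (a₂ ⊔ b₂)
  GL = record
    { Carrier = Invertible
    ; _≈_ = λ M N → to M ≈ₑ to N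
    ; _∙_ = λ M N → record
      { to      = to M ∘ₑ to N
      ; from    = from N ∘ₑ from M
      ; to∘from = λ v → ≈ᴹ-trans (End.⟦⟧-cong (to M) (to∘from N _)) (to∘from M v)
      ; from∘to = λ v → ≈ᴹ-trans (End.⟦⟧-cong (from N) (from∘to M _)) (from∘to N v)
      }
    ; ε   = record { to = idₑ ; from = idₑ ; to∘from = λ _ → ≈ᴹ-refl ; from∘to = λ _ → ≈ᴹ-refl }
    ; _⁻¹ = λ M → record { to = from M ; from = to M ; to∘from = from∘to M ; from∘to = to∘from M }
    ; isGroup = record
      { isMonoid = record
        { isSemigroup = record
          { isMagma = record
            { isEquivalence = record
              { refl  = λ _ → ≈ᴹ-refl
              ; sym   = λ eq v → ≈ᴹ-sym (eq v)
              ; trans = λ eq eq′ v → ≈ᴹ-trans (eq v) (eq′ v)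
              }
            ; ∙-cong = λ {M} {M′} {N} {N′} eq eq′ v →
                ≈ᴹ-trans (End.⟦⟧-cong (to M) (eq′ v)) (eq _)
            }
          ; assoc = λ _ _ _ _ → ≈ᴹ-refl
          }
        ; identity = (λ _ _ → ≈ᴹ-refl) , (λ _ _ → ≈ᴹ-refl)
        }
      ; inverse = from∘to , to∘from
      ; ⁻¹-cong = λ {M} {N} eq v →
          ≈ᴹ-trans (End.⟦⟧-cong (from M) (≈ᴹ-trans (≈ᴹ-sym (to∘from N v)) (≈ᴹ-sym (eq _))))
                   (from∘to M _)
      }
    }

  private
    module ∑ = Sum +ᴹ-commutativeMonoid
    module E = CommutativeRing E

  linearCombination : ∀ {m} → Vector Carrierᴹ m → Vector Carrier m → Carrierᴹ
  linearCombination v x = ∑.sum (λ i → x i *ₗ v i)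

  record Basis (m : ℕ) : Set (a ⊔ b ⊔ a₂ ⊔ b₂) where
    field
      vec         : Vector Carrierᴹ m
      independent : ∀ x → linearCombination vec x ≈ᴹ 0ᴹ → ∀ i → x i ≈ 0#
      spanning    : ∀ v → ∃ λ x → v ≈ᴹ linearCombination vec x

    coord : Carrierᴹ → Vector Carrier m
    coord v = proj₁ (spanning v)

    lin : Vector Carrier m → Carrierᴹ
    lin = linearCombination vec

    lin-cong : ∀ {x y} → (∀ i → x i ≈ y i) → lin x ≈ᴹ lin y
    lin-cong eq = ∑.sum-cong-≋ (λ i → *ₗ-congʳ (eq i))

    lin-+ : ∀ x y → lin (λ i → x i E.+ y i) ≈ᴹ lin x +ᴹ lin y
    lin-+ x y = ≈ᴹ-trans (∑.sum-cong-≋ (λ i → *ₗ-distribʳ (vec i) (x i) (y i)))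
                         (∑.∑-distrib-+ (λ i → x i *ₗ vec i) (λ i → y i *ₗ vec i))

    lin-* : ∀ z x → lin (λ i → z E.* x i) ≈ᴹ z *ₗ lin x
    lin-* z x = ≈ᴹ-trans (∑.sum-cong-≋ (λ i → *ₗ-assoc z (x i) (vec i))) (scale _ (λ i → x i *ₗ vec i))
      where
      scale : ∀ m (f : Vector Carrierᴹ m) → ∑.sum (λ i → z *ₗ f i) ≈ᴹ z *ₗ ∑.sum f
      scale zero    f = ≈ᴹ-sym (*ₗ-zeroʳ z)
      scale (suc m) f = ≈ᴹ-trans (+ᴹ-congˡ (scale m (f ∘ suc))) (≈ᴹ-sym (*ₗ-distribˡ z _ _))

    lin-injective : ∀ x y → lin x ≈ᴹ lin y → ∀ i → x i ≈ y i
    lin-injective x y eq i = begin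
      x i                         ≈⟨ E.+-identityʳ (x i) ⟨
      x i E.+ 0#                  ≈⟨ E.+-congˡ (E.-‿inverseˡ (y i)) ⟨
      x i E.+ (E.- y i E.+ y i)   ≈⟨ E.+-assoc _ _ _ ⟨
      (x i E.- y i) E.+ y i       ≈⟨ E.+-congʳ (independent (λ j → x j E.- y j) lin≈0 i) ⟩
      0# E.+ y i                  ≈⟨ E.+-identityˡ (y i) ⟩
      y i                         ∎
      where
      open SetoidReasoning E.setoid
      lin≈0 : lin (λ j → x j E.- y j) ≈ᴹ 0ᴹ
      lin≈0 = ≈ᴹ-trans (lin-+ x (λ j → E.- y j))
             (≈ᴹ-trans (+ᴹ-congʳ eq)
             (≈ᴹ-trans (≈ᴹ-sym (lin-+ y (λ j → E.- y j)))
             (≈ᴹ-trans (lin-cong (λ j → E.trans (E.-‿inverseʳ (y j)) (E.sym (E.zeroˡ 0#))))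
             (≈ᴹ-trans (lin-* 0# (λ _ → 0#)) (*ₗ-zeroˡ _)))))

    coord-lin : ∀ x i → coord (lin x) i ≈ x i
    coord-lin x = lin-injective _ x (≈ᴹ-sym (proj₂ (spanning (lin x))))

    coord-cong : ∀ {v v′} → v ≈ᴹ v′ → ∀ i → coord v i ≈ coord v′ i
    coord-cong {v} {v′} eq = lin-injective _ _
      (≈ᴹ-trans (≈ᴹ-sym (proj₂ (spanning v))) (≈ᴹ-trans eq (proj₂ (spanning v′))))

    coord-+ : ∀ v v′ i → coord (v +ᴹ v′) i ≈ coord v i E.+ coord v′ i
    coord-+ v v′ = lin-injective _ _
      (≈ᴹ-trans (≈ᴹ-sym (proj₂ (spanning (v +ᴹ v′))))
      (≈ᴹ-trans (+ᴹ-cong (proj₂ (spanning v)) (proj₂ (spanning v′)))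
                (≈ᴹ-sym (lin-+ (coord v) (coord v′)))))

    coord-* : ∀ z v i → coord (z *ₗ v) i ≈ z E.* coord v i
    coord-* z v = lin-injective _ _
      (≈ᴹ-trans (≈ᴹ-sym (proj₂ (spanning (z *ₗ v))))
      (≈ᴹ-trans (*ₗ-congˡ (proj₂ (spanning v))) (≈ᴹ-sym (lin-* z (coord v)))))

  linear : (f : Carrierᴹ → Carrierᴹ) → (∀ {u v} → u ≈ᴹ v → f u ≈ᴹ f v) →
           (∀ u v → f (u +ᴹ v) ≈ᴹ f u +ᴹ f v) → (∀ z v → f (z *ₗ v) ≈ᴹ z *ₗ f v) → End
  linear f f-cong f-+ f-* = record
    { ⟦_⟧      = f
    ; isLinear = record
      { +ᴹ-isGroupHomomorphism = record
        { isMonoidHomomorphism = record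
          { isMagmaHomomorphism = record
            { isRelHomomorphism = record { cong = f-cong } ; homo = f-+ }
          ; ε-homo = f-0
          }
        ; ⁻¹-homo = λ v → GroupProperties.inverseˡ-unique +ᴹ-group (f (-ᴹ v)) (f v)
            (≈ᴹ-trans (≈ᴹ-sym (f-+ (-ᴹ v) v)) (≈ᴹ-trans (f-cong (-ᴹ‿inverseˡ v)) f-0))
        }
      ; *ₗ-homo = f-*
      }
    }
    where
    f-0 : f 0ᴹ ≈ᴹ 0ᴹ
    f-0 = ≈ᴹ-trans (f-cong (≈ᴹ-sym (*ₗ-zeroˡ 0ᴹ))) (≈ᴹ-trans (f-* 0# 0ᴹ) (*ₗ-zeroˡ (f 0ᴹ)))

------------------------------------------------------------------------
-- Automorphism groups of a set 𝒟 of endomorphisms, relative to a basis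

module CodeAutomorphisms
  (E : CommutativeRing a b) (P : Pred (CommutativeRing.Carrier E) r)
  (V : LeftModule (CommutativeRing.ring E) a₂ b₂) (m : ℕ) (B : Endomorphisms.Basis E V m)
  where

  open LeftModule V
  open RingAutomorphisms E P public
  open Endomorphisms E V public
  open Endomorphisms.Basis B
  open Automorphism
  private
    module E = CommutativeRing E
    module GL = Group GL
    module Γ = Group automorphismGroup
    module I = Invertible

  L : Automorphism → Carrierᴹ → Carrierᴹ
  L ρ v = lin (λ i → to ρ (coord v i))

  L-cong : ∀ ρ τ {u v} → ρ ≈ₐ τ → u ≈ᴹ v → L ρ u ≈ᴹ L τ v
  L-cong ρ τ eq u≈v = lin-cong (λ i → E.trans (to-cong ρ (coord-cong u≈v i)) (eq _))

  L-id : ∀ v → L idₐ v ≈ᴹ v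
  L-id v = ≈ᴹ-sym (proj₂ (spanning v))

  L-∘ : ∀ ρ τ v → L ρ (L τ v) ≈ᴹ L (ρ ∘ₐ τ) v
  L-∘ ρ τ v = lin-cong (λ i → to-cong ρ (coord-lin (λ j → to τ (coord v j)) i))

  L-inverseˡ : ∀ ρ v → L (ρ ⁻¹ₐ) (L ρ v) ≈ᴹ v
  L-inverseˡ ρ v = ≈ᴹ-trans (L-∘ (ρ ⁻¹ₐ) ρ v)
    (≈ᴹ-trans (L-cong (ρ ⁻¹ₐ ∘ₐ ρ) idₐ (from∘to ρ) ≈ᴹ-refl) (L-id v))

  L-+ : ∀ ρ u v → L ρ (u +ᴹ v) ≈ᴹ L ρ u +ᴹ L ρ v
  L-+ ρ u v = ≈ᴹ-trans
    (lin-cong (λ i → E.trans (to-cong ρ (coord-+ u v i)) (+-homo ρ _ _)))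
    (lin-+ (λ i → to ρ (coord u i)) (λ i → to ρ (coord v i)))

  L-semilinear : ∀ ρ z v → L ρ (z *ₗ v) ≈ᴹ to ρ z *ₗ L ρ v
  L-semilinear ρ z v = ≈ᴹ-trans
    (lin-cong (λ i → E.trans (to-cong ρ (coord-* z v i)) (*-homo ρ _ _)))
    (lin-* (to ρ z) (λ i → to ρ (coord v i)))

  -- A ^ρ = L_ρ A L_ρ⁻¹, where L_ρ⁻¹ = L_{ρ⁻¹} by L-inverseˡ.
  conj : Automorphism → End → End
  conj ρ A = linear
    (λ v → L ρ (⟦ A ⟧ (L (ρ ⁻¹ₐ) v)))
    (λ eq → L-cong ρ ρ (λ _ → E.refl) (A.⟦⟧-cong (L-cong (ρ ⁻¹ₐ) (ρ ⁻¹ₐ) (λ _ → E.refl) eq)))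
    (λ u v → ≈ᴹ-trans (L-cong ρ ρ (λ _ → E.refl) (≈ᴹ-trans (A.⟦⟧-cong (L-+ (ρ ⁻¹ₐ) u v)) (A.+ᴹ-homo _ _)))
                      (L-+ ρ _ _))
    (λ z v → ≈ᴹ-trans (L-cong ρ ρ (λ _ → E.refl)
                        (≈ᴹ-trans (A.⟦⟧-cong (L-semilinear (ρ ⁻¹ₐ) z v)) (A.*ₗ-homo _ _)))
             (≈ᴹ-trans (L-semilinear ρ _ _) (*ₗ-congʳ (to∘from ρ z))))
    where module A = End A

  conj-cong : ∀ ρ τ A A′ → ρ ≈ₐ τ → A ≈ₑ A′ → conj ρ A ≈ₑ conj τ A′
  conj-cong ρ τ A A′ ρ≈τ A≈A′ v = L-cong ρ τ ρ≈τ
    (≈ᴹ-trans (End.⟦⟧-cong A (L-cong (ρ ⁻¹ₐ) (τ ⁻¹ₐ) (⁻¹ₐ-cong ρ τ ρ≈τ) ≈ᴹ-refl)) (A≈A′ _))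

  conj-id : ∀ A → conj idₐ A ≈ₑ A
  conj-id A v = ≈ᴹ-trans (L-id _) (End.⟦⟧-cong A (L-id v))

  conj-∘ : ∀ ρ A B → conj ρ (A ∘ₑ B) ≈ₑ conj ρ A ∘ₑ conj ρ B
  conj-∘ ρ A B v = L-cong ρ ρ (λ _ → E.refl) (End.⟦⟧-cong A (≈ᴹ-sym (L-inverseˡ ρ _)))

  conj-idₑ : ∀ ρ → conj ρ idₑ ≈ₑ idₑ
  conj-idₑ ρ = L-inverseˡ (ρ ⁻¹ₐ)

  conj-conj : ∀ ρ τ A → conj ρ (conj τ A) ≈ₑ conj (ρ ∘ₐ τ) A
  conj-conj ρ τ A v = ≈ᴹ-trans (L-∘ ρ τ _)
    (L-cong (ρ ∘ₐ τ) (ρ ∘ₐ τ) (λ _ → E.refl) (End.⟦⟧-cong A (L-∘ (τ ⁻¹ₐ) (ρ ⁻¹ₐ) v)))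

  conjGL : Automorphism → Invertible → Invertible
  conjGL ρ M = record
    { to      = conj ρ (I.to M)
    ; from    = conj ρ (I.from M)
    ; to∘from = λ v → ≈ᴹ-trans (≈ᴹ-sym (conj-∘ ρ (I.to M) (I.from M) v))
        (≈ᴹ-trans (conj-cong ρ ρ (I.to M ∘ₑ I.from M) idₑ (λ _ → E.refl) (I.to∘from M) v) (conj-idₑ ρ v))
    ; from∘to = λ v → ≈ᴹ-trans (≈ᴹ-sym (conj-∘ ρ (I.from M) (I.to M) v))
        (≈ᴹ-trans (conj-cong ρ ρ (I.from M ∘ₑ I.to M) idₑ (λ _ → E.refl) (I.from∘to M) v) (conj-idₑ ρ v))
    }

  -- The triples (M , N , ρ), with (M , N , ρ)(M′ , N′ , ρ′) = (M M′^ρ , N′^ρ N , ρ ρ′).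
  semilinearPairs : Group (a ⊔ b ⊔ a₂ ⊔ b₂ ⊔ r) (a ⊔ b ⊔ a₂ ⊔ b₂)
  semilinearPairs = record
    { Carrier = Invertible × Invertible × Automorphism
    ; _≈_ = λ (M , N , ρ) (M′ , N′ , ρ′) → M GL.≈ M′ × N GL.≈ N′ × ρ ≈ₐ ρ′
    ; _∙_ = λ (M , N , ρ) (M′ , N′ , ρ′) → M GL.∙ conjGL ρ M′ , conjGL ρ N′ GL.∙ N , ρ ∘ₐ ρ′
    ; ε   = GL.ε , GL.ε , idₐ
    ; _⁻¹ = λ (M , N , ρ) → conjGL (ρ ⁻¹ₐ) (M GL.⁻¹) , conjGL (ρ ⁻¹ₐ) (N GL.⁻¹) , ρ ⁻¹ₐ
    ; isGroup = record
      { isMonoid = record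
        { isSemigroup = record
          { isMagma = record
            { isEquivalence = record
              { refl  = λ {(M , N , ρ)} → GL.refl {M} , GL.refl {N} , Γ.refl {ρ}
              ; sym   = λ {(M , N , ρ)} {(M′ , N′ , ρ′)} (eq₁ , eq₂ , eq₃) →
                  GL.sym {M} {M′} eq₁ , GL.sym {N} {N′} eq₂ , Γ.sym {ρ} {ρ′} eq₃
              ; trans = λ {(M , N , ρ)} {(M′ , N′ , ρ′)} {(M″ , N″ , ρ″)} (eq₁ , eq₂ , eq₃) (eq₁′ , eq₂′ , eq₃′) →
                  GL.trans {M} {M′} {M″} eq₁ eq₁′ , GL.trans {N} {N′} {N″} eq₂ eq₂′ ,
                  Γ.trans {ρ} {ρ′} {ρ″} eq₃ eq₃′
              }
            ; ∙-cong = λ {(M , N , ρ)} {(M′ , N′ , ρ′)} {(K , J , τ)} {(K′ , J′ , τ′)} (eq₁ , eq₂ , eq₃) (eq₁′ , eq₂′ , eq₃′) →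
                GL.∙-cong {M} {M′} {conjGL ρ K} {conjGL ρ′ K′} eq₁
                  (conj-cong ρ ρ′ (I.to K) (I.to K′) eq₃ eq₁′) ,
                GL.∙-cong {conjGL ρ J} {conjGL ρ′ J′} {N} {N′}
                  (conj-cong ρ ρ′ (I.to J) (I.to J′) eq₃ eq₂′) eq₂ ,
                Γ.∙-cong {ρ} {ρ′} {τ} {τ′} eq₃ eq₃′
            }
          ; assoc = λ (M , N , ρ) (M′ , N′ , ρ′) (M″ , N″ , ρ″) →
              (λ v → End.⟦⟧-cong (I.to M) (≈ᴹ-sym
                (≈ᴹ-trans (conj-∘ ρ (I.to M′) (conj ρ′ (I.to M″)) v)
                          (End.⟦⟧-cong (conj ρ (I.to M′)) (conj-conj ρ ρ′ (I.to M″) v))))) ,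
              (λ v → ≈ᴹ-sym
                (≈ᴹ-trans (conj-∘ ρ (conj ρ′ (I.to N″)) (I.to N′) (⟦ I.to N ⟧ v))
                          (conj-conj ρ ρ′ (I.to N″) _))) ,
              (λ _ → E.refl)
          }
        ; identity =
            (λ (M , N , ρ) → conj-id (I.to M) , conj-id (I.to N) , λ _ → E.refl) ,
            (λ (M , N , ρ) → (λ v → End.⟦⟧-cong (I.to M) (conj-idₑ ρ v)) ,
                             (λ v → conj-idₑ ρ _) , λ _ → E.refl)
        }
      ; inverse =
          (λ (M , N , ρ) →
            GL.inverseˡ (conjGL (ρ ⁻¹ₐ) M) , GL.inverseʳ (conjGL (ρ ⁻¹ₐ) N) , from∘to ρ) ,
          (λ (M , N , ρ) →
            (λ v → ≈ᴹ-trans (End.⟦⟧-cong (I.to M) (conj-⁻¹ ρ (I.from M) v)) (I.to∘from M v)) ,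
            (λ v → ≈ᴹ-trans (conj-⁻¹ ρ (I.from N) _) (I.from∘to N v)) ,
            to∘from ρ)
      ; ⁻¹-cong = λ {(M , N , ρ)} {(M′ , N′ , ρ′)} (eq₁ , eq₂ , eq₃) →
          conj-cong (ρ ⁻¹ₐ) (ρ′ ⁻¹ₐ) (I.from M) (I.from M′) (⁻¹ₐ-cong ρ ρ′ eq₃) (GL.⁻¹-cong {M} {M′} eq₁) ,
          conj-cong (ρ ⁻¹ₐ) (ρ′ ⁻¹ₐ) (I.from N) (I.from N′) (⁻¹ₐ-cong ρ ρ′ eq₃) (GL.⁻¹-cong {N} {N′} eq₂) ,
          ⁻¹ₐ-cong ρ ρ′ eq₃
      }
    }
    where
    conj-⁻¹ : ∀ ρ A → conj ρ (conj (ρ ⁻¹ₐ) A) ≈ₑ A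
    conj-⁻¹ ρ A v = ≈ᴹ-trans (conj-conj ρ (ρ ⁻¹ₐ) A v)
      (≈ᴹ-trans (conj-cong (ρ ∘ₐ ρ ⁻¹ₐ) idₐ A A (to∘from ρ) (λ _ → ≈ᴹ-refl) v) (conj-id A v))

  linearPairs : Group (a ⊔ a₂ ⊔ b₂) (a₂ ⊔ b₂)
  linearPairs = DirectProduct.group GL (Flip.group GL)

  infix 8 _⟨_⟩_
  _⟨_⟩_ : Invertible → End → Invertible → End
  M ⟨ A ⟩ N = I.to M ∘ₑ A ∘ₑ I.to N

  ⟨⟩-cong : ∀ {M M′ N N′ A A′} → M GL.≈ M′ → N GL.≈ N′ → A ≈ₑ A′ → M ⟨ A ⟩ N ≈ₑ M′ ⟨ A′ ⟩ N′
  ⟨⟩-cong {M} {A = A} M≈ N≈ A≈ v =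
    ≈ᴹ-trans (End.⟦⟧-cong (I.to M) (≈ᴹ-trans (End.⟦⟧-cong A (N≈ v)) (A≈ _))) (M≈ _)

  infixr 8 _⋆_ _•_
  _⋆_ : Group.Carrier semilinearPairs → End → End
  (M , N , ρ) ⋆ A = M ⟨ conj ρ A ⟩ N

  _•_ : Group.Carrier linearPairs → End → End
  (M , N) • A = M ⟨ A ⟩ N

  ⋆-cong : ∀ x y A A′ → Group._≈_ semilinearPairs x y → A ≈ₑ A′ → x ⋆ A ≈ₑ y ⋆ A′
  ⋆-cong (M , N , ρ) (M′ , N′ , ρ′) A A′ (eq₁ , eq₂ , eq₃) A≈A′ =
    ⟨⟩-cong {M} {M′} {N} {N′} {conj ρ A} {conj ρ′ A′} eq₁ eq₂ (conj-cong ρ ρ′ A A′ eq₃ A≈A′)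

  ⋆-∙ : ∀ x y A → Group._∙_ semilinearPairs x y ⋆ A ≈ₑ x ⋆ (y ⋆ A)
  ⋆-∙ (M , N , ρ) (M′ , N′ , ρ′) A v = End.⟦⟧-cong (I.to M) (≈ᴹ-sym
    (≈ᴹ-trans (conj-∘ ρ (I.to M′ ∘ₑ conj ρ′ A) (I.to N′) _)
    (≈ᴹ-trans (conj-∘ ρ (I.to M′) (conj ρ′ A) _)
              (End.⟦⟧-cong (conj ρ (I.to M′)) (conj-conj ρ ρ′ A _)))))

  •-cong : ∀ x y A A′ → Group._≈_ linearPairs x y → A ≈ₑ A′ → x • A ≈ₑ y • A′
  •-cong (M , N) (M′ , N′) A A′ (eq₁ , eq₂) = ⟨⟩-cong {M} {M′} {N} {N′} {A} {A′} eq₁ eq₂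

  module _ (𝒟 : Pred End a₃) (𝒟-resp : ∀ A A′ → A ≈ₑ A′ → 𝒟 A → 𝒟 A′) where

    private
      module AutStabiliser = Stabiliser semilinearPairs endSetoid
        _⋆_ ⋆-cong conj-id ⋆-∙ 𝒟 𝒟-resp

      module Aut-EStabiliser = Stabiliser linearPairs endSetoid
        _•_ •-cong (λ _ _ → ≈ᴹ-refl) (λ _ _ _ _ → ≈ᴹ-refl) 𝒟 𝒟-resp

    -- The (M , N , ρ) with M 𝒟^ρ N = 𝒟.
    Aut : Group (a ⊔ b ⊔ a₂ ⊔ b₂ ⊔ r ⊔ a₃) (a ⊔ b ⊔ a₂ ⊔ b₂)
    Aut = subgroup semilinearPairs AutStabiliser.isSubgroup

    -- The (M , N) with M 𝒟 N = 𝒟.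
    Aut-E : Group (a ⊔ a₂ ⊔ b₂ ⊔ a₃) (a₂ ⊔ b₂)
    Aut-E = subgroup linearPairs Aut-EStabiliser.isSubgroup

    π : Group.Carrier Aut → Automorphism
    π ((_ , _ , ρ) , _) = ρ

    π-hom : IsHom Aut automorphismGroup π
    π-hom = record
      { isMonoidHomomorphism = record
        { isMagmaHomomorphism = record
          { isRelHomomorphism = record { cong = λ (_ , _ , eq) → eq }
          ; homo              = λ _ _ _ → E.refl
          }
        ; ε-homo = λ _ → E.refl
        }
      ; ⁻¹-homo = λ _ _ → E.refl
      }

    -- (M , N) ↦ (M , N , id)
    ι : Group.Carrier Aut-E → Group.Carrier Aut
    ι ((M , N) , s) = (M , N , idₐ) ,
      (λ (A , A∈ , eq) → proj₁ s (A , A∈ , λ v → ≈ᴹ-trans (eq v) (drop A v))) ,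
      (λ A∈ → let (A , A∈ , eq) = proj₂ s A∈ in
        A , A∈ , λ v → ≈ᴹ-trans (eq v) (≈ᴹ-sym (drop A v)))
      where
      drop : ∀ A → M ⟨ conj idₐ A ⟩ N ≈ₑ M ⟨ A ⟩ N
      drop A v = End.⟦⟧-cong (I.to M) (conj-id A _)

    Ker-π : Group (a ⊔ b ⊔ a₂ ⊔ b₂ ⊔ r ⊔ a₃) (a ⊔ b ⊔ a₂ ⊔ b₂)
    Ker-π = Kernel.kernel Aut automorphismGroup π π-hom

    ι-Ker : Group.Carrier Aut-E → Group.Carrier Ker-π
    ι-Ker x = ι x , λ _ → E.refl

------------------------------------------------------------------------
-- The codes

record Parameters : Set where
  field
    p e n s k h : ℕ
    p-prime  : Prime p
    1≤e      : 1 ≤ e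
    2≤n      : 2 ≤ n
    2≤s      : 2 ≤ s
    1≤k      : 1 ≤ k
    k≤n-1    : k ≤ n ∸ 1
    gcd[h,n] : gcd h n ≡ 1

  q : ℕ
  q = p ℕ.^ e

  ℓ : ℕ
  ℓ = gcd n s

  field
    n′        : ℕ
    n≡n′ℓ     : n ≡ n′ ℕ.* ℓ
    c         : ℕ
    c′        : ℤ
    0<c       : 0 < c
    ℓ≡cs+c′n  : + ℓ ≡ + c ℤ.* + s ℤ.+ c′ ℤ.* + n
    gcd[c,n′] : gcd c n′ ≡ 1

record Setup a b r : Set (lsuc (a ⊔ b ⊔ r)) where
  field
    parameters : Parameters
  open Parameters parameters public

  field
    𝕃           : Field a b
    -- ns/ℓ = n′s
    order-𝕃     : HasOrder (Field.setoid 𝕃) (q ℕ.^ (n′ ℕ.* s))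
    -- A finite field has at most one subfield of any given order.
    𝔽ₚ 𝔽q 𝕂 𝔽   : Subfield 𝕃 r
    order-𝔽ₚ    : HasOrder (Subfield.setoid 𝔽ₚ) p
    order-𝔽q    : HasOrder (Subfield.setoid 𝔽q) q
    order-𝕂     : HasOrder (Subfield.setoid 𝕂) (q ℕ.^ n)
    order-𝔽     : HasOrder (Subfield.setoid 𝔽) (q ℕ.^ s)

  open Field 𝕃 public using (Carrier; _≈_; _+_; _*_; 0#; 1#; _⁻¹)
  open RawSemiringOps (RawRing.rawSemiring (Field.rawRing 𝕃)) public using (_^_; product)
  open Subfield public using (Elem; _∈)

  σ : Carrier → Carrier
  σ x = x ^ (q ℕ.^ h)

  γ : Carrier → Carrier
  γ x = x ^ (q ℕ.^ (h ℕ.* c ℕ.* s))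

  -- Gal(𝕃/𝔽) is cyclic of order n′, generated by x ↦ x ^ (q ^ s).
  N𝕃/𝔽 : Carrier → Carrier
  N𝕃/𝔽 x = product {n′} (λ j → x ^ ((q ℕ.^ s) ℕ.^ toℕ j))

  open Polynomial (Subfield.commutativeRing 𝔽q) public

  field
    F             : Poly
    F-monic       : MonicOfDegree s F
    F-irreducible : Irreducible F
    w             : Carrier
    w≉0           : ¬ (w ≈ 0#)
    u             : Elem 𝔽
    u≈N[w]        : proj₁ u ≈ N𝕃/𝔽 w
    F[u]≈0        : eval (Field.commutativeRing 𝕃) proj₁ F (proj₁ u) ≈ 0#

  𝔼 : CommutativeRing (a ⊔ r) b
  𝔼 = Subfield.commutativeRing 𝔽

  -- 𝕃^ℓ, with 𝔼 acting coordinatewise.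
  V : LeftModule (CommutativeRing.ring 𝔼) a b
  V = record
    { Carrierᴹ = Vector Carrier ℓ
    ; _≈ᴹ_ = A._≈_
    ; _+ᴹ_ = A._∙_
    ; _*ₗ_ = λ z v i → proj₁ z * v i
    ; 0ᴹ   = A.ε
    ; -ᴹ_  = A._⁻¹
    ; isLeftModule = record
      { isLeftSemimodule = record
        { +ᴹ-isCommutativeMonoid = A.isCommutativeMonoid
        ; isPreleftSemimodule = record
          { *ₗ-cong      = λ z≈z′ v≈v′ i → 𝕃.*-cong z≈z′ (v≈v′ i)
          ; *ₗ-zeroˡ     = λ v i → 𝕃.zeroˡ (v i)
          ; *ₗ-distribʳ  = λ v z z′ i → 𝕃.distribʳ (v i) (proj₁ z) (proj₁ z′)
          ; *ₗ-identityˡ = λ v i → 𝕃.*-identityˡ (v i)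
          ; *ₗ-assoc     = λ z z′ v i → 𝕃.*-assoc (proj₁ z) (proj₁ z′) (v i)
          ; *ₗ-zeroʳ     = λ z i → 𝕃.zeroʳ (proj₁ z)
          ; *ₗ-distribˡ  = λ z v v′ i → 𝕃.distribˡ (proj₁ z) (v i) (v′ i)
          }
        }
      ; -ᴹ‿cong    = A.⁻¹-cong
      ; -ᴹ‿inverse = A.inverse
      }
    }
    where
    module 𝕃 = Field 𝕃
    module A = AbelianGroup (Pointwise.abelianGroup (Fin ℓ) 𝕃.+-abelianGroup)

  open LeftModule V public using (Carrierᴹ; _≈ᴹ_)

  infixr 7 _·_
  _·_ : Elem 𝕂 → Carrierᴹ → Carrierᴹ
  (α · v) i = iterate σ (proj₁ α) (toℕ i) * v i

  shift : ∀ {m} → Vector Carrier m → Vector Carrier m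
  shift {zero}  v = v
  shift {suc m} v = Vector.insertAt (Vector.tail v) (fromℕ m) (w * γ (Vector.head v))

  T : Carrierᴹ → Carrierᴹ
  T = shift

  private
    module End = Endomorphisms 𝔼 V
  open End using (⟦_⟧)
  open RawMonoidOps (LeftModule.+ᴹ-rawMonoid V) public using (sum)

  -- Each sum of terms α · Tⁱ is 𝔼-linear, so 𝒞 is exactly the set of these sums.
  𝒞 : Pred End.End (a ⊔ b ⊔ r)
  𝒞 A = ∃ λ (α : Fin (s ℕ.* k) → Elem 𝕂) → ∀ v → ⟦ A ⟧ v ≈ᴹ sum (λ i → α i · iterate T v (toℕ i))

  𝒞-resp : ∀ A A′ → A End.≈ₑ A′ → 𝒞 A → 𝒞 A′
  𝒞-resp _ _ A≈A′ (α , eq) = α , λ v → LeftModule.≈ᴹ-trans V (LeftModule.≈ᴹ-sym V (A≈A′ v)) (eq v)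

  open RingAutomorphisms 𝔼 (λ x → _∈ 𝔽ₚ (proj₁ x)) public
    using (Automorphism; _≈ₐ_) renaming (automorphismGroup to Aut𝔽ₚ[𝔽])
  open Automorphism using (to)

  ℋ⁺ ℋ⁻ ℋ : Pred Automorphism (a ⊔ b ⊔ r)
  ℋ⁺ ρ = ∃ λ λ′ → _∈ 𝔽q λ′ × ¬ (λ′ ≈ 0#) × proj₁ (to ρ u) ≈ λ′ * proj₁ u
  ℋ⁻ ρ = ∃ λ λ′ → _∈ 𝔽q λ′ × ¬ (λ′ ≈ 0#) × proj₁ (to ρ u) ≈ λ′ * proj₁ u ⁻¹
  ℋ  ρ = ℋ⁺ ρ ⊎ (n ≡ 2 × ℋ⁻ ρ)

  module WithBasis (B : End.Basis n) where
    private
      module Code = CodeAutomorphisms 𝔼 (λ x → _∈ 𝔽ₚ (proj₁ x)) V n B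

    Aut[𝒞] : Group (a ⊔ b ⊔ r) (a ⊔ b ⊔ r)
    Aut[𝒞] = Code.Aut 𝒞 𝒞-resp

    Aut-𝔼[𝒞] : Group (a ⊔ b ⊔ r) (a ⊔ b)
    Aut-𝔼[𝒞] = Code.Aut-E 𝒞 𝒞-resp

    π : Group.Carrier Aut[𝒞] → Automorphism
    π = Code.π 𝒞 𝒞-resp

    ι : Group.Carrier Aut-𝔼[𝒞] → Group.Carrier Aut[𝒞]
    ι = Code.ι 𝒞 𝒞-resp

    Ker-π : Group (a ⊔ b ⊔ r) (a ⊔ b ⊔ r)
    Ker-π = Code.Ker-π 𝒞 𝒞-resp

    ι-Ker : Group.Carrier Aut-𝔼[𝒞] → Group.Carrier Ker-π
    ι-Ker = Code.ι-Ker 𝒞 𝒞-resp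

{-# OPTIONS --safe #-}
-- Write φ = M ∘ L_ρ and ψ = N⁻¹ ∘ L_ρ, so that M 𝒞^ρ N = 𝒞 reads φ 𝒞 ψ⁻¹ = 𝒞.  The operators Tⁱ with i < sn are
-- linearly independent over 𝕂, hence the left and right idealisers of 𝒞 are 𝕂, and conjugation by φ and by ψ
-- normalises 𝕂.  So φ⁻¹ Tⁱ ψ ∈ 𝒞 is homogeneous for the grading by Gal(𝕂/𝔽q) ≅ ℤ/n, and for all i < sk outside a
-- single class modulo n it has no term of degree sk - 1.  For these i the operator Y = φ T φ⁻¹ satisfies Y Tⁱ ∈ 𝒞,
-- and comparing top degrees along one class gives Y = κ T with κ ∈ 𝕂, or possibly Y = κ T⁻¹ if n = 2.  Taking n-th
-- powers, ρ(u) = N(κ) u, respectively ρ(u) = N(κ) u⁻¹, where N is the norm from 𝕂 to 𝔽q.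
--
-- Conversely every ρ is a power x ↦ x ^ (p ^ f).  Composing this map on 𝕃^ℓ with a diagonal map, which is found by
-- surjectivity of the norm of 𝕂/𝔽q and Hilbert 90 for 𝕃/𝔽, gives m with m T m⁻¹ = κ T or m T m⁻¹ = κ T⁻¹.  In the
-- first case m 𝒞 m⁻¹ = 𝒞, in the second m 𝒞 m⁻¹ T ^ (sk - 1) = 𝒞.
module Submission where

open import Algebra.Bundles
open import Algebra.Module.Bundles using (LeftModule)
open import Algebra.Morphism.Structures using (module GroupMorphisms; module RingMorphisms)
import Algebra.Properties.CommutativeMonoid.Mult as Mult
import Algebra.Properties.CommutativeMonoid.Sum as Sum
import Algebra.Properties.CommutativeSemigroup as CommSemigroup
import Algebra.Properties.CommutativeSemiring.Binomial as Binomial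
import Algebra.Properties.CommutativeSemiring.Exp as CommExp
import Algebra.Properties.Group as GroupProperties
import Algebra.Properties.Monoid.Mult as MonoidMult
import Algebra.Properties.Ring as RingProperties
import Algebra.Properties.Semiring.Exp as Exp
import Algebra.Properties.Semiring.Mult as SemiringMult
import Algebra.Properties.Semiring.Sum as SemiringSum
import Algebra.Solver.Ring.NaturalCoefficients.Default as Solver
open import Data.Empty using (⊥)
open import Data.Fin.Base as Fin using (Fin; zero; suc; toℕ; fromℕ; fromℕ<; inject₁; inject≤)
import Data.Fin.Permutation as Perm
import Data.Fin.Properties as Fin
open import Data.Fin.Relation.Unary.Top using (view; ‵fromℕ; ‵inject₁)
import Data.Integer.Properties as ℤ
open import Data.List.Base as List using (List; []; _∷_; length)
import Data.List.Properties as List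
open import Data.Nat.Base as ℕ using (ℕ; zero; suc; _≤_; _<_; _∸_; z≤n; s≤s; NonZero; >-nonZero)
open import Data.Nat.Combinatorics using (nCk+nC[k+1]≡[n+1]C[k+1]; nCn≡1; nC1≡n) renaming (_C_ to _choose_)
open import Data.Nat.Coprimality as Coprime using (Coprime; coprime-Bézout; coprime-divisor; gcd≡1⇒coprime; prime⇒coprime)
open import Data.Nat.DivMod using (_%_; _/_; m≡m%n+[m/n]*n; m%n<n; m<n⇒m%n≡m; m%n%n≡m%n; [m+kn]%n≡m%n; %-distribˡ-*)
open import Data.Nat.Divisibility
open import Data.Nat.GCD using (module Bézout)
open import Data.Nat.GeneralisedArithmetic using (iterate)
open import Data.Nat.Induction using (<-rec)
open import Data.Nat.Primality as Prime using (Prime; euclidsLemma; prime⇒nonTrivial; prime⇒nonZero)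
import Data.Nat.Properties as ℕ
open import Data.Nat.Solver using () renaming (module +-*-Solver to ℕ-Solver)
open import Data.Product.Base using (Σ; ∃; ∃₂; _×_; _,_; proj₁; proj₂)
open import Data.Sum.Base using (_⊎_; inj₁; inj₂; [_,_]′)
open import Data.Vec.Functional as Vector using (Vector)
open import Data.Vec.Functional.Properties using (insertAt-lookup)
open import Function.Base using (_∘_; id)
open import Function.Bundles using (Inverse; _⇔_; mk⇔; module Equivalence)
open import Level using (Level; _⊔_)
open import Relation.Binary.Bundles using (Setoid)
open import Relation.Binary.Definitions using (Decidable; tri<; tri≈; tri>)
open import Relation.Binary.PropositionalEquality as ≡ using (_≡_; _≢_; module ≡-Reasoning)
import Relation.Binary.Reasoning.Setoid as SetoidReasoning
open import Relation.Nullary using (¬_; Dec; yes; no; contradiction)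
open import Relation.Nullary.Decidable as Dec using (¬?; decidable-stable)
import Relation.Unary as U
open import Relation.Unary using (Pred)
open import Defs

-- Degrees mean something only below sn: the Tⁱ with i < sn are independent over 𝕂, but F(Tⁿ) = 0.
-- So every comparison of top degrees needs a product whose degree lies between sk and sn - 1. As k
-- ≤ n - 1, this window has length at least s ≥ 2. For the idealisers this suffices, because the
-- degree of a product can be adjusted in steps of 1. Along one class modulo n it moves in steps of
-- n, which may jump over the window. Hence for n ≥ 3 two neighbouring classes that hit the window
-- are used, of which at most one can be the excluded class. For n = 2 the excluded class may be
-- class 0. Class 1 gives no more than Y T = z₀ + z₂ T², and it remains to show that z₀ or z₂ is 0.
-- If sk is even, another comparison of degrees yields z₂ = 0; if sk is odd, the same analysis
-- applies to Y⁻¹, and Y Y⁻¹ = id decides. The alternative z₂ = 0 is the origin of ℋ⁻. A factor μ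
-- from 𝔽 lets one construction serve both cases of the converse: μ T is T for μ = 1, and it is T⁻¹
-- for n = 2 and μ = u⁻¹.

private
  variable
    a b a₁ b₁ r₁ a₂ b₂ a₃ a₄ : Level


-- Finite sets and polynomial functions over a field

module FiniteSetoid (S : Setoid a b) {m : ℕ} (order : HasOrder S m) where
  open Setoid S
  open Inverse order using (to; from; to-cong; from-cong; strictlyInverseˡ; strictlyInverseʳ) public

  infix 4 _≟_
  _≟_ : Decidable _≈_
  x ≟ y = Dec.map′ (λ eq → trans (sym (strictlyInverseʳ x)) (trans (from-cong eq) (strictlyInverseʳ y)))
                   to-cong (to x Fin.≟ to y)

  from-injective : ∀ {i j} → from i ≈ from j → i ≡ j
  from-injective {i} {j} eq =
    ≡.trans (≡.sym (strictlyInverseˡ i)) (≡.trans (to-cong eq) (strictlyInverseˡ j))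

  module _ {P : Carrier → Set a₂} (resp : ∀ {x y} → x ≈ y → P x → P y) where

    all? : U.Decidable P → Dec (∀ x → P x)
    all? P? = Dec.map′ (λ f x → resp (strictlyInverseʳ x) (f (to x))) (λ f i → f (from i))
                       (Fin.all? (λ i → P? (from i)))

    ¬∀⇒∃¬ : U.Decidable P → ¬ (∀ x → P x) → ∃ λ x → ¬ P x
    ¬∀⇒∃¬ P? ¬∀ with Fin.¬∀⟶∃¬ m (P ∘ from) (P? ∘ from)
                        (λ f → ¬∀ (λ x → resp (strictlyInverseʳ x) (f (to x))))
    ... | i , ¬p = from i , ¬p

  module _ (M : CommutativeMonoid a₂ b₂) where
    private
      module M = CommutativeMonoid M
    open Sum M

    sum-reindex : (f : Carrier → M.Carrier) → (∀ {x y} → x ≈ y → f x M.≈ f y) →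
                  (g h : Carrier → Carrier) → (∀ {x y} → x ≈ y → g x ≈ g y) →
                  (∀ {x y} → x ≈ y → h x ≈ h y) → (∀ x → g (h x) ≈ x) → (∀ x → h (g x) ≈ x) →
                  sum (f ∘ from) M.≈ sum (f ∘ g ∘ from)
    sum-reindex f f-cong g h g-cong h-cong gh hg = M.trans (sum-permute (f ∘ from) π)
      (sum-cong-≋ (λ i → f-cong (strictlyInverseʳ (g (from i)))))
      where
      half : ∀ (g h : Carrier → Carrier) → (∀ {x y} → x ≈ y → g x ≈ g y) → (∀ x → g (h x) ≈ x) →
             ∀ i → to (g (from (to (h (from i))))) ≡ i
      half g h g-cong gh i = ≡.trans
        (to-cong (trans (g-cong (strictlyInverseʳ _)) (gh _))) (strictlyInverseˡ i)
      π : Perm.Permutation m m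
      π = Perm.permutation (λ i → to (g (from i))) (λ i → to (h (from i)))
            (half g h g-cong gh) (half h g h-cong hg)

module FieldTheory (K : Field a b) where
  open Field K hiding (zero)
  open SetoidReasoning setoid
  open RingProperties ring public using (-‿distribˡ-*)
  open GroupProperties +-group public using () renaming (∙-cancelˡ to +-cancelˡ; ∙-cancelʳ to +-cancelʳ)
  open Exp semiring public using (^-congˡ; ^-congʳ; ^-homo-*; ^-assocʳ)
  open CommExp commutativeSemiring public using (^-distrib-*)
  module ∑ = Sum +-commutativeMonoid
  module ∏ = Sum *-commutativeMonoid
  module × = Mult +-commutativeMonoid
  open import Algebra.Definitions.RawSemiring (RawRing.rawSemiring rawRing) public using (_^_; product; sum) renaming (_×_ to _×′_)

  x-y≈0⇒x≈y : ∀ {x y} → x - y ≈ 0# → x ≈ y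
  x-y≈0⇒x≈y {x} {y} eq = +-cancelʳ (- y) x y (trans eq (sym (-‿inverseʳ y)))

  x≈y+[x-y] : ∀ x y → x ≈ y + (x - y)
  x≈y+[x-y] x y = begin
    x               ≈⟨ +-identityʳ x ⟨
    x + 0#          ≈⟨ +-congˡ (-‿inverseˡ y) ⟨
    x + (- y + y)   ≈⟨ +-assoc x (- y) y ⟨
    (x - y) + y     ≈⟨ +-comm _ _ ⟩
    y + (x - y)     ∎

  *-cancelˡ-≉0 : ∀ {x} → ¬ (x ≈ 0#) → ∀ {y z} → x * y ≈ x * z → y ≈ z
  *-cancelˡ-≉0 {x} x≉0 {y} {z} eq = trans (sym (cancel y)) (trans (*-congˡ eq) (cancel z))
    where
    cancel : ∀ y → x ⁻¹ * (x * y) ≈ y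
    cancel y = begin
      x ⁻¹ * (x * y) ≈⟨ *-assoc _ _ _ ⟨
      x ⁻¹ * x * y   ≈⟨ *-congʳ (trans (*-comm _ _) (*-inverseʳ x x≉0)) ⟩
      1# * y         ≈⟨ *-identityˡ y ⟩
      y              ∎

  xy≈0⇒y≈0 : ∀ {x y} → ¬ (x ≈ 0#) → x * y ≈ 0# → y ≈ 0#
  xy≈0⇒y≈0 x≉0 eq = *-cancelˡ-≉0 x≉0 (trans eq (sym (zeroʳ _)))

  *-≉0 : ∀ {x y} → ¬ (x ≈ 0#) → ¬ (y ≈ 0#) → ¬ (x * y ≈ 0#)
  *-≉0 x≉0 y≉0 eq = y≉0 (xy≈0⇒y≈0 x≉0 eq)

  ^-≉0 : ∀ {x} → ¬ (x ≈ 0#) → ∀ n → ¬ (x ^ n ≈ 0#)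
  ^-≉0 x≉0 zero    = 1≉0
  ^-≉0 x≉0 (suc n) = *-≉0 x≉0 (^-≉0 x≉0 n)

  ⁻¹-≉0 : ∀ {x} → ¬ (x ≈ 0#) → ¬ (x ⁻¹ ≈ 0#)
  ⁻¹-≉0 {x} x≉0 eq = 1≉0 (trans (sym (*-inverseʳ x x≉0)) (trans (*-congˡ eq) (zeroʳ x)))

  0^ : ∀ n → 0 < n → 0# ^ n ≈ 0#
  0^ (suc n) _ = zeroˡ _

  1^ : ∀ n → 1# ^ n ≈ 1#
  1^ zero    = refl
  1^ (suc n) = trans (*-identityˡ _) (1^ n)

  product-≉0 : ∀ {n} (f : Fin n → Carrier) → (∀ i → ¬ (f i ≈ 0#)) → ¬ (product f ≈ 0#)
  product-≉0 {zero}  f f≉0 = 1≉0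
  product-≉0 {suc n} f f≉0 = *-≉0 (f≉0 zero) (product-≉0 (f ∘ suc) (f≉0 ∘ suc))

  *-distribˡ-sum : ∀ {n} x (f : Fin n → Carrier) → x * sum f ≈ sum (λ i → x * f i)
  *-distribˡ-sum x f = SemiringSum.*-distribˡ-sum semiring x f

  -- PolyFun d l f: f is given by a polynomial of degree at most d whose coefficient of degree d is l.
  PolyFun : ℕ → Carrier → (Carrier → Carrier) → Set (a ⊔ b)
  PolyFun zero    l f = ∀ x → f x ≈ l
  PolyFun (suc d) l f = ∃₂ λ g c → PolyFun d l g × (∀ x → f x ≈ x * g x + c)

  polyFun-cong : ∀ d {l f g} → (∀ x → f x ≈ g x) → PolyFun d l f → PolyFun d l g
  polyFun-cong zero    eq h                = λ x → trans (sym (eq x)) (h x)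
  polyFun-cong (suc d) eq (g , c , h , eq′) = g , c , h , λ x → trans (sym (eq x)) (eq′ x)

  polyFun-scale : ∀ d {l f} y → PolyFun d l f → PolyFun d (y * l) (λ x → y * f x)
  polyFun-scale zero    y h = λ x → *-congˡ (h x)
  polyFun-scale (suc d) y (g , c , h , e) = (λ x → y * g x) , y * c , polyFun-scale d y h , λ x →
    trans (*-congˡ (e x)) (solve 4 (λ y x g c → y :* (x :* g :+ c) := x :* (y :* g) :+ y :* c) refl y x (g x) c)
    where open Solver commutativeSemiring

  polyFun-+ : ∀ d {l l′ f g} → PolyFun d l f → PolyFun d l′ g → PolyFun d (l + l′) (λ x → f x + g x)
  polyFun-+ zero    h h′ = λ x → +-cong (h x) (h′ x)
  polyFun-+ (suc d) (g , c , h , e) (g′ , c′ , h′ , e′) =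
    (λ x → g x + g′ x) , c + c′ , polyFun-+ d h h′ , λ x → trans (+-cong (e x) (e′ x))
      (solve 5 (λ x g g′ c c′ → (x :* g :+ c) :+ (x :* g′ :+ c′) := x :* (g :+ g′) :+ (c :+ c′))
             refl x (g x) (g′ x) c c′)
    where open Solver commutativeSemiring

  polyFun-+-lower : ∀ {d e} → e < d → ∀ {l l′ f g} → PolyFun d l f → PolyFun e l′ g →
                    PolyFun d l (λ x → f x + g x)
  polyFun-+-lower {suc d} {zero}  _ {l′ = l′} (g , c , h , e) h′ =
    g , c + l′ , h , λ x → trans (+-cong (e x) (h′ x)) (+-assoc _ _ _)
  polyFun-+-lower {suc d} {suc e′} (s≤s e<d) (g , c , h , e) (g′ , c′ , h′ , e″) =
    (λ x → g x + g′ x) , c + c′ , polyFun-+-lower e<d h h′ , λ x → trans (+-cong (e x) (e″ x))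
      (solve 5 (λ x g g′ c c′ → (x :* g :+ c) :+ (x :* g′ :+ c′) := x :* (g :+ g′) :+ (c :+ c′))
             refl x (g x) (g′ x) c c′)
    where open Solver commutativeSemiring

  polyFun-*x : ∀ {d l f} → PolyFun d l f → PolyFun (suc d) l (λ x → x * f x)
  polyFun-*x h = _ , 0# , h , λ x → sym (+-identityʳ _)

  polyFun-^ : ∀ d → PolyFun d 1# (_^ d)
  polyFun-^ zero    = λ x → refl
  polyFun-^ (suc d) = polyFun-*x (polyFun-^ d)

  -- The factor theorem, by Horner's scheme. `z` plays the role of x - y, so that only identities
  -- over a commutative semiring are left to the solver.
  difference-quotient : ∀ d {l f} → PolyFun (suc d) l f → ∀ y →
    ∃ λ g → PolyFun d l g × (∀ x z → x ≈ y + z → f x ≈ f y + z * g x)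
  difference-quotient zero {l} {f} (g , c , h , e) y = g , h , λ x z x≈ → begin
    f x                      ≈⟨ e x ⟩
    x * g x + c              ≈⟨ +-congʳ (*-cong x≈ (h x)) ⟩
    (y + z) * l + c          ≈⟨ solve 4 (λ y z l c → (y :+ z) :* l :+ c := (y :* l :+ c) :+ z :* l) refl y z l c ⟩
    (y * l + c) + z * l      ≈⟨ +-cong (+-congʳ (*-congˡ (h y))) (*-congˡ (h x)) ⟨
    (y * g y + c) + z * g x  ≈⟨ +-congʳ (e y) ⟨
    f y + z * g x            ∎
    where open Solver commutativeSemiring
  difference-quotient (suc d) {l} {f} (g , c , h , e) y with difference-quotient d h y
  ... | g′ , h′ , e′ = (λ x → g x + y * g′ x) ,
    polyFun-+-lower (ℕ.n<1+n d) h (polyFun-scale d y h′) , λ x z x≈ → begin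
      f x                                           ≈⟨ e x ⟩
      x * g x + c                                   ≈⟨ +-congʳ (*-cong x≈ (e′ x z x≈)) ⟩
      (y + z) * (g y + z * g′ x) + c                ≈⟨ solve 5 (λ y z G H c → (y :+ z) :* (G :+ z :* H) :+ c :=
                                                          (y :* G :+ c) :+ z :* ((G :+ z :* H) :+ y :* H))
                                                          refl y z (g y) (g′ x) c ⟩
      (y * g y + c) + z * ((g y + z * g′ x) + y * g′ x) ≈⟨ +-cong (e y) (*-congˡ (+-congʳ (e′ x z x≈))) ⟨
      f y + z * (g x + y * g′ x)                    ∎
    where open Solver commutativeSemiring

  -- The difference quotient at `r zero` keeps the leading coefficient and vanishes at the other
  -- roots, since they differ from `r zero`.
  root-bound : ∀ d {l f} → PolyFun d l f → ¬ (l ≈ 0#) → (r : Fin (suc d) → Carrier) →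
               (∀ {i j} → r i ≈ r j → i ≡ j) → ¬ (∀ i → f (r i) ≈ 0#)
  root-bound zero    h l≉0 r r-inj roots = l≉0 (trans (sym (h (r zero))) (roots zero))
  root-bound (suc d) {l} {f} h l≉0 r r-inj roots with difference-quotient d h (r zero)
  ... | g , h′ , e = root-bound d h′ l≉0 (r ∘ suc) (Fin.suc-injective ∘ r-inj) (λ i →
    xy≈0⇒y≈0 (λ eq → case (r-inj (x-y≈0⇒x≈y eq)))
      (trans (sym (+-identityˡ _)) (trans (+-congʳ (sym (roots zero)))
        (trans (sym (e (r (suc i)) _ (x≈y+[x-y] _ _))) (roots (suc i))))))
    where
    case : ∀ {i : Fin (suc d)} → suc i ≡ zero → ⊥
    case ()

  module _ {x : Level} {X : Set x} (_∙_ : X → X → X) (e : X) where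

    -- Artin's argument. The relation at `y ∙ x` minus χ₀(y) times the relation at `x` no longer
    -- involves χ₀, and its coefficients are vⱼ (χⱼ(y) - χ₀(y)). By induction these vanish, and a
    -- `y` that separates χⱼ from χ₀ gives vⱼ = 0. The value at `e` settles the remaining
    -- coefficient.
    characters-independent : ∀ {m} (χ : Fin m → X → Carrier) →
      (∀ i x y → χ i (x ∙ y) ≈ χ i x * χ i y) → (∀ i → χ i e ≈ 1#) →
      (∀ {i j} → i ≢ j → ∃ λ y → ¬ (χ i y ≈ χ j y)) →
      (v : Fin m → Carrier) → (∀ x → sum (λ i → v i * χ i x) ≈ 0#) → ∀ i → v i ≈ 0#
    characters-independent {suc m} χ χ-∙ χ-e sep v rel = go
      where
      tail≈0 : ∀ i → v (suc i) ≈ 0#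
      tail≈0 i with sep {suc i} {zero} (λ ())
      ... | y , χi≉χ0 = xy≈0⇒y≈0 (λ eq → χi≉χ0 (x-y≈0⇒x≈y eq)) (trans (*-comm _ _) (step i))
        where
        step : ∀ j → v (suc j) * (χ (suc j) y - χ zero y) ≈ 0#
        step = characters-independent (χ ∘ suc) (χ-∙ ∘ suc) (χ-e ∘ suc)
          (λ i≢j → sep (λ eq → i≢j (Fin.suc-injective eq)))
          (λ j → v (suc j) * (χ (suc j) y - χ zero y))
          (λ x → +-cancelˡ (χ zero y * S x) _ _ (begin
            χ zero y * S x + ∑.sum (λ j → v (suc j) * (χ (suc j) y - χ zero y) * χ (suc j) x)
              ≈⟨ +-congʳ (*-distribˡ-sum {m} (χ zero y) (λ j → v (suc j) * χ (suc j) x)) ⟩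
            ∑.sum (λ j → χ zero y * (v (suc j) * χ (suc j) x)) + _
              ≈⟨ ∑.∑-distrib-+ {m} (λ j → χ zero y * (v (suc j) * χ (suc j) x))
                    (λ j → v (suc j) * (χ (suc j) y - χ zero y) * χ (suc j) x) ⟨
            ∑.sum (λ j → χ zero y * (v (suc j) * χ (suc j) x) +
                         v (suc j) * (χ (suc j) y - χ zero y) * χ (suc j) x)
              ≈⟨ ∑.sum-cong-≋ {m} (λ j → trans
                   (solve 4 (λ c v x d → c :* (v :* x) :+ v :* d :* x := v :* ((c :+ d) :* x)) refl
                      (χ zero y) (v (suc j)) (χ (suc j) x) (χ (suc j) y - χ zero y))
                   (*-congˡ (trans (*-congʳ (sym (x≈y+[x-y] _ _))) (sym (χ-∙ (suc j) y x))))) ⟩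
            S (y ∙ x)
              ≈⟨ +-cancelˡ (v zero * χ zero (y ∙ x)) _ _ (begin
                   v zero * χ zero (y ∙ x) + S (y ∙ x)  ≈⟨ rel (y ∙ x) ⟩
                   0#                              ≈⟨ zeroʳ _ ⟨
                   χ zero y * 0#                   ≈⟨ *-congˡ (rel x) ⟨
                   χ zero y * (v zero * χ zero x + S x)
                     ≈⟨ solve 4 (λ c v x s → c :* (v :* x :+ s) := v :* (c :* x) :+ c :* s) refl
                          (χ zero y) (v zero) (χ zero x) (S x) ⟩
                   v zero * (χ zero y * χ zero x) + χ zero y * S x ≈⟨ +-congʳ (*-congˡ (χ-∙ zero y x)) ⟨
                   v zero * χ zero (y ∙ x) + χ zero y * S x ∎) ⟩
            χ zero y * S x        ≈⟨ +-identityʳ _ ⟨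
            χ zero y * S x + 0#   ∎))
          where
          open Solver commutativeSemiring
          S : X → Carrier
          S x = ∑.sum (λ j → v (suc j) * χ (suc j) x)
      go : ∀ i → v i ≈ 0#
      go (suc i) = tail≈0 i
      go zero    = begin
        v zero                             ≈⟨ *-identityʳ _ ⟨
        v zero * 1#                        ≈⟨ *-congˡ (χ-e zero) ⟨
        v zero * χ zero e                  ≈⟨ +-identityʳ _ ⟨
        v zero * χ zero e + 0#             ≈⟨ +-congˡ (trans (∑.sum-cong-≋ {m}
                                                (λ j → trans (*-congʳ (tail≈0 j)) (zeroˡ _))) (∑.sum-replicate-zero m)) ⟨
        v zero * χ zero e + ∑.sum (λ j → v (suc j) * χ (suc j) e) ≈⟨ rel e ⟩
        0#                                 ∎

-- Sums over residues

inverse-mod : ∀ c n .{{_ : NonZero n}} → Coprime c n → ∃ λ d → (d ℕ.* c) % n ≡ 1 % n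
inverse-mod c n@(suc m) coprime with coprime-Bézout coprime
... | Bézout.+- x y eq = x , ≡.trans (≡.cong (_% n) (≡.sym eq)) ([m+kn]%n≡m%n 1 y n)
-- Here 1 + x c = y n, so the inverse of c is -x, represented by x (n - 1).
... | Bézout.-+ x y eq = x ℕ.* m , (begin
  (x ℕ.* m ℕ.* c) % n                      ≡⟨ [m+kn]%n≡m%n (x ℕ.* m ℕ.* c) 1 n ⟨
  (x ℕ.* m ℕ.* c ℕ.+ 1 ℕ.* n) % n          ≡⟨ ≡.cong (_% n) (solve 3 (λ x c m → x :* m :* c :+ con 1 :* (con 1 :+ m) :=
                                                con 1 :+ m :* (con 1 :+ x :* c)) ≡.refl x c m) ⟩
  (1 ℕ.+ m ℕ.* (1 ℕ.+ x ℕ.* c)) % n        ≡⟨ ≡.cong (λ z → (1 ℕ.+ m ℕ.* z) % n) eq ⟩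
  (1 ℕ.+ m ℕ.* (y ℕ.* n)) % n              ≡⟨ ≡.cong (λ z → (1 ℕ.+ z) % n) (ℕ.*-assoc m y n) ⟨
  (1 ℕ.+ m ℕ.* y ℕ.* n) % n                ≡⟨ [m+kn]%n≡m%n 1 (m ℕ.* y) n ⟩
  1 % n                                    ∎)
  where
  open ≡-Reasoning
  open ℕ-Solver

multiplication-permutation : ∀ c n .{{_ : NonZero n}} → Coprime c n →
  ∃ λ (π : Perm.Permutation n n) → ∀ i → toℕ (π Perm.⟨$⟩ʳ i) ≡ (c ℕ.* toℕ i) % n
multiplication-permutation c n coprime =
  Perm.permutation (times c) (times d) (cancel c d (≡.trans (≡.cong (_% n) (ℕ.*-comm c d)) dc≡1)) (cancel d c dc≡1) ,
  λ i → Fin.toℕ-fromℕ< _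
  where
  d = proj₁ (inverse-mod c n coprime)
  dc≡1 = proj₂ (inverse-mod c n coprime)
  times : ℕ → Fin n → Fin n
  times c i = fromℕ< (m%n<n (c ℕ.* toℕ i) n)
  cancel : ∀ c d → (c ℕ.* d) % n ≡ 1 % n → ∀ i → times c (times d i) ≡ i
  cancel c d cd≡1 i = Fin.toℕ-injective (begin
    toℕ (times c (times d i))                   ≡⟨ Fin.toℕ-fromℕ< _ ⟩
    (c ℕ.* toℕ (times d i)) % n                 ≡⟨ ≡.cong (λ z → (c ℕ.* z) % n) (Fin.toℕ-fromℕ< _) ⟩
    (c ℕ.* ((d ℕ.* toℕ i) % n)) % n             ≡⟨ %-distribˡ-* c ((d ℕ.* toℕ i) % n) n ⟩
    ((c % n) ℕ.* ((d ℕ.* toℕ i) % n % n)) % n   ≡⟨ ≡.cong (λ z → ((c % n) ℕ.* z) % n) (m%n%n≡m%n (d ℕ.* toℕ i) n) ⟩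
    ((c % n) ℕ.* ((d ℕ.* toℕ i) % n)) % n       ≡⟨ %-distribˡ-* c (d ℕ.* toℕ i) n ⟨
    (c ℕ.* (d ℕ.* toℕ i)) % n                   ≡⟨ ≡.cong (_% n) (ℕ.*-assoc c d (toℕ i)) ⟨
    ((c ℕ.* d) ℕ.* toℕ i) % n                   ≡⟨ %-distribˡ-* (c ℕ.* d) (toℕ i) n ⟩
    (((c ℕ.* d) % n) ℕ.* (toℕ i % n)) % n       ≡⟨ ≡.cong (λ z → (z ℕ.* (toℕ i % n)) % n) cd≡1 ⟩
    ((1 % n) ℕ.* (toℕ i % n)) % n               ≡⟨ %-distribˡ-* 1 (toℕ i) n ⟨
    (1 ℕ.* toℕ i) % n                           ≡⟨ ≡.cong (_% n) (ℕ.*-identityˡ (toℕ i)) ⟩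
    toℕ i % n                                   ≡⟨ m<n⇒m%n≡m (Fin.toℕ<n i) ⟩
    toℕ i                                       ∎)
    where open ≡-Reasoning

module MonoidSums (M : CommutativeMonoid a b) where
  open CommutativeMonoid M
  open Sum M

  -- Multiplication by `c` permutes the residues modulo `n`. In multiplicative form this compares a
  -- norm taken along one generator of a cyclic Galois group with the norm taken along another.
  periodic-sum-reindex : ∀ c n .{{_ : NonZero n}} → Coprime c n → (f : ℕ → Carrier) → (∀ j → f (j ℕ.+ n) ≈ f j) →
    sum {n} (λ j → f (c ℕ.* toℕ j)) ≈ sum {n} (λ j → f (toℕ j))
  periodic-sum-reindex c n coprime f periodic = trans
    (sum-cong-≋ {n} (λ i → trans (mod (c ℕ.* toℕ i)) (reflexive (≡.cong f (≡.sym (proj₂ π i))))))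
    (sym (sum-permute {n} {n} (λ j → f (toℕ j)) (proj₁ π)))
    where
    π = multiplication-permutation c n coprime
    periodic* : ∀ k j → f (j ℕ.+ k ℕ.* n) ≈ f j
    periodic* zero    j = reflexive (≡.cong f (ℕ.+-identityʳ j))
    periodic* (suc k) j = trans (reflexive (≡.cong f (≡.trans (≡.cong (j ℕ.+_) (ℕ.+-comm n (k ℕ.* n))) (≡.sym (ℕ.+-assoc j (k ℕ.* n) n)))))
      (trans (periodic (j ℕ.+ k ℕ.* n)) (periodic* k j))
    mod : ∀ j → f j ≈ f (j % n)
    mod j = trans (reflexive (≡.cong f (m≡m%n+[m/n]*n j n))) (periodic* (j / n) (j % n))

  -- Gives the invariance of traces, norms and resolvents under a map that moves each term to the
  -- next.
  sum-rotate : ∀ (t : ℕ → Carrier) k → t k ≈ t 0 → sum {k} (λ i → t (suc (toℕ i))) ≈ sum {k} (λ i → t (toℕ i))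
  sum-rotate t zero    eq = refl
  sum-rotate t (suc k) eq = begin
    sum {suc k} (λ i → t (suc (toℕ i)))
      ≈⟨ sum-init-last {k} (λ i → t (suc (toℕ i))) ⟩
    sum {k} (λ i → t (suc (toℕ (inject₁ i)))) ∙ t (suc (toℕ (fromℕ k)))
      ≈⟨ ∙-cong (sum-cong-≋ {k} (λ i → reflexive (≡.cong (λ j → t (suc j)) (Fin.toℕ-inject₁ i))))
                (trans (reflexive (≡.cong (λ j → t (suc j)) (Fin.toℕ-fromℕ k))) eq) ⟩
    sum {k} (λ i → t (suc (toℕ i))) ∙ t 0
      ≈⟨ comm _ _ ⟩
    t 0 ∙ sum {k} (λ i → t (suc (toℕ i))) ∎
    where open SetoidReasoning setoid

  sum-split : ∀ m k (g : ℕ → Carrier) → sum {m ℕ.+ k} (λ i → g (toℕ i)) ≈ sum {m} (λ i → g (toℕ i)) ∙ sum {k} (λ i → g (m ℕ.+ toℕ i))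
  sum-split zero    k g = sym (identityˡ _)
  sum-split (suc m) k g = trans (∙-congˡ (sum-split m k (λ i → g (suc i)))) (sym (assoc _ _ _))

  sum-blocks : ∀ s n (g : ℕ → Carrier) →
    sum {s ℕ.* n} (λ i → g (toℕ i)) ≈ sum {n} (λ l → sum {s} (λ t → g (toℕ l ℕ.+ toℕ t ℕ.* n)))
  sum-blocks zero    n g = sym (sum-replicate-zero n)
  sum-blocks (suc s) n g = begin
    sum {n ℕ.+ s ℕ.* n} (λ i → g (toℕ i))
      ≈⟨ sum-split n (s ℕ.* n) g ⟩
    sum {n} (λ i → g (toℕ i)) ∙ sum {s ℕ.* n} (λ i → g (n ℕ.+ toℕ i))
      ≈⟨ ∙-congˡ (sum-blocks s n (λ i → g (n ℕ.+ i))) ⟩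
    sum {n} (λ i → g (toℕ i)) ∙ sum {n} (λ l → sum {s} (λ t → g (n ℕ.+ (toℕ l ℕ.+ toℕ t ℕ.* n))))
      ≈⟨ ∑-distrib-+ {n} (λ i → g (toℕ i)) (λ l → sum {s} (λ t → g (n ℕ.+ (toℕ l ℕ.+ toℕ t ℕ.* n)))) ⟨
    sum {n} (λ l → g (toℕ l) ∙ sum {s} (λ t → g (n ℕ.+ (toℕ l ℕ.+ toℕ t ℕ.* n))))
      ≈⟨ sum-cong-≋ {n} (λ l → ∙-cong (reflexive (≡.cong g (≡.sym (ℕ.+-identityʳ (toℕ l)))))
           (sum-cong-≋ {s} (λ t → reflexive (≡.cong g (solve 3 (λ n l t → n :+ (l :+ t) := l :+ (n :+ t)) ≡.refl n (toℕ l) (toℕ t ℕ.* n)))))) ⟩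
    sum {n} (λ l → sum {suc s} (λ t → g (toℕ l ℕ.+ toℕ t ℕ.* n))) ∎
    where
    open SetoidReasoning setoid
    open ℕ-Solver

-- Finite fields

binomial-absorption : ∀ n k → suc k ℕ.* (suc n choose suc k) ≡ suc n ℕ.* (n choose k)
binomial-absorption zero zero = ≡.refl
binomial-absorption zero (suc k) = ≡.trans (ℕ.*-zeroʳ (2 ℕ.+ k)) (≡.sym (ℕ.*-zeroʳ 1))
binomial-absorption (suc n) zero = ≡.trans (ℕ.*-identityˡ _)
  (≡.trans (nC1≡n (suc (suc n))) (≡.sym (ℕ.*-identityʳ _)))
binomial-absorption (suc n) (suc k) = begin
  (2 ℕ.+ k) ℕ.* (suc (suc n) choose suc (suc k))
    ≡⟨ ≡.cong ((2 ℕ.+ k) ℕ.*_) (nCk+nC[k+1]≡[n+1]C[k+1] (suc n) (suc k)) ⟨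
  (2 ℕ.+ k) ℕ.* (B ℕ.+ A)
    ≡⟨ solve 3 (λ k A B → (con 2 :+ k) :* (B :+ A) := B :+ ((con 1 :+ k) :* B :+ (con 2 :+ k) :* A)) ≡.refl k A B ⟩
  B ℕ.+ (suc k ℕ.* B ℕ.+ (2 ℕ.+ k) ℕ.* A)
    ≡⟨ ≡.cong (B ℕ.+_) (≡.cong₂ ℕ._+_ (binomial-absorption n k) (binomial-absorption n (suc k))) ⟩
  B ℕ.+ (suc n ℕ.* (n choose k) ℕ.+ suc n ℕ.* (n choose suc k))
    ≡⟨ ≡.cong (B ℕ.+_) (ℕ.*-distribˡ-+ (suc n) (n choose k) (n choose suc k)) ⟨
  B ℕ.+ suc n ℕ.* (n choose k ℕ.+ n choose suc k)
    ≡⟨ ≡.cong (λ z → B ℕ.+ suc n ℕ.* z) (nCk+nC[k+1]≡[n+1]C[k+1] n k) ⟩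
  (2 ℕ.+ n) ℕ.* B ∎
  where
  open ≡.≡-Reasoning
  open ℕ-Solver
  A = suc n choose suc (suc k)
  B = suc n choose suc k

-- By absorption the prime divides k + 1 times the binomial coefficient, and it is larger than k +
-- 1.
prime∣binomial : ∀ {n k} → Prime (suc n) → k < n → suc n ∣ suc n choose suc k
prime∣binomial {n} {k} pr k<n with euclidsLemma (suc k) (suc n choose suc k) pr
  (divides (n choose k) (≡.trans (binomial-absorption n k) (ℕ.*-comm (suc n) (n choose k))))
... | inj₁ p∣k = contradiction (∣⇒≤ p∣k) (ℕ.<⇒≱ (s≤s k<n))
... | inj₂ p∣C = p∣C

module FrobeniusPowers (K : Field a b) where
  open Field K hiding (zero)
  open FieldTheory K

  ^-^-+ : ∀ q m n x → (x ^ (q ℕ.^ m)) ^ (q ℕ.^ n) ≈ x ^ (q ℕ.^ (m ℕ.+ n))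
  ^-^-+ q m n x = trans (^-assocʳ x (q ℕ.^ m) (q ℕ.^ n)) (^-congʳ x (≡.sym (ℕ.^-distribˡ-+-* q m n)))

  fixed-+ : ∀ q m n {x} → x ^ (q ℕ.^ m) ≈ x → x ^ (q ℕ.^ n) ≈ x → x ^ (q ℕ.^ (m ℕ.+ n)) ≈ x
  fixed-+ q m n {x} hm hn = trans (sym (^-^-+ q m n x)) (trans (^-congˡ (q ℕ.^ n) hm) hn)

  fixed-cancel : ∀ q m n {x} → x ^ (q ℕ.^ m) ≈ x → x ^ (q ℕ.^ (m ℕ.+ n)) ≈ x → x ^ (q ℕ.^ n) ≈ x
  fixed-cancel q m n {x} hm hmn = trans (^-congˡ (q ℕ.^ n) (sym hm)) (trans (^-^-+ q m n x) hmn)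

  fixed-* : ∀ q m k {x} → x ^ (q ℕ.^ m) ≈ x → x ^ (q ℕ.^ (k ℕ.* m)) ≈ x
  fixed-* q m zero    h = *-identityʳ _
  fixed-* q m (suc k) h = fixed-+ q m (k ℕ.* m) h (fixed-* q m k h)

  -- The exponents add up to m N. So on elements fixed by the N-th power of the Frobenius, its m-th
  -- power is undone by its m (N - 1)-st power.
  frobenius-inverse : ∀ q {N} → 0 < N → ∀ m {x} → x ^ (q ℕ.^ N) ≈ x → x ^ (q ℕ.^ (m ℕ.+ m ℕ.* (N ℕ.∸ 1))) ≈ x
  frobenius-inverse q {suc N} _ m {x} fix = trans (^-congʳ x (≡.cong (q ℕ.^_) (≡.sym (ℕ.*-suc m N)))) (fixed-* q (suc N) m fix)

  frobenius-injective : ∀ q {N} → 0 < N → ∀ m {x y} → x ^ (q ℕ.^ N) ≈ x → y ^ (q ℕ.^ N) ≈ y →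
                        x ^ (q ℕ.^ m) ≈ y ^ (q ℕ.^ m) → x ≈ y
  frobenius-injective q {N} 0<N m {x} {y} fix-x fix-y eq = trans (sym (undo fix-x)) (trans (^-congˡ (q ℕ.^ (m ℕ.* (N ℕ.∸ 1))) eq) (undo fix-y))
    where
    undo : ∀ {x} → x ^ (q ℕ.^ N) ≈ x → (x ^ (q ℕ.^ m)) ^ (q ℕ.^ (m ℕ.* (N ℕ.∸ 1))) ≈ x
    undo {x} fix = trans (^-^-+ q m (m ℕ.* (N ℕ.∸ 1)) x) (frobenius-inverse q 0<N m fix)

module Characteristic (K : Field a b) {p : ℕ} (p-prime : Prime p)
  (p×1≈0 : Field._≈_ K (FieldTheory._×′_ K p (Field.1# K)) (Field.0# K)) where
  open Field K hiding (zero)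
  open FieldTheory K
  open SetoidReasoning setoid
  private
    module M = SemiringMult semiring
    module MM = MonoidMult +-monoid

  p×x≈0 : ∀ x → p ×′ x ≈ 0#
  p×x≈0 x = begin
    p ×′ x          ≈⟨ MM.×-congʳ p (*-identityˡ x) ⟨
    p ×′ (1# * x)   ≈⟨ M.×-assoc-* p 1# x ⟨
    (p ×′ 1#) * x   ≈⟨ *-congʳ p×1≈0 ⟩
    0# * x          ≈⟨ zeroˡ x ⟩
    0#              ∎

  ∣⇒×x≈0 : ∀ {n} → p ∣ n → ∀ x → n ×′ x ≈ 0#
  ∣⇒×x≈0 (divides k eq) x = trans (MM.×-congˡ {x} eq)
    (trans (sym (MM.×-assocˡ x k p)) (trans (MM.×-congʳ k (p×x≈0 x)) (×0 k)))
    where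
    ×0 : ∀ k → k ×′ 0# ≈ 0#
    ×0 zero    = refl
    ×0 (suc k) = trans (+-identityˡ _) (×0 k)

  frobenius-+ : ∀ x y → (x + y) ^ p ≈ x ^ p + y ^ p
  frobenius-+ x y = expand p p-prime ∣⇒×x≈0
   where
   expand : ∀ p → Prime p → (∀ {n} → p ∣ n → ∀ z → n ×′ z ≈ 0#) → (x + y) ^ p ≈ x ^ p + y ^ p
   expand zero    pr vanish = contradiction pr Prime.¬prime[0]
   expand (suc n) pr vanish = begin
     (x + y) ^ suc n
       ≈⟨ Binomial.theorem commutativeSemiring (suc n) x y ⟩
     term zero + sum (term ∘ suc)
       ≈⟨ +-cong (trans (+-identityʳ _) (*-identityˡ _)) (∑.sum-init-last (term ∘ suc)) ⟩
     y ^ suc n + (sum (λ i → term (suc (inject₁ i))) + term (suc (fromℕ n)))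
       ≈⟨ +-congˡ (+-cong (trans (∑.sum-cong-≋ middle) (∑.sum-replicate-zero n)) last) ⟩
     y ^ suc n + (0# + x ^ suc n)
       ≈⟨ trans (+-congˡ (+-identityˡ _)) (+-comm _ _) ⟩
     x ^ suc n + y ^ suc n ∎
     where
     term : Fin (suc (suc n)) → Carrier
     term i = (suc n choose toℕ i) ×′ (x ^ toℕ i * y ^ (suc n ℕ.∸ toℕ i))
     middle : ∀ i → term (suc (inject₁ i)) ≈ 0#
     middle i = vanish (prime∣binomial pr (≡.subst (_< n) (≡.sym (Fin.toℕ-inject₁ i)) (Fin.toℕ<n i))) _
     last : term (suc (fromℕ n)) ≈ x ^ suc n
     last = begin
       (suc n choose suc (toℕ (fromℕ n))) ×′ (x ^ suc (toℕ (fromℕ n)) * y ^ (n ℕ.∸ toℕ (fromℕ n)))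
         ≡⟨ ≡.cong₂ (λ i j → (suc n choose suc i) ×′ (x ^ suc i * y ^ j)) (Fin.toℕ-fromℕ n) (n-n n) ⟩
       (suc n choose suc n) ×′ (x ^ suc n * 1#)
         ≡⟨ ≡.cong (_×′ (x ^ suc n * 1#)) (nCn≡1 (suc n)) ⟩
       x ^ suc n * 1# + 0#
         ≈⟨ trans (+-identityʳ _) (*-identityʳ _) ⟩
       x ^ suc n ∎
       where
       n-n : ∀ n → n ℕ.∸ toℕ (fromℕ n) ≡ 0
       n-n zero    = ≡.refl
       n-n (suc n) = n-n n

  ^p^-+ : ∀ m x y → (x + y) ^ (p ℕ.^ m) ≈ x ^ (p ℕ.^ m) + y ^ (p ℕ.^ m)
  ^p^-+ zero    x y = trans (*-identityʳ _) (sym (+-cong (*-identityʳ _) (*-identityʳ _)))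
  ^p^-+ (suc m) x y = begin
    (x + y) ^ (p ℕ.* p ℕ.^ m)              ≈⟨ ^-assocʳ _ p (p ℕ.^ m) ⟨
    ((x + y) ^ p) ^ (p ℕ.^ m)              ≈⟨ ^-congˡ (p ℕ.^ m) (frobenius-+ x y) ⟩
    (x ^ p + y ^ p) ^ (p ℕ.^ m)            ≈⟨ ^p^-+ m _ _ ⟩
    (x ^ p) ^ (p ℕ.^ m) + (y ^ p) ^ (p ℕ.^ m) ≈⟨ +-cong (^-assocʳ x p (p ℕ.^ m)) (^-assocʳ y p (p ℕ.^ m)) ⟩
    x ^ (p ℕ.* p ℕ.^ m) + y ^ (p ℕ.* p ℕ.^ m) ∎

module FiniteField (K : Field a b) {m : ℕ} (order : HasOrder (Field.setoid K) (suc m)) where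
  open Field K hiding (zero)
  open FieldTheory K
  open FrobeniusPowers K
  open FiniteSetoid setoid order public
  open SetoidReasoning setoid
  private
    module MM = MonoidMult +-monoid

  0<m : 0 < m
  0<m = ℕ.n≢0⇒n>0 (λ m≡0 → 1≉0
    (trans (sym (strictlyInverseʳ 1#)) (trans (from-cong (eq m≡0 (to 1#) (to 0#))) (strictlyInverseʳ 0#))))
    where
    eq : ∀ {m} → m ≡ 0 → (i j : Fin (suc m)) → i ≡ j
    eq ≡.refl zero zero = ≡.refl

  -- Translation by 1 permutes the field, so the sum of all elements does not change when `suc m`
  -- copies of 1 are added to it.
  order×1≈0 : suc m ×′ 1# ≈ 0#
  order×1≈0 = +-cancelˡ S _ _ (begin
    S + suc m ×′ 1#                         ≈⟨ +-congˡ (∑.sum-replicate (suc m)) ⟨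
    S + sum {suc m} (λ _ → 1#)              ≈⟨ ∑.∑-distrib-+ from (λ _ → 1#) ⟨
    sum (λ i → from i + 1#)                 ≈⟨ sum-reindex +-commutativeMonoid id id (_+ 1#) (_- 1#) +-congʳ +-congʳ
                                                 (λ x → cancel x (-‿inverseˡ 1#)) (λ x → cancel x (-‿inverseʳ 1#)) ⟨
    S                                       ≈⟨ +-identityʳ S ⟨
    S + 0#                                  ∎)
    where
    S = sum from
    cancel : ∀ x {y z} → y + z ≈ 0# → (x + y) + z ≈ x
    cancel x eq = trans (+-assoc _ _ _) (trans (+-congˡ eq) (+-identityʳ x))

  -- The product of all units is invariant under multiplication by `x`. To let the products run over
  -- the whole field, `unit` replaces the factor 0 by 1, and `ramp y` is the quotient of
  -- `unit (x * y)` by `unit y`: it is `x`, except for the value 1 at 0.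
  fermat-unit : ∀ {x} → ¬ (x ≈ 0#) → x ^ m ≈ 1#
  fermat-unit {x} x≉0 = begin
    x ^ m                  ≈⟨ ∏.sum-replicate m ⟨
    product {m} (λ _ → x)  ≈⟨ ∏.sum-cong-≋ {m} (λ i → step i) ⟨
    product (λ i → ramp (from (Fin.punchIn 𝟘 i)))  ≈⟨ *-identityˡ _ ⟨
    1# * product (λ i → ramp (from (Fin.punchIn 𝟘 i)))  ≈⟨ *-congʳ at-0 ⟨
    ramp (from 𝟘) * product (λ i → ramp (from (Fin.punchIn 𝟘 i))) ≈⟨ ∏.sum-remove {m} {𝟘} (ramp ∘ from) ⟨
    product (ramp ∘ from)  ≈⟨ *-cancelˡ-≉0 P≉0 (trans (*-comm _ _) (trans ramp*unit (sym (*-identityʳ _)))) ⟩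
    1#                     ∎
    where
    𝟘 = to 0#
    unit ramp : Carrier → Carrier
    unit y with y ≟ 0#
    ... | yes _ = 1#
    ... | no  _ = y
    ramp y with y ≟ 0#
    ... | yes _ = 1#
    ... | no  _ = x
    unit-cong : ∀ {y z} → y ≈ z → unit y ≈ unit z
    unit-cong {y} {z} eq with y ≟ 0# | z ≟ 0#
    ... | yes _   | yes _   = refl
    ... | no _    | no _    = eq
    ... | yes y≈0 | no z≉0  = contradiction (trans (sym eq) y≈0) z≉0
    ... | no y≉0  | yes z≈0 = contradiction (trans eq z≈0) y≉0
    unit-≉0 : ∀ y → ¬ (unit y ≈ 0#)
    unit-≉0 y with y ≟ 0#
    ... | yes _  = 1≉0
    ... | no y≉0 = y≉0
    unit-* : ∀ y → unit (x * y) ≈ ramp y * unit y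
    unit-* y with x * y ≟ 0# | y ≟ 0#
    ... | yes _    | yes _   = sym (*-identityˡ _)
    ... | no _     | no _    = refl
    ... | yes xy≈0 | no y≉0  = contradiction xy≈0 (*-≉0 x≉0 y≉0)
    ... | no xy≉0  | yes y≈0 = contradiction (trans (*-congˡ y≈0) (zeroʳ x)) xy≉0
    at-0 : ramp (from 𝟘) ≈ 1#
    at-0 with from 𝟘 ≟ 0#
    ... | yes _ = refl
    ... | no ≉0 = contradiction (strictlyInverseʳ 0#) ≉0
    step : ∀ i → ramp (from (Fin.punchIn 𝟘 i)) ≈ x
    step i with from (Fin.punchIn 𝟘 i) ≟ 0#
    ... | no _  = refl
    ... | yes eq = contradiction (from-injective (trans eq (sym (strictlyInverseʳ 0#)))) (Fin.punchInᵢ≢i 𝟘 i)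
    P≉0 : ¬ (product (unit ∘ from) ≈ 0#)
    P≉0 = product-≉0 (unit ∘ from) (λ i → unit-≉0 (from i))
    ramp*unit : product (ramp ∘ from) * product (unit ∘ from) ≈ product (unit ∘ from)
    ramp*unit = begin
      product (ramp ∘ from) * product (unit ∘ from)  ≈⟨ ∏.∑-distrib-+ (ramp ∘ from) (unit ∘ from) ⟨
      product (λ i → ramp (from i) * unit (from i))  ≈⟨ ∏.sum-cong-≋ {suc m} (λ i → unit-* (from i)) ⟨
      product (λ i → unit (x * from i))
        ≈⟨ sum-reindex *-commutativeMonoid unit unit-cong (x *_) (x ⁻¹ *_) *-congˡ *-congˡ
             (λ y → trans (sym (*-assoc _ _ _)) (trans (*-congʳ (*-inverseʳ x x≉0)) (*-identityˡ y)))
             (λ y → trans (sym (*-assoc _ _ _)) (trans (*-congʳ (trans (*-comm _ _) (*-inverseʳ x x≉0))) (*-identityˡ y))) ⟨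
      product (unit ∘ from)                          ∎

  fermat : ∀ x → x ^ suc m ≈ x
  fermat x with x ≟ 0#
  ... | yes x≈0 = trans (*-congʳ x≈0) (trans (zeroˡ _) (sym x≈0))
  ... | no  x≉0 = trans (*-congˡ (fermat-unit x≉0)) (*-identityʳ x)

  polyFun-≉0 : ∀ {d l f} → d ≤ m → PolyFun d l f → ¬ (l ≈ 0#) → ¬ (∀ x → f x ≈ 0#)
  polyFun-≉0 {d} d≤m h l≉0 f≈0 = root-bound d h l≉0 (λ i → from (inject≤ i (s≤s d≤m)))
    (λ eq → Fin.inject≤-injective _ _ _ _ (from-injective eq)) (λ i → f≈0 _)

  -- Otherwise Y^e - Y would be a polynomial of degree e ≤ m with m + 1 roots.
  power-id⇒order≤ : ∀ {e} → 1 < e → (∀ x → x ^ e ≈ x) → suc m ≤ e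
  power-id⇒order≤ {e} 1<e id with suc m ℕ.≤? e
  ... | yes le = le
  ... | no ≰e = contradiction (λ x → trans (+-congʳ (id x)) (trans (+-congˡ (sym (neg x))) (-‿inverseʳ x)))
    (polyFun-≉0 (ℕ.≤-pred (ℕ.≰⇒> ≰e)) (polyFun-+-lower 1<e (polyFun-^ e) (polyFun-scale 1 (- 1#) (polyFun-^ 1))) 1≉0)
    where
    neg : ∀ x → - x ≈ - 1# * x ^ 1
    neg x = trans (-‿cong (sym (trans (*-congˡ (*-identityʳ x)) (*-identityˡ x)))) (-‿distribˡ-* 1# (x ^ 1))

  -- A nonzero remainder r of `n` modulo `D` would satisfy x^(q^r) = x for all x, although 1 < q^r
  -- and q^r is smaller than the order of the field.
  frobenius-order : ∀ q {D} → suc m ≡ q ℕ.^ D → ∀ n → (∀ x → x ^ (q ℕ.^ n) ≈ x) → D ∣ n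
  frobenius-order q {zero}  eq n h = contradiction 0<m (ℕ.<-irrefl (≡.sym (ℕ.suc-injective eq)))
  frobenius-order q {suc D} eq n h with n % suc D ℕ.≟ 0
  ... | yes n%D≡0 = m%n≡0⇒n∣m n (suc D) n%D≡0
  ... | no  n%D≢0 = contradiction (power-id⇒order≤ 1<q^r fixed)
    (ℕ.<⇒≱ (≡.subst (q ℕ.^ r <_) (≡.sym eq) (ℕ.^-monoʳ-< q 1<q (m%n<n n (suc D)))))
    where
    r = n % suc D
    1<q : 1 < q
    1<q with q ℕ.≤? 1
    ... | no q≰1 = ℕ.≰⇒> q≰1
    ... | yes q≤1 = contradiction
      (ℕ.≤-trans (ℕ.≤-reflexive eq) (≡.subst (q ℕ.^ suc D ≤_) (ℕ.^-zeroˡ (suc D)) (ℕ.^-monoˡ-≤ (suc D) q≤1)))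
      (ℕ.<⇒≱ (s≤s 0<m))
    1<q^r : 1 < q ℕ.^ r
    1<q^r = ℕ.^-monoʳ-< q 1<q (ℕ.n≢0⇒n>0 n%D≢0)
    fixed : ∀ x → x ^ (q ℕ.^ r) ≈ x
    fixed x = fixed-cancel q ((n / suc D) ℕ.* suc D) r
      (fixed-* q (suc D) (n / suc D) (trans (^-congʳ x (≡.sym eq)) (fermat x)))
      (trans (^-congʳ x (≡.cong (q ℕ.^_) (≡.trans (ℕ.+-comm _ r) (≡.sym (m≡m%n+[m/n]*n n (suc D)))))) (h x))

  -- If l were no M-th power, then (y ^ t - l ^ t) / (y - l) would vanish at y = x ^ M for every unit x, but its
  -- degree in x is too low for this.
  power-surjective : ∀ M t → m ≡ t ℕ.* M → ∀ {l} → ¬ (l ≈ 0#) → l ^ t ≈ 1# → ∃ λ x → ¬ (x ≈ 0#) × x ^ M ≈ l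
  power-surjective M zero    eq l≉0 l^t≈1 = contradiction 0<m (ℕ.<-irrefl (≡.sym eq))
  power-surjective zero (suc t) eq l≉0 l^t≈1 = contradiction 0<m (ℕ.<-irrefl (≡.sym (≡.trans eq (ℕ.*-zeroʳ t))))
  power-surjective M@(suc _) (suc t) eq {l} l≉0 l^t≈1
    with all? (λ {x} {y} x≈y h eq → h (trans (^-congˡ M x≈y) eq)) (λ x → ¬? (x ^ M ≟ l))
  ... | no ¬all = let x , ¬¬eq = ¬∀⇒∃¬ (λ {x} {y} x≈y h eq → h (trans (^-congˡ M x≈y) eq)) (λ x → ¬? (x ^ M ≟ l)) ¬all
                      x^M≈l = decidable-stable (x ^ M ≟ l) ¬¬eq
                  in x , (λ x≈0 → l≉0 (trans (sym x^M≈l) (trans (^-congˡ M x≈0) (0^ M (s≤s z≤n))))) , x^M≈l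
  -- `G i y` below is the quotient of y^(i + 1) - l^(i + 1) by y - l. The additional factor x
  -- provides the root 0; it is affordable because t M + 1 ≤ (t + 1) M = m.
  ... | yes all≉ = contradiction vanish
    (polyFun-≉0 deg (polyFun-*x (polyFun-G t)) 1≉0)
    where
    G : ℕ → Carrier → Carrier
    G zero    y = 1#
    G (suc i) y = y ^ suc i + l * G i y
    polyFun-G : ∀ i → PolyFun (i ℕ.* M) 1# (λ x → G i (x ^ M))
    polyFun-G zero    = λ _ → refl
    polyFun-G (suc i) = polyFun-+-lower (ℕ.m<n+m (i ℕ.* M) (s≤s z≤n))
      (polyFun-cong (M ℕ.+ i ℕ.* M) (λ x → trans (^-congʳ x (ℕ.*-comm (suc i) M)) (sym (^-assocʳ x M (suc i))))
        (polyFun-^ (suc i ℕ.* M)))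
      (polyFun-scale (i ℕ.* M) l (polyFun-G i))
    G-eq : ∀ i y → y * G i y + l ^ suc i ≈ l * G i y + y ^ suc i
    G-eq zero    y = solve 2 (λ y l → y :* con 1 :+ l :* con 1 := l :* con 1 :+ y :* con 1) refl y l
      where open Solver commutativeSemiring
    G-eq (suc i) y = begin
      y * (y ^ suc i + l * G i y) + l * l ^ suc i
        ≈⟨ solve 5 (λ y Y l G L → y :* (Y :+ l :* G) :+ l :* L := y :* Y :+ l :* (y :* G :+ L)) refl
             y (y ^ suc i) l (G i y) (l ^ suc i) ⟩
      y * y ^ suc i + l * (y * G i y + l ^ suc i)   ≈⟨ +-congˡ (*-congˡ (G-eq i y)) ⟩
      y * y ^ suc i + l * (l * G i y + y ^ suc i)
        ≈⟨ solve 4 (λ y Y l G → y :* Y :+ l :* (l :* G :+ Y) := l :* (Y :+ l :* G) :+ y :* Y) refl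
             y (y ^ suc i) l (G i y) ⟩
      l * (y ^ suc i + l * G i y) + y * y ^ suc i   ∎
      where open Solver commutativeSemiring
    vanish : ∀ x → x * G t (x ^ M) ≈ 0#
    vanish x with x ≟ 0#
    ... | yes x≈0 = trans (*-congʳ x≈0) (zeroˡ _)
    ... | no  x≉0 = trans (*-congˡ (xy≈0⇒y≈0 (λ eq → all≉ x (x-y≈0⇒x≈y eq)) root)) (zeroʳ x)
      where
      y = x ^ M
      y^t≈1 : y ^ suc t ≈ 1#
      y^t≈1 = trans (^-assocʳ x M (suc t))
        (trans (^-congʳ x (≡.trans (ℕ.*-comm M (suc t)) (≡.sym eq))) (fermat-unit x≉0))
      root : (y - l) * G t y ≈ 0#
      root = begin
        (y - l) * G t y              ≈⟨ distribʳ _ _ _ ⟩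
        y * G t y + - l * G t y      ≈⟨ +-cong (+-cancelʳ 1# _ _ (trans (+-congˡ (sym l^t≈1))
                                          (trans (G-eq t y) (+-congˡ y^t≈1)))) (sym (-‿distribˡ-* l (G t y))) ⟩
        l * G t y - l * G t y        ≈⟨ -‿inverseʳ _ ⟩
        0#                           ∎
    deg : suc (t ℕ.* M) ≤ m
    deg = ≡.subst (suc (t ℕ.* M) ≤_) (≡.sym eq) (ℕ.m<n+m (t ℕ.* M) (s≤s z≤n))

-- Automorphisms of finite fields and Hilbert 90

module FrobeniusAutomorphisms (K : Field a b) {m : ℕ} (order : HasOrder (Field.setoid K) (suc m))
  {p : ℕ} (p-prime : Prime p)
  (p×1≈0 : Field._≈_ K (FieldTheory._×′_ K p (Field.1# K)) (Field.0# K)) where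
  open Field K hiding (zero)
  open FieldTheory K
  open FiniteField K order
  open Characteristic K p-prime p×1≈0
  open SetoidReasoning setoid
  private
    module MM = MonoidMult +-monoid

  -- A nonzero remainder of `n` modulo `p` would be coprime to `p` and annihilate 1 as well, so that
  -- 1 = 0 by Bézout.
  ×1≈0⇒∣ : ∀ n → n ×′ 1# ≈ 0# → p ∣ n
  ×1≈0⇒∣ n n×1≈0 = let instance _ = prime⇒nonZero p-prime in go (n % p) ≡.refl
    where
    instance _ = prime⇒nonZero p-prime
    zero-of : ∀ k l → k ×′ 1# ≈ 0# → (l ℕ.* k) ×′ 1# ≈ 0#
    zero-of k zero    eq = refl
    zero-of k (suc l) eq = trans (MM.×-homo-+ 1# k (l ℕ.* k)) (trans (+-cong eq (zero-of k l eq)) (+-identityˡ _))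
    bézout : ∀ k l i j → k ×′ 1# ≈ 0# → l ×′ 1# ≈ 0# → 1 ℕ.+ i ℕ.* k ≡ j ℕ.* l → 1# ≈ 0#
    bézout k l i j eq eq′ e = trans (sym (+-identityʳ 1#)) (trans (+-congˡ (sym (zero-of k i eq)))
      (trans (MM.×-congˡ e) (zero-of l j eq′)))
    rem≈0 : (n % p) ×′ 1# ≈ 0#
    rem≈0 = begin
      (n % p) ×′ 1#                           ≈⟨ +-identityʳ _ ⟨
      (n % p) ×′ 1# + 0#                      ≈⟨ +-congˡ (zero-of p (n / p) p×1≈0) ⟨
      (n % p) ×′ 1# + ((n / p) ℕ.* p) ×′ 1#   ≈⟨ MM.×-homo-+ 1# (n % p) ((n / p) ℕ.* p) ⟨
      (n % p ℕ.+ (n / p) ℕ.* p) ×′ 1#         ≈⟨ MM.×-congˡ (m≡m%n+[m/n]*n n p) ⟨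
      n ×′ 1#                                 ≈⟨ n×1≈0 ⟩
      0#                                      ∎
    go : ∀ k → k ≡ n % p → p ∣ n
    go zero    eq = m%n≡0⇒n∣m n p (≡.sym eq)
    go (suc k) eq with coprime-Bézout (prime⇒coprime {p} {suc k} p-prime (≡.subst (_< p) (≡.sym eq) (m%n<n n p)))
    ... | Bézout.+- x y e = contradiction
      (bézout (suc k) p y x (≡.subst (λ z → z ×′ 1# ≈ 0#) (≡.sym eq) rem≈0) p×1≈0 e) 1≉0
    ... | Bézout.-+ x y e = contradiction
      (bézout p (suc k) x y p×1≈0 (≡.subst (λ z → z ×′ 1# ≈ 0#) (≡.sym eq) rem≈0) e) 1≉0

  ^p-injective : ∀ {x y} → x ^ p ≈ y ^ p → x ≈ y
  ^p-injective {x} {y} eq with (x - y) ≟ 0#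
  ... | yes x-y≈0 = x-y≈0⇒x≈y x-y≈0
  ... | no x-y≉0 = contradiction (+-cancelˡ (y ^ p) _ _ (begin
    y ^ p + (x - y) ^ p   ≈⟨ frobenius-+ y (x - y) ⟨
    (y + (x - y)) ^ p     ≈⟨ ^-congˡ p (x≈y+[x-y] x y) ⟨
    x ^ p                 ≈⟨ eq ⟩
    y ^ p                 ≈⟨ +-identityʳ _ ⟨
    y ^ p + 0#            ∎)) (^-≉0 x-y≉0 p)

  -- The point is the leading coefficient j + 1 of the difference, which is nonzero as soon as `p`
  -- does not divide the exponent.
  [1+x]^j-x^j : ∀ j → ∃ λ g → PolyFun j (suc j ×′ 1#) g × (∀ x → (x + 1#) ^ suc j ≈ x ^ suc j + g x)
  [1+x]^j-x^j zero    = (λ _ → 1#) , (λ _ → sym (+-identityʳ 1#)) ,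
    λ x → trans (*-identityʳ _) (+-congʳ (sym (*-identityʳ x)))
  [1+x]^j-x^j (suc j) with [1+x]^j-x^j j
  ... | g , h , eq = (λ x → (x ^ suc j + x * g x) + g x) ,
    polyFun-+-lower (ℕ.n<1+n j) (polyFun-+ (suc j) (polyFun-^ (suc j)) (polyFun-*x h)) h ,
    λ x → begin
      (x + 1#) * (x + 1#) ^ suc j      ≈⟨ *-congˡ (eq x) ⟩
      (x + 1#) * (x ^ suc j + g x)     ≈⟨ solve 3 (λ x X g → (x :+ con 1) :* (X :+ g) :=
                                            x :* X :+ ((X :+ x :* g) :+ g)) refl x (x ^ suc j) (g x) ⟩
      x * x ^ suc j + ((x ^ suc j + x * g x) + g x) ∎
    where open Solver commutativeSemiring

  -- A factor `p` of the exponent is removed by the injectivity of x ↦ x^p. If `p` does not divide j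
  -- ≥ 2, then (x + 1)^j - x^j - 1 has degree j - 1 < m and leading coefficient j ≠ 0, so it cannot
  -- vanish everywhere.
  additive-power : ∀ j → 0 < j → j ≤ m → (∀ x y → (x + y) ^ j ≈ x ^ j + y ^ j) → ∃ λ i → j ≡ p ℕ.^ i
  additive-power = <-rec _ step
    where
    step : ∀ j → (∀ {k} → k < j → 0 < k → k ≤ m → (∀ x y → (x + y) ^ k ≈ x ^ k + y ^ k) → ∃ λ i → k ≡ p ℕ.^ i) →
           0 < j → j ≤ m → (∀ x y → (x + y) ^ j ≈ x ^ j + y ^ j) → ∃ λ i → j ≡ p ℕ.^ i
    step j rec 0<j j≤m add = go j 0<j j≤m add rec (p ∣? j)
      where
      go : ∀ j → 0 < j → j ≤ m → (∀ x y → (x + y) ^ j ≈ x ^ j + y ^ j) →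
           (∀ {k} → k < j → 0 < k → k ≤ m → (∀ x y → (x + y) ^ k ≈ x ^ k + y ^ k) → ∃ λ i → k ≡ p ℕ.^ i) →
           Dec (p ∣ j) → ∃ λ i → j ≡ p ℕ.^ i
      go j 0<j j≤m add rec (yes (divides zero eq)) = contradiction 0<j (ℕ.<-irrefl (≡.sym eq))
      go j 0<j j≤m add rec (yes (divides (suc k) eq)) =
        let i , eq′ = rec k<j (s≤s z≤n) (ℕ.≤-trans (ℕ.<⇒≤ k<j) j≤m) add′
        in suc i , ≡.trans eq (≡.trans (ℕ.*-comm (suc k) p) (≡.cong (p ℕ.*_) eq′))
        where
        k<j : suc k < j
        k<j = ≡.subst (suc k <_) (≡.sym eq) (ℕ.m<m*n (suc k) p (ℕ.nonTrivial⇒n>1 p))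
          where instance _ = prime⇒nonTrivial p-prime
        pow : ∀ x → (x ^ suc k) ^ p ≈ x ^ j
        pow x = trans (^-assocʳ x (suc k) p) (^-congʳ x (≡.sym eq))
        add′ : ∀ x y → (x + y) ^ suc k ≈ x ^ suc k + y ^ suc k
        add′ x y = ^p-injective (begin
          ((x + y) ^ suc k) ^ p                ≈⟨ pow (x + y) ⟩
          (x + y) ^ j                          ≈⟨ add x y ⟩
          x ^ j + y ^ j                        ≈⟨ +-cong (pow x) (pow y) ⟨
          (x ^ suc k) ^ p + (y ^ suc k) ^ p    ≈⟨ frobenius-+ (x ^ suc k) (y ^ suc k) ⟨
          (x ^ suc k + y ^ suc k) ^ p          ∎)
      go (suc zero)    0<j j≤m add rec (no p∤j) = 0 , ≡.refl
      go (suc (suc j)) 0<j j≤m add rec (no p∤j) = contradiction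
        (λ x → trans (+-congʳ (g≈1 x)) (-‿inverseʳ 1#))
        (polyFun-≉0 (ℕ.≤-trans (ℕ.n≤1+n (suc j)) j≤m) (polyFun-+-lower {suc j} {0} (s≤s z≤n) {l′ = - 1#} h (λ _ → refl))
          (λ eq → p∤j (×1≈0⇒∣ (suc (suc j)) eq)))
        where
        expansion = [1+x]^j-x^j (suc j)
        g = proj₁ expansion
        h = proj₁ (proj₂ expansion)
        g≈1 : ∀ x → g x ≈ 1#
        g≈1 x = +-cancelˡ (x ^ suc (suc j)) _ _
          (trans (sym (proj₂ (proj₂ expansion) x)) (trans (add x 1#) (+-congˡ (1^ (suc (suc j))))))

  module _ (ρ : Carrier → Carrier) (ρ-cong : ∀ {x y} → x ≈ y → ρ x ≈ ρ y)
           (ρ-+ : ∀ x y → ρ (x + y) ≈ ρ x + ρ y) (ρ-* : ∀ x y → ρ (x * y) ≈ ρ x * ρ y)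
           (ρ-0 : ρ 0# ≈ 0#) (ρ-1 : ρ 1# ≈ 1#) where

    -- If S i = ∑ ρ(x) xⁱ is nonzero for some i, then replacing x by yx shows ρ(y) yⁱ = 1 for all units y.
    -- The sum of all S i is ∑ ρ(x) (1 + x + … + xᵐ⁻¹) = m · ρ(1) = -1.
    private
      S : ℕ → Carrier
      S i = sum (λ j → ρ (from j) * from j ^ i)

      G : ℕ → Carrier → Carrier
      G n x = sum {n} (λ i → x ^ toℕ i)

      G-eq : ∀ n x → x * G n x + 1# ≈ G n x + x ^ n
      G-eq zero    x = +-congʳ (zeroʳ x)
      G-eq (suc n) x = begin
        x * (1# + sum {n} (λ i → x * x ^ toℕ i)) + 1#  ≈⟨ +-congʳ (*-congˡ (+-congˡ (*-distribˡ-sum {n} x (λ i → x ^ toℕ i)))) ⟨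
        x * (1# + x * G n x) + 1#            ≈⟨ +-congʳ (*-congˡ (+-comm _ _)) ⟩
        x * (x * G n x + 1#) + 1#            ≈⟨ +-congʳ (*-congˡ (G-eq n x)) ⟩
        x * (G n x + x ^ n) + 1#             ≈⟨ solve 3 (λ x g X → x :* (g :+ X) :+ con 1 := (con 1 :+ x :* g) :+ x :* X)
                                                  refl x (G n x) (x ^ n) ⟩
        (1# + x * G n x) + x * x ^ n         ≈⟨ +-congʳ (+-congˡ (*-distribˡ-sum {n} x (λ i → x ^ toℕ i))) ⟩
        (1# + sum {n} (λ i → x * x ^ toℕ i)) + x * x ^ n ∎
        where open Solver commutativeSemiring

      𝟙 : Fin (suc m)
      𝟙 = to 1#

      term : Fin (suc m) → Carrier
      term j = ρ (from j) * G m (from j)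

      -- For a unit x ≠ 1 the geometric sum is (x^m - 1) / (x - 1) = 0, and for x = 0 the factor
      -- ρ(0) vanishes.
      term≈0 : ∀ i → term (Fin.punchIn 𝟙 i) ≈ 0#
      term≈0 i with from (Fin.punchIn 𝟙 i) ≟ 0#
      ... | yes x≈0 = trans (*-congʳ (trans (ρ-cong x≈0) ρ-0)) (zeroˡ _)
      ... | no x≉0 = trans (*-congˡ (xy≈0⇒y≈0 (λ eq → x≉1 (x-y≈0⇒x≈y eq)) vanish)) (zeroʳ _)
        where
        x = from (Fin.punchIn 𝟙 i)
        x≉1 : ¬ (x ≈ 1#)
        x≉1 eq = Fin.punchInᵢ≢i 𝟙 i (from-injective (trans eq (sym (strictlyInverseʳ 1#))))
        vanish : (x - 1#) * G m x ≈ 0#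
        vanish = begin
          (x - 1#) * G m x           ≈⟨ distribʳ _ _ _ ⟩
          x * G m x + - 1# * G m x   ≈⟨ +-cong (+-cancelʳ 1# _ _ (trans (G-eq m x) (+-congˡ (fermat-unit x≉0))))
                                          (trans (sym (-‿distribˡ-* 1# _)) (-‿cong (*-identityˡ _))) ⟩
          G m x - G m x              ≈⟨ -‿inverseʳ _ ⟩
          0#                         ∎

      term𝟙 : term 𝟙 ≈ m ×′ 1#
      term𝟙 = begin
        ρ (from 𝟙) * G m (from 𝟙)   ≈⟨ *-cong (trans (ρ-cong (strictlyInverseʳ 1#)) ρ-1)
                                        (∑.sum-cong-≋ {m} (λ i → trans (^-congˡ (toℕ i) (strictlyInverseʳ 1#)) (1^ (toℕ i)))) ⟩
        1# * sum {m} (λ _ → 1#)     ≈⟨ *-identityˡ _ ⟩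
        sum {m} (λ _ → 1#)          ≈⟨ ∑.sum-replicate m ⟩
        m ×′ 1#                     ∎

      total : sum {m} (λ i → S (toℕ i)) ≈ m ×′ 1#
      total = begin
        sum {m} (λ i → sum {suc m} (λ j → ρ (from j) * from j ^ toℕ i))
          ≈⟨ ∑.∑-comm {m} {suc m} (λ i j → ρ (from j) * from j ^ toℕ i) ⟩
        sum {suc m} (λ j → sum {m} (λ i → ρ (from j) * from j ^ toℕ i))
          ≈⟨ ∑.sum-cong-≋ {suc m} (λ j → *-distribˡ-sum {m} (ρ (from j)) (λ i → from j ^ toℕ i)) ⟨
        sum {suc m} term
          ≈⟨ ∑.sum-remove {m} {𝟙} term ⟩
        term 𝟙 + sum {m} (λ i → term (Fin.punchIn 𝟙 i))
          ≈⟨ +-cong term𝟙 (trans (∑.sum-cong-≋ {m} term≈0) (∑.sum-replicate-zero m)) ⟩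
        m ×′ 1# + 0#
          ≈⟨ +-identityʳ _ ⟩
        m ×′ 1# ∎

      nonzero-S : ∃ λ (i : Fin m) → ¬ (S (toℕ i) ≈ 0#)
      nonzero-S = Fin.¬∀⟶∃¬ m (λ i → S (toℕ i) ≈ 0#) (λ i → S (toℕ i) ≟ 0#) (λ all≈0 →
        1≉0 (begin
          1#                  ≈⟨ +-identityʳ 1# ⟨
          1# + 0#             ≈⟨ +-congˡ (trans (∑.sum-cong-≋ {m} all≈0) (∑.sum-replicate-zero m)) ⟨
          1# + sum {m} (λ i → S (toℕ i)) ≈⟨ +-congˡ total ⟩
          suc m ×′ 1#         ≈⟨ order×1≈0 ⟩
          0#                  ∎))

      S-shift : ∀ i {y} → ¬ (y ≈ 0#) → S i ≈ (ρ y * y ^ i) * S i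
      S-shift i {y} y≉0 = begin
        S i
          ≈⟨ sum-reindex +-commutativeMonoid (λ x → ρ x * x ^ i) (λ eq → *-cong (ρ-cong eq) (^-congˡ i eq))
               (y *_) (y ⁻¹ *_) *-congˡ *-congˡ
               (λ x → trans (sym (*-assoc _ _ _)) (trans (*-congʳ (*-inverseʳ y y≉0)) (*-identityˡ x)))
               (λ x → trans (sym (*-assoc _ _ _)) (trans (*-congʳ (trans (*-comm _ _) (*-inverseʳ y y≉0))) (*-identityˡ x))) ⟩
        sum {suc m} (λ j → ρ (y * from j) * (y * from j) ^ i)
          ≈⟨ ∑.sum-cong-≋ {suc m} (λ j → trans (*-cong (ρ-* y (from j)) (^-distrib-* y (from j) i))
               (solve 4 (λ r R Y X → r :* R :* (Y :* X) := r :* Y :* (R :* X)) refl (ρ y) (ρ (from j)) (y ^ i) (from j ^ i))) ⟩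
        sum {suc m} (λ j → (ρ y * y ^ i) * (ρ (from j) * from j ^ i))
          ≈⟨ *-distribˡ-sum {suc m} (ρ y * y ^ i) (λ j → ρ (from j) * from j ^ i) ⟨
        (ρ y * y ^ i) * S i ∎
        where open Solver commutativeSemiring

    -- As y^m = 1 for units, ρ(y) yⁱ = 1 means ρ(y) = y^(m - i). Since i < m, the exponent is
    -- positive, which also covers y = 0.
    endomorphism-power : ∃ λ j → 0 < j × j ≤ m × (∀ x → ρ x ≈ x ^ j)
    endomorphism-power = choose nonzero-S
      where
      power : ∀ (i : Fin m) → ¬ (S (toℕ i) ≈ 0#) → ∀ {x} → Dec (x ≈ 0#) → ρ x ≈ x ^ (m ℕ.∸ toℕ i)
      power i Si≉0 {x} (yes x≈0) = trans (ρ-cong x≈0)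
        (trans ρ-0 (sym (trans (^-congˡ (m ℕ.∸ toℕ i) x≈0) (0^ _ (ℕ.m<n⇒0<n∸m (Fin.toℕ<n i))))))
      power i Si≉0 {x} (no x≉0) = *-cancelˡ-≉0 (^-≉0 x≉0 (toℕ i)) (begin
        x ^ toℕ i * ρ x                   ≈⟨ *-comm _ _ ⟩
        ρ x * x ^ toℕ i                   ≈⟨ *-cancelˡ-≉0 Si≉0 (trans (*-comm _ _) (trans (sym (S-shift (toℕ i) x≉0))
                                                  (sym (*-identityʳ _)))) ⟩
        1#                                ≈⟨ fermat-unit x≉0 ⟨
        x ^ m                             ≈⟨ ^-congʳ x (ℕ.m+[n∸m]≡n (ℕ.<⇒≤ (Fin.toℕ<n i))) ⟨
        x ^ (toℕ i ℕ.+ (m ℕ.∸ toℕ i))     ≈⟨ ^-homo-* x (toℕ i) _ ⟩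
        x ^ toℕ i * x ^ (m ℕ.∸ toℕ i)     ∎)
      choose : (∃ λ (i : Fin m) → ¬ (S (toℕ i) ≈ 0#)) → ∃ λ j → 0 < j × j ≤ m × (∀ x → ρ x ≈ x ^ j)
      choose (i , Si≉0) = m ℕ.∸ toℕ i , ℕ.m<n⇒0<n∸m (Fin.toℕ<n i) , ℕ.m∸n≤m m (toℕ i) , λ x → power i Si≉0 (x ≟ 0#)

    endomorphism-frobenius : ∃ λ i → ∀ x → ρ x ≈ x ^ (p ℕ.^ i)
    endomorphism-frobenius =
      let j , 0<j , j≤m , power = endomorphism-power
          i , eq = additive-power j 0<j j≤m
            (λ x y → trans (sym (power (x + y))) (trans (ρ-+ x y) (+-cong (power x) (power y))))
      in i , λ x → trans (power x) (^-congʳ x eq)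

module Hilbert90 (K : Field a b) {m : ℕ} (order : HasOrder (Field.setoid K) (suc m)) where
  open Field K hiding (zero)
  open MonoidSums +-commutativeMonoid using (sum-rotate)
  open FieldTheory K
  open FiniteField K order
  open SetoidReasoning setoid

  -- γ j plays the role of the j-th power of a generator γ 1 of a cyclic group of order n.
  module _ (γ : ℕ → Carrier → Carrier) (γ-cong : ∀ j {x y} → x ≈ y → γ j x ≈ γ j y)
           (γ-+ : ∀ x y → γ 1 (x + y) ≈ γ 1 x + γ 1 y) (γ-* : ∀ j x y → γ j (x * y) ≈ γ j x * γ j y)
           (γ-1# : ∀ j → γ j 1# ≈ 1#) (γ-zero : ∀ x → γ 0 x ≈ x) (γ-suc : ∀ j x → γ 1 (γ j x) ≈ γ (suc j) x)
           (n : ℕ) (γ-n : ∀ x → γ n x ≈ x)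
           (distinct : ∀ {i j : Fin n} → i ≢ j → ∃ λ y → ¬ (γ (toℕ i) y ≈ γ (toℕ j) y))
    where

    -- The solution is the Lagrange resolvent, the sum of the P j γʲ(θ) with P j = x γ(x) ⋯ γʲ⁻¹(x).
    -- Applying γ and multiplying by `x` moves each term to the next, and the last one to the first
    -- because P n is the norm of `x`. By the independence of the powers of γ, some θ has a nonzero
    -- resolvent.
    hilbert90 : 0 < n → ∀ {x} → product {n} (λ i → γ (toℕ i) x) ≈ 1# → ∃ λ y → ¬ (y ≈ 0#) × x * γ 1 y ≈ y
    hilbert90 0<n {x} norm≈1 = resolvent θ , θ≉ , fixed
      where
      P : ℕ → Carrier
      P zero    = 1#
      P (suc j) = x * γ 1 (P j)

      γ1-sum : ∀ {k} (f : Fin k → Carrier) → γ 1 (sum f) ≈ sum (λ i → γ 1 (f i))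
      γ1-sum {zero}  f = +-cancelˡ (γ 1 0#) _ _ (trans (sym (γ-+ 0# 0#)) (trans (γ-cong 1 (+-identityˡ _)) (sym (+-identityʳ _))))
      γ1-sum {suc k} f = trans (γ-+ _ _) (+-congˡ (γ1-sum (f ∘ suc)))

      γ1-product : ∀ {k} (f : Fin k → Carrier) → γ 1 (product f) ≈ product (λ i → γ 1 (f i))
      γ1-product {zero}  f = γ-1# 1
      γ1-product {suc k} f = trans (γ-* 1 _ _) (*-congˡ (γ1-product (f ∘ suc)))

      P-product : ∀ j → P j ≈ product {j} (λ i → γ (toℕ i) x)
      P-product zero    = refl
      P-product (suc j) = *-cong (sym (γ-zero x)) (trans (γ-cong 1 (P-product j))
        (trans (γ1-product {j} (λ i → γ (toℕ i) x)) (∏.sum-cong-≋ {j} (λ i → γ-suc (toℕ i) x))))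

      resolvent : Carrier → Carrier
      resolvent y = sum {n} (λ i → P (toℕ i) * γ (toℕ i) y)

      resolvent-resp : ∀ {y z} → y ≈ z → resolvent y ≈ 0# → resolvent z ≈ 0#
      resolvent-resp y≈z eq = trans (∑.sum-cong-≋ {n} (λ i → *-congˡ (γ-cong (toℕ i) (sym y≈z)))) eq

      resolvent≉0 : ¬ (∀ y → resolvent y ≈ 0#)
      resolvent≉0 all = 1≉0 (trans (reflexive (≡.cong P (≡.sym (Fin.toℕ-fromℕ< 0<n))))
        (characters-independent _*_ 1# (γ ∘ toℕ) (γ-* ∘ toℕ) (γ-1# ∘ toℕ) distinct (P ∘ toℕ) all (Fin.fromℕ< 0<n)))

      θ-exists : ∃ λ y → ¬ (resolvent y ≈ 0#)
      θ-exists = ¬∀⇒∃¬ resolvent-resp (λ y → resolvent y ≟ 0#) resolvent≉0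
      θ = proj₁ θ-exists
      θ≉ = proj₂ θ-exists

      t : ℕ → Carrier
      t j = P j * γ j θ

      t-suc : ∀ j → x * γ 1 (t j) ≈ t (suc j)
      t-suc j = trans (*-congˡ (γ-* 1 _ _)) (trans (sym (*-assoc _ _ _)) (*-congˡ (γ-suc j θ)))

      fixed : x * γ 1 (resolvent θ) ≈ resolvent θ
      fixed = begin
        x * γ 1 (resolvent θ)                          ≈⟨ *-congˡ (γ1-sum {n} (λ i → t (toℕ i))) ⟩
        x * sum {n} (λ i → γ 1 (t (toℕ i)))    ≈⟨ *-distribˡ-sum {n} x (λ i → γ 1 (t (toℕ i))) ⟩
        sum {n} (λ i → x * γ 1 (t (toℕ i)))    ≈⟨ ∑.sum-cong-≋ {n} (λ i → t-suc (toℕ i)) ⟩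
        sum {n} (λ i → t (suc (toℕ i)))        ≈⟨ sum-rotate t n (trans (*-cong (trans (P-product n) norm≈1) (γ-n θ)) (*-congˡ (sym (γ-zero θ)))) ⟩
        resolvent θ                                    ∎

-- Minimal polynomials

module SubfieldTheory (L : Field a b) (_≟_ : Decidable (Field._≈_ L)) (K : Subfield L a₃) where
  private
    module L = Field L
    module K = Subfield K
  open FieldTheory L

  field′ : Field (a ⊔ a₃) b
  field′ = record
    { commutativeRing = K.commutativeRing
    ; 1≉0 = L.1≉0
    ; _⁻¹ = inv
    ; *-inverseʳ = inverse
    }
    where
    inv : K.Elem → K.Elem
    inv (x , x∈) with x ≟ L.0#
    -- The inverse of 0 in `L` is unspecified and may lie outside `K`.
    ... | yes _  = L.0# , K.0-closed
    ... | no x≉0 = x L.⁻¹ , K.⁻¹-closed x≉0 x∈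
    inverse : ∀ x → ¬ (proj₁ x L.≈ L.0#) → proj₁ x L.* proj₁ (inv x) L.≈ L.1#
    inverse (x , x∈) x≉0 with x ≟ L.0#
    ... | yes x≈0 = contradiction x≈0 x≉0
    ... | no _    = L.*-inverseʳ x x≉0

  private
    module K′ = FieldTheory field′

  ^-proj₁ : ∀ x n → proj₁ (x K′.^ n) L.≈ proj₁ x ^ n
  ^-proj₁ x zero    = L.refl
  ^-proj₁ x (suc n) = L.*-congˡ (^-proj₁ x n)

  ×-proj₁ : ∀ n x → proj₁ (n K′.×′ x) L.≈ n ×′ proj₁ x
  ×-proj₁ zero    x = L.refl
  ×-proj₁ (suc n) x = L.+-congˡ (×-proj₁ n x)

module PolynomialTheory (K : Field a b) (_≟_ : Decidable (Field._≈_ K)) where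
  open Field K hiding (zero)
  open FieldTheory K
  open Polynomial commutativeRing
  open import Algebra.Definitions.RawMagma using (_,_)
  import Algebra.Definitions.RawSemiring rawSemiring as RS
  open RS using () renaming (_∣_ to _∣ₚ_)

  coeff-+ : ∀ f g i → coeff (f +ₚ g) i ≈ coeff f i + coeff g i
  coeff-+ []      g       i       = sym (+-identityˡ _)
  coeff-+ (x ∷ f) []      i       = sym (+-identityʳ _)
  coeff-+ (x ∷ f) (y ∷ g) zero    = refl
  coeff-+ (x ∷ f) (y ∷ g) (suc i) = coeff-+ f g i

  coeff-scale : ∀ x g i → coeff (List.map (x *_) g) i ≈ x * coeff g i
  coeff-scale x []      i       = sym (zeroʳ x)
  coeff-scale x (y ∷ g) zero    = refl
  coeff-scale x (y ∷ g) (suc i) = coeff-scale x g i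

  coeff-∷* : ∀ x f g i → coeff ((x ∷ f) *ₚ g) i ≈ x * coeff g i + coeff (0# ∷ (f *ₚ g)) i
  coeff-∷* x f g i = trans (coeff-+ (List.map (x *_) g) _ i) (+-congʳ (coeff-scale x g i))

  coeff-beyond : ∀ f {i} → length f ≤ i → coeff f i ≈ 0#
  coeff-beyond []      _         = refl
  coeff-beyond (x ∷ f) (s≤s len) = coeff-beyond f len

  coeff-tabulate : ∀ {n} (c : Fin n → Carrier) i → coeff (List.tabulate c) (toℕ i) ≈ c i
  coeff-tabulate c zero    = refl
  coeff-tabulate c (suc i) = coeff-tabulate (c ∘ suc) i

  truncate : ℕ → (ℕ → Carrier) → Poly
  truncate n c = List.tabulate {n = n} (c ∘ toℕ)

  length-truncate : ∀ n c → length (truncate n c) ≤ n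
  length-truncate n c = ℕ.≤-reflexive (List.length-tabulate {n = n} (c ∘ toℕ))

  coeff-truncate-< : ∀ {n} c {i} → i < n → coeff (truncate n c) i ≈ c i
  coeff-truncate-< {n} c {i} i<n = ≡.subst (λ j → coeff (truncate n c) j ≈ c j) (Fin.toℕ-fromℕ< i<n)
    (coeff-tabulate (c ∘ toℕ) (Fin.fromℕ< i<n))

  coeff-truncate-≥ : ∀ {n} c {i} → n ≤ i → coeff (truncate n c) i ≈ 0#
  coeff-truncate-≥ {n} c n≤i = coeff-beyond (truncate n c) (ℕ.≤-trans (length-truncate n c) n≤i)

  Degree : Poly → ℕ → Carrier → Set b
  Degree f m x = coeff f m ≈ x × (∀ i → m < i → coeff f i ≈ 0#)

  degree? : ∀ f → (f ≈ₚ []) ⊎ ∃₂ λ m x → Degree f m x × ¬ (x ≈ 0#)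
  degree? [] = inj₁ (λ _ → refl)
  degree? (x ∷ f) with degree? f
  ... | inj₂ (m , y , (eq , above) , y≉0) = inj₂ (suc m , y , (eq , λ { (suc i) (s≤s m<i) → above i m<i }) , y≉0)
  ... | inj₁ f≈0 with x ≟ 0#
  ...   | yes x≈0 = inj₁ λ { zero → x≈0 ; (suc i) → f≈0 i }
  ...   | no x≉0 = inj₂ (0 , x , (refl , λ { (suc i) _ → f≈0 i }) , x≉0)

  *-zero : ∀ f g → f ≈ₚ [] → (f *ₚ g) ≈ₚ []
  *-zero []      g f≈0 i = refl
  *-zero (x ∷ f) g f≈0 i = trans (coeff-∷* x f g i)
    (trans (+-cong (trans (*-congʳ (f≈0 0)) (zeroˡ _)) (tail i)) (+-identityʳ _))
    where
    tail : ∀ i → coeff (0# ∷ (f *ₚ g)) i ≈ 0#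
    tail zero    = refl
    tail (suc i) = *-zero f g (λ j → f≈0 (suc j)) i

  degree-* : ∀ f g {m n x y} → Degree f m x → Degree g n y → Degree (f *ₚ g) (m ℕ.+ n) (x * y)
  degree-* [] g (0≈x , _) _ = trans (sym (zeroˡ _)) (*-congʳ 0≈x) , λ _ _ → refl
  degree-* (z ∷ f) g {zero} {n} {x} {y} (z≈x , above) (gn , above′) =
    trans (coeff-∷* z f g n) (trans (+-cong (*-cong z≈x gn) (tail n)) (+-identityʳ _)) ,
    λ i n<i → trans (coeff-∷* z f g i)
      (trans (+-cong (trans (*-congˡ (above′ i n<i)) (zeroʳ z)) (tail i)) (+-identityʳ _))
    where
    tail : ∀ i → coeff (0# ∷ (f *ₚ g)) i ≈ 0#
    tail zero    = refl
    tail (suc i) = *-zero f g (λ j → above (suc j) (s≤s z≤n)) i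
  degree-* (z ∷ f) g {suc m} {n} {x} {y} (fm , above) (gn , above′) =
    trans (coeff-∷* z f g (suc (m ℕ.+ n)))
      (trans (+-cong (trans (*-congˡ (above′ _ (s≤s (ℕ.m≤n+m n m)))) (zeroʳ z)) (proj₁ ih)) (+-identityˡ _)) ,
    λ { (suc i) (s≤s m+n<i) → trans (coeff-∷* z f g (suc i))
      (trans (+-cong (trans (*-congˡ (above′ _ (ℕ.≤-trans (s≤s (ℕ.m≤n+m n m)) (ℕ.≤-trans m+n<i (ℕ.n≤1+n i))))) (zeroʳ z)) (proj₂ ih i m+n<i)) (+-identityˡ _)) }
    where
    ih = degree-* f g {m} {n} {x} {y} (fm , λ i m<i → above (suc i) (s≤s m<i)) (gn , above′)

  degree-unique : ∀ {f g m n x y} → f ≈ₚ g → Degree f m x → Degree g n y → ¬ (x ≈ 0#) → ¬ (y ≈ 0#) → m ≡ n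
  degree-unique {m = m} {n} f≈g (fm , above) (gn , above′) x≉0 y≉0 with ℕ.<-cmp m n
  ... | tri≈ _ eq _ = eq
  ... | tri< m<n _ _ = contradiction (trans (sym gn) (trans (sym (f≈g n)) (above n m<n))) y≉0
  ... | tri> _ _ n<m = contradiction (trans (sym fm) (trans (f≈g m) (above′ m n<m))) x≉0

  -- If f = h g + r′, then x + Y f = (Y h) g + (x + Y r′). Subtracting t g, where t is the
  -- coefficient of degree d of x + Y r′, brings the remainder below degree d.
  divide : ∀ {d} g → MonicOfDegree d g → ∀ f → ∃₂ λ h r → length r ≤ d × f ≈ₚ (h *ₚ g) +ₚ r
  divide g monic [] = [] , [] , z≤n , λ _ → refl
  divide {d} g (g-lead , g-above) (x ∷ f) = t ∷ h , r , length-truncate d c , eq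
    where
    rec = divide g (g-lead , g-above) f
    h = proj₁ rec
    r′ = proj₁ (proj₂ rec)
    len = proj₁ (proj₂ (proj₂ rec))
    eq′ = proj₂ (proj₂ (proj₂ rec))
    t = coeff (x ∷ r′) d
    c : ℕ → Carrier
    c i = coeff (x ∷ r′) i - t * coeff g i
    r = truncate d c
    split : ∀ i → coeff (x ∷ f) i ≈ coeff (0# ∷ (h *ₚ g)) i + coeff (x ∷ r′) i
    split zero    = sym (+-identityˡ x)
    split (suc i) = trans (eq′ i) (coeff-+ (h *ₚ g) r′ i)
    remainder : ∀ i → t * coeff g i + coeff r i ≈ coeff (x ∷ r′) i
    remainder i with ℕ.<-cmp i d
    ... | tri< i<d _ _ = trans (+-congˡ (coeff-truncate-< c i<d)) (sym (x≈y+[x-y] _ _))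
    ... | tri≈ _ ≡.refl _ = trans (+-cong (trans (*-congˡ g-lead) (*-identityʳ t)) (coeff-truncate-≥ {d} c {d} ℕ.≤-refl)) (+-identityʳ t)
    ... | tri> _ _ d<i = trans (+-cong (trans (*-congˡ (g-above i d<i)) (zeroʳ t)) (coeff-truncate-≥ c (ℕ.<⇒≤ d<i)))
                           (trans (+-identityʳ 0#) (sym (coeff-beyond (x ∷ r′) (ℕ.≤-trans (s≤s len) d<i))))
    eq : (x ∷ f) ≈ₚ ((t ∷ h) *ₚ g) +ₚ r
    eq i = begin
      coeff (x ∷ f) i                                                ≈⟨ split i ⟩
      coeff (0# ∷ (h *ₚ g)) i + coeff (x ∷ r′) i                     ≈⟨ +-congˡ (remainder i) ⟨
      coeff (0# ∷ (h *ₚ g)) i + (t * coeff g i + coeff r i)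
        ≈⟨ solve 3 (λ A B C → A :+ (B :+ C) := (B :+ A) :+ C) refl (coeff (0# ∷ (h *ₚ g)) i) (t * coeff g i) (coeff r i) ⟩
      (t * coeff g i + coeff (0# ∷ (h *ₚ g)) i) + coeff r i          ≈⟨ +-congʳ (coeff-∷* t h g i) ⟨
      coeff ((t ∷ h) *ₚ g) i + coeff r i                             ≈⟨ coeff-+ ((t ∷ h) *ₚ g) r i ⟨
      coeff (((t ∷ h) *ₚ g) +ₚ r) i                                  ∎
      where
      open Solver commutativeSemiring
      open SetoidReasoning setoid

  module Evaluation (A : Field a₂ b₂) (φ : Carrier → Field.Carrier A)
    (φ-hom : RingMorphisms.IsRingHomomorphism rawRing (Field.rawRing A) φ) (y : Field.Carrier A) where
    private
      module A where
        open Field A hiding (zero) public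
        open FieldTheory A public
      module φ = RingMorphisms.IsRingHomomorphism φ-hom
    open SetoidReasoning A.setoid
    open Solver A.commutativeSemiring

    ev : Poly → A.Carrier
    ev f = eval (Field.commutativeRing A) φ f y

    ev-zero : ∀ f → f ≈ₚ [] → ev f A.≈ A.0#
    ev-zero []      f≈0 = A.refl
    ev-zero (x ∷ f) f≈0 = A.trans (A.+-cong (A.trans (φ.⟦⟧-cong (f≈0 0)) φ.0#-homo)
      (A.trans (A.*-congˡ (ev-zero f (λ i → f≈0 (suc i)))) (A.zeroʳ y))) (A.+-identityʳ _)

    ev-cong : ∀ f g → f ≈ₚ g → ev f A.≈ ev g
    ev-cong []      g       eq = A.sym (ev-zero g (λ i → sym (eq i)))
    ev-cong (x ∷ f) []      eq = ev-zero (x ∷ f) eq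
    ev-cong (x ∷ f) (z ∷ g) eq = A.+-cong (φ.⟦⟧-cong (eq 0)) (A.*-congˡ (ev-cong f g (λ i → eq (suc i))))

    ev-+ : ∀ f g → ev (f +ₚ g) A.≈ ev f A.+ ev g
    ev-+ []      g       = A.sym (A.+-identityˡ _)
    ev-+ (x ∷ f) []      = A.sym (A.+-identityʳ _)
    ev-+ (x ∷ f) (z ∷ g) = A.trans (A.+-cong (φ.+-homo x z) (A.*-congˡ (ev-+ f g)))
      (solve 5 (λ X Z Y F G → (X :+ Z) :+ Y :* (F :+ G) := (X :+ Y :* F) :+ (Z :+ Y :* G)) A.refl
        (φ x) (φ z) y (ev f) (ev g))

    ev-scale : ∀ x g → ev (List.map (x *_) g) A.≈ φ x A.* ev g
    ev-scale x []      = A.sym (A.zeroʳ _)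
    ev-scale x (z ∷ g) = A.trans (A.+-cong (φ.*-homo x z) (A.*-congˡ (ev-scale x g)))
      (solve 4 (λ X Z Y G → X :* Z :+ Y :* (X :* G) := X :* (Z :+ Y :* G)) A.refl (φ x) (φ z) y (ev g))

    ev-* : ∀ f g → ev (f *ₚ g) A.≈ ev f A.* ev g
    ev-* []      g = A.sym (A.zeroˡ _)
    ev-* (x ∷ f) g = begin
      ev (List.map (x *_) g +ₚ (0# ∷ (f *ₚ g)))
        ≈⟨ ev-+ (List.map (x *_) g) (0# ∷ (f *ₚ g)) ⟩
      ev (List.map (x *_) g) A.+ (φ 0# A.+ y A.* ev (f *ₚ g))
        ≈⟨ A.+-cong (ev-scale x g) (A.trans (A.+-congʳ φ.0#-homo) (A.trans (A.+-identityˡ _) (A.*-congˡ (ev-* f g)))) ⟩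
      φ x A.* ev g A.+ y A.* (ev f A.* ev g)
        ≈⟨ solve 4 (λ X G Y F → X :* G :+ Y :* (F :* G) := (X :+ Y :* F) :* G) A.refl (φ x) (ev g) y (ev f) ⟩
      (φ x A.+ y A.* ev f) A.* ev g ∎

    ev-1 : ev (1# ∷ []) A.≈ A.1#
    ev-1 = A.trans (A.+-cong φ.1#-homo (A.zeroʳ y)) (A.+-identityʳ _)

    ev-tabulate : ∀ {n} (c : Fin n → Carrier) → ev (List.tabulate c) A.≈ A.sum (λ i → φ (c i) A.* y A.^ toℕ i)
    ev-tabulate {zero}  c = A.refl
    ev-tabulate {suc n} c = A.+-cong (A.sym (A.*-identityʳ _)) (begin
      y A.* ev (List.tabulate (c ∘ suc))
        ≈⟨ A.*-congˡ (ev-tabulate (c ∘ suc)) ⟩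
      y A.* A.sum (λ i → φ (c (suc i)) A.* y A.^ toℕ i)
        ≈⟨ A.*-distribˡ-sum y (λ i → φ (c (suc i)) A.* y A.^ toℕ i) ⟩
      A.sum (λ i → y A.* (φ (c (suc i)) A.* y A.^ toℕ i))
        ≈⟨ A.∑.sum-cong-≋ {n} (λ i → solve 3 (λ Y C P → Y :* (C :* P) := C :* (Y :* P)) A.refl y (φ (c (suc i))) (y A.^ toℕ i)) ⟩
      A.sum (λ i → φ (c (suc i)) A.* (y A.* y A.^ toℕ i)) ∎)

    module _ {s F} (monic : MonicOfDegree s F) (irreducible : Irreducible F) (root : ev F A.≈ A.0#) where

      -- If the coefficient of degree d is nonzero, the monic multiple `g` of `f` has degree d < s.
      -- Dividing F by `g` leaves a remainder of length at most d that vanishes at `y`, so it is 0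
      -- by induction and `g` divides F. This contradicts irreducibility: `g` is no unit because it
      -- has a root, and its cofactor is no unit because d < s.
      minimal : ∀ d → d ≤ s → ∀ f → length f ≤ d → ev f A.≈ A.0# → f ≈ₚ []
      minimal zero    d≤s [] _ _ = λ _ → refl
      minimal (suc d) d<s f len root′ with coeff f d ≟ 0#
      ... | yes lead≈0 = λ i → trans (f≈f′ i) (minimal d (ℕ.<⇒≤ d<s) f′ (length-truncate d (coeff f))
                           (A.trans (A.sym (ev-cong f f′ f≈f′)) root′) i)
        where
        f′ = truncate d (coeff f)
        f≈f′ : f ≈ₚ f′
        f≈f′ i with ℕ.<-cmp i d
        ... | tri< i<d _ _ = sym (coeff-truncate-< (coeff f) i<d)
        ... | tri≈ _ ≡.refl _ = trans lead≈0 (sym (coeff-truncate-≥ {d} (coeff f) {d} ℕ.≤-refl))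
        ... | tri> _ _ d<i = trans (coeff-beyond f (ℕ.≤-trans len d<i)) (sym (coeff-truncate-≥ (coeff f) (ℕ.<⇒≤ d<i)))
      ... | no lead≉0 = contradiction (RS.Irreducible.split-∣1 irreducible F≈hg) [ h∤1 , g∤1 ]′
        where
        t = coeff f d ⁻¹
        g = List.map (t *_) f
        g-monic : MonicOfDegree d g
        g-monic = trans (coeff-scale t f d) (trans (*-comm _ _) (*-inverseʳ _ lead≉0)) ,
          λ i d<i → trans (coeff-scale t f i) (trans (*-congˡ (coeff-beyond f (ℕ.≤-trans len d<i))) (zeroʳ t))
        g-root : ev g A.≈ A.0#
        g-root = A.trans (ev-scale t f) (A.trans (A.*-congˡ root′) (A.zeroʳ _))
        division = divide g g-monic F
        h = proj₁ division
        r = proj₁ (proj₂ division)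
        F≈hg+r : F ≈ₚ (h *ₚ g) +ₚ r
        F≈hg+r = proj₂ (proj₂ (proj₂ division))
        r-root : ev r A.≈ A.0#
        r-root = begin
          ev r                        ≈⟨ A.+-identityˡ _ ⟨
          A.0# A.+ ev r               ≈⟨ A.+-congʳ (A.trans (ev-* h g) (A.trans (A.*-congˡ g-root) (A.zeroʳ _))) ⟨
          ev (h *ₚ g) A.+ ev r        ≈⟨ ev-+ (h *ₚ g) r ⟨
          ev ((h *ₚ g) +ₚ r)          ≈⟨ ev-cong F ((h *ₚ g) +ₚ r) F≈hg+r ⟨
          ev F                        ≈⟨ root ⟩
          A.0#                        ∎
        F≈hg : F ≈ₚ h *ₚ g
        F≈hg i = trans (F≈hg+r i) (trans (coeff-+ (h *ₚ g) r i) (trans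
          (+-congˡ (minimal d (ℕ.<⇒≤ d<s) r (proj₁ (proj₂ (proj₂ division))) r-root i)) (+-identityʳ _)))
        g∤1 : ¬ (g ∣ₚ (1# ∷ []))
        g∤1 (q , qg≈1) = A.1≉0 (begin
          A.1#               ≈⟨ ev-1 ⟨
          ev (1# ∷ [])       ≈⟨ ev-cong (q *ₚ g) (1# ∷ []) qg≈1 ⟨
          ev (q *ₚ g)        ≈⟨ ev-* q g ⟩
          ev q A.* ev g      ≈⟨ A.trans (A.*-congˡ g-root) (A.zeroʳ _) ⟩
          A.0#               ∎)
        h∤1 : ¬ (h ∣ₚ (1# ∷ []))
        h∤1 (q , qh≈1) with degree? h | degree? q
        ... | inj₁ h≈0 | _ = contradiction (trans (sym (proj₁ monic)) (trans (F≈hg s) (*-zero h g h≈0 s))) 1≉0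
        ... | inj₂ _ | inj₁ q≈0 = contradiction (trans (sym (qh≈1 0)) (*-zero q h q≈0 0)) 1≉0
        ... | inj₂ (e , x , h-degree , x≉0) | inj₂ (e′ , x′ , q-degree , x′≉0) =
          contradiction d<s (ℕ.<-irrefl (≡.trans (≡.cong (ℕ._+ d) (≡.sym e≡0)) e+d≡s))
          where
          e+d≡s : e ℕ.+ d ≡ s
          e+d≡s = degree-unique {h *ₚ g} {F} (λ i → sym (F≈hg i)) (degree-* h g h-degree g-monic) monic
            (*-≉0 x≉0 1≉0) 1≉0
          e≡0 : e ≡ 0
          e≡0 = ℕ.m+n≡0⇒n≡0 e′ (degree-unique {q *ₚ h} {1# ∷ []} qh≈1 (degree-* q h q-degree h-degree)
            (refl , λ { (suc i) _ → refl }) (*-≉0 x′≉0 x≉0) 1≉0)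

      powers-independent : (c : Fin s → Carrier) → A.sum (λ i → φ (c i) A.* y A.^ toℕ i) A.≈ A.0# → ∀ i → c i ≈ 0#
      powers-independent c rel i = trans (sym (coeff-tabulate c i))
        (minimal s ℕ.≤-refl (List.tabulate c) (ℕ.≤-reflexive (List.length-tabulate c)) (A.trans (ev-tabulate c) rel) (toℕ i))

-- Skew polynomial operators

module SkewPolynomials (K : Field a b) (V : LeftModule (Field.ring K) a₂ b₂) (e : ℕ)
  (T : LeftModule.Carrierᴹ V → LeftModule.Carrierᴹ V)
  (T-cong : ∀ {v w} → LeftModule._≈ᴹ_ V v w → LeftModule._≈ᴹ_ V (T v) (T w))
  (T-+ : ∀ v w → LeftModule._≈ᴹ_ V (T (LeftModule._+ᴹ_ V v w)) (LeftModule._+ᴹ_ V (T v) (T w)))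
  (T-* : ∀ x v → LeftModule._≈ᴹ_ V (T (LeftModule._*ₗ_ V x v))
                   (LeftModule._*ₗ_ V (FieldTheory._^_ K x e) (T v)))
  where
  open Field K hiding (zero)
  open FieldTheory K
  open LeftModule V
  open SetoidReasoning ≈ᴹ-setoid
  open CommSemigroup (CommutativeMonoid.commutativeSemigroup +ᴹ-commutativeMonoid) using (interchange)

  σ^ : ℕ → Carrier → Carrier
  σ^ j x = x ^ (e ℕ.^ j)

  σ^-cong : ∀ j {x y} → x ≈ y → σ^ j x ≈ σ^ j y
  σ^-cong j = ^-congˡ (e ℕ.^ j)

  σ^-+ : ∀ i j x → σ^ i (σ^ j x) ≈ σ^ (j ℕ.+ i) x
  σ^-+ i j x = trans (^-assocʳ x (e ℕ.^ j) (e ℕ.^ i)) (^-congʳ x (≡.sym (ℕ.^-distribˡ-+-* e j i)))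

  σ^-suc : ∀ j x → σ^ j (x ^ e) ≈ σ^ (suc j) x
  σ^-suc j x = ^-assocʳ x e (e ℕ.^ j)

  T^ : ℕ → Carrierᴹ → Carrierᴹ
  T^ i v = iterate T v i

  T^-cong : ∀ i {v w} → v ≈ᴹ w → T^ i v ≈ᴹ T^ i w
  T^-cong zero    eq = eq
  T^-cong (suc i) eq = T^-cong i (T-cong eq)

  T^-+ : ∀ i j v → T^ (i ℕ.+ j) v ≡ T^ j (T^ i v)
  T^-+ zero    j v = ≡.refl
  T^-+ (suc i) j v = T^-+ i j (T v)

  T^-* : ∀ i x v → T^ i (x *ₗ v) ≈ᴹ σ^ i x *ₗ T^ i v
  T^-* zero    x v = *ₗ-congʳ (sym (*-identityʳ x))
  T^-* (suc i) x v = ≈ᴹ-trans (T^-cong i (T-* x v)) (≈ᴹ-trans (T^-* i (x ^ e) (T v)) (*ₗ-congʳ (σ^-suc i x)))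

  -- The operator with the terms αᵢ Tⁱ for i < m. The coefficients form a sequence on ℕ whose values
  -- from `m` on are ignored, so taking off the lowest term is composition with `suc`.
  P : ℕ → (ℕ → Carrier) → Carrierᴹ → Carrierᴹ
  P zero    α v = 0ᴹ
  P (suc m) α v = α 0 *ₗ v +ᴹ P m (α ∘ suc) (T v)

  P-congᵛ : ∀ m α {v w} → v ≈ᴹ w → P m α v ≈ᴹ P m α w
  P-congᵛ zero    α eq = ≈ᴹ-refl
  P-congᵛ (suc m) α eq = +ᴹ-cong (*ₗ-congˡ eq) (P-congᵛ m (α ∘ suc) (T-cong eq))

  P-cong : ∀ m {α β} → (∀ i → i < m → α i ≈ β i) → ∀ v → P m α v ≈ᴹ P m β v
  P-cong zero    eq v = ≈ᴹ-refl
  P-cong (suc m) eq v = +ᴹ-cong (*ₗ-congʳ (eq 0 (s≤s z≤n))) (P-cong m (λ i i<m → eq (suc i) (s≤s i<m)) (T v))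

  P-zero : ∀ m {α} → (∀ i → i < m → α i ≈ 0#) → ∀ v → P m α v ≈ᴹ 0ᴹ
  P-zero zero    eq v = ≈ᴹ-refl
  P-zero (suc m) eq v = ≈ᴹ-trans (+ᴹ-cong (≈ᴹ-trans (*ₗ-congʳ (eq 0 (s≤s z≤n))) (*ₗ-zeroˡ v))
    (P-zero m (λ i i<m → eq (suc i) (s≤s i<m)) (T v))) (+ᴹ-identityʳ _)

  P-+ : ∀ m α β v → P m (λ i → α i + β i) v ≈ᴹ P m α v +ᴹ P m β v
  P-+ zero    α β v = ≈ᴹ-sym (+ᴹ-identityʳ _)
  P-+ (suc m) α β v = ≈ᴹ-trans (+ᴹ-cong (*ₗ-distribʳ v (α 0) (β 0)) (P-+ m (α ∘ suc) (β ∘ suc) (T v)))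
    (interchange _ _ _ _)

  P-scale : ∀ m x α v → x *ₗ P m α v ≈ᴹ P m (λ i → x * α i) v
  P-scale zero    x α v = *ₗ-zeroʳ x
  P-scale (suc m) x α v = ≈ᴹ-trans (*ₗ-distribˡ x _ _)
    (+ᴹ-cong (≈ᴹ-sym (*ₗ-assoc x (α 0) v)) (P-scale m x (α ∘ suc) (T v)))

  P-extend : ∀ {m m′} α → m ≤ m′ → (∀ i → m ≤ i → i < m′ → α i ≈ 0#) → ∀ v → P m′ α v ≈ᴹ P m α v
  P-extend {m′ = m′} α z≤n above v = P-zero m′ (λ i → above i z≤n) v
  P-extend α (s≤s m≤m′) above v =
    +ᴹ-congˡ (P-extend (α ∘ suc) m≤m′ (λ i m≤i i<m′ → above (suc i) (s≤s m≤i) (s≤s i<m′)) (T v))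

  P-* : ∀ m α x v → P m α (x *ₗ v) ≈ᴹ P m (λ i → α i * σ^ i x) v
  P-* zero    α x v = ≈ᴹ-refl
  P-* (suc m) α x v = +ᴹ-cong
    (≈ᴹ-trans (≈ᴹ-sym (*ₗ-assoc (α 0) x v)) (*ₗ-congʳ (*-congˡ (sym (*-identityʳ x)))))
    (≈ᴹ-trans (P-congᵛ m (α ∘ suc) (T-* x v)) (≈ᴹ-trans (P-* m (α ∘ suc) (x ^ e) (T v))
      (P-cong m (λ i _ → *-congˡ (σ^-suc i x)) (T v))))

  cons : Carrier → (ℕ → Carrier) → ℕ → Carrier
  cons x α zero    = x
  cons x α (suc i) = α i

  pad : ℕ → (ℕ → Carrier) → ℕ → Carrier
  pad zero    α = α
  pad (suc k) α = cons 0# (pad k α)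

  P-pad : ∀ k m α v → P m α (T^ k v) ≈ᴹ P (k ℕ.+ m) (pad k α) v
  P-pad zero    m α v = ≈ᴹ-refl
  P-pad (suc k) m α v = ≈ᴹ-trans (P-pad k m α (T v))
    (≈ᴹ-sym (≈ᴹ-trans (+ᴹ-congʳ (*ₗ-zeroˡ v)) (+ᴹ-identityˡ _)))

  pad-+ : ∀ k α i → pad k α (k ℕ.+ i) ≡ α i
  pad-+ zero    α i = ≡.refl
  pad-+ (suc k) α i = pad-+ k α i

  T-0 : T 0ᴹ ≈ᴹ 0ᴹ
  T-0 = ≈ᴹ-trans (T-cong (≈ᴹ-sym (*ₗ-zeroˡ 0ᴹ))) (≈ᴹ-trans (T-* 0# 0ᴹ)
    (≈ᴹ-trans (*ₗ-congˡ zero′) (*ₗ-zeroʳ _)))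
    where
    zero′ : T 0ᴹ ≈ᴹ 0ᴹ
    zero′ = GroupP.identityʳ-unique (T 0ᴹ) (T 0ᴹ) (≈ᴹ-trans (≈ᴹ-sym (T-+ 0ᴹ 0ᴹ)) (T-cong (+ᴹ-identityʳ 0ᴹ)))
      where module GroupP = GroupProperties +ᴹ-group

  T-P : ∀ m α v → T (P m α v) ≈ᴹ P m (λ i → α i ^ e) (T v)
  T-P zero    α v = T-0
  T-P (suc m) α v = ≈ᴹ-trans (T-+ _ _) (+ᴹ-cong (T-* (α 0) v) (T-P m (α ∘ suc) (T v)))

  T^-P : ∀ k m α v → T^ k (P m α v) ≈ᴹ P m (λ i → σ^ k (α i)) (T^ k v)
  T^-P zero    m α v = P-cong m (λ i _ → sym (*-identityʳ (α i))) v
  T^-P (suc k) m α v = ≈ᴹ-trans (T^-cong k (T-P m α v)) (≈ᴹ-trans (T^-P k m (λ i → α i ^ e) (T v))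
    (P-cong m (λ i _ → σ^-suc k (α i)) (T^ k (T v))))

  P-single : ∀ {m α j} → j < m → (∀ i → i < m → i ≢ j → α i ≈ 0#) → ∀ v → P m α v ≈ᴹ α j *ₗ T^ j v
  P-single {suc m} {α} {zero}  _ eq v = ≈ᴹ-trans (+ᴹ-congˡ (P-zero m (λ i i<m → eq (suc i) (s≤s i<m) (λ ())) (T v)))
    (+ᴹ-identityʳ _)
  P-single {suc m} {α} {suc j} (s≤s j<m) eq v = ≈ᴹ-trans
    (+ᴹ-cong (≈ᴹ-trans (*ₗ-congʳ (eq 0 (s≤s z≤n) (λ ()))) (*ₗ-zeroˡ v))
      (P-single j<m (λ i i<m i≢j → eq (suc i) (s≤s i<m) (λ eq′ → i≢j (ℕ.suc-injective eq′))) (T v)))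
    (+ᴹ-identityˡ _)

  -- Sets the ignored coefficients to 0, so that operators of different lengths can be compared in
  -- the common length `D`.
  cut : ℕ → (ℕ → Carrier) → ℕ → Carrier
  cut zero    α i       = 0#
  cut (suc m) α zero    = α 0
  cut (suc m) α (suc i) = cut m (α ∘ suc) i

  cut-< : ∀ {m} α {i} → i < m → cut m α i ≡ α i
  cut-< {suc m} α {zero}  _         = ≡.refl
  cut-< {suc m} α {suc i} (s≤s i<m) = cut-< (α ∘ suc) i<m

  cut-≥ : ∀ {m} α {i} → m ≤ i → cut m α i ≡ 0#
  cut-≥ α z≤n       = ≡.refl
  cut-≥ α (s≤s m≤i) = cut-≥ (α ∘ suc) m≤i

  P-cut : ∀ {m m′} α → m ≤ m′ → ∀ v → P m′ (cut m α) v ≈ᴹ P m α v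
  P-cut {m} α m≤m′ v = ≈ᴹ-trans (P-extend (cut m α) m≤m′ (λ i m≤i _ → reflexive (cut-≥ α m≤i)) v)
    (P-cong m (λ i i<m → reflexive (cut-< α i<m)) v)

  -- Uniqueness of coefficients, and codes

  module Independent (D : ℕ) (independent : ∀ α → (∀ v → P D α v ≈ᴹ 0ᴹ) → ∀ i → i < D → α i ≈ 0#) where

    coefficients-unique : ∀ {m m′ α β} → m ≤ D → m′ ≤ D → (∀ v → P m α v ≈ᴹ P m′ β v) →
                          ∀ i → i < D → cut m α i ≈ cut m′ β i
    coefficients-unique {m} {m′} {α} {β} m≤D m′≤D eq i i<D = x-y≈0⇒x≈y
      (trans (+-congˡ (trans (-‿cong (sym (*-identityˡ _))) (-‿distribˡ-* 1# (cut m′ β i))))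
             (independent (λ i → cut m α i + - 1# * cut m′ β i) vanish i i<D))
      where
      vanish : ∀ v → P D (λ i → cut m α i + - 1# * cut m′ β i) v ≈ᴹ 0ᴹ
      vanish v = begin
        P D (λ i → cut m α i + - 1# * cut m′ β i) v           ≈⟨ P-+ D (cut m α) (λ i → - 1# * cut m′ β i) v ⟩
        P D (cut m α) v +ᴹ P D (λ i → - 1# * cut m′ β i) v    ≈⟨ +ᴹ-cong (P-cut α m≤D v) (≈ᴹ-sym (P-scale D (- 1#) (cut m′ β) v)) ⟩
        P m α v +ᴹ - 1# *ₗ P D (cut m′ β) v                   ≈⟨ +ᴹ-cong (≈ᴹ-trans (eq v) (≈ᴹ-sym (*ₗ-identityˡ _))) (*ₗ-congˡ (P-cut β m′≤D v)) ⟩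
        1# *ₗ P m′ β v +ᴹ - 1# *ₗ P m′ β v                    ≈⟨ *ₗ-distribʳ _ _ _ ⟨
        (1# - 1#) *ₗ P m′ β v                                 ≈⟨ *ₗ-congʳ (-‿inverseʳ 1#) ⟩
        0# *ₗ P m′ β v                                        ≈⟨ *ₗ-zeroˡ _ ⟩
        0ᴹ                                                    ∎

    coefficient-equal : ∀ {m α β} → m ≤ D → (∀ v → P m α v ≈ᴹ P m β v) → ∀ i → i < m → α i ≈ β i
    coefficient-equal {m} {α} {β} m≤D eq i i<m = trans (reflexive (≡.sym (cut-< α i<m)))
      (trans (coefficients-unique m≤D m≤D eq i (ℕ.≤-trans i<m m≤D)) (reflexive (cut-< β i<m)))

    scalar-faithful : 0 < D → ∀ {x y} → (∀ v → x *ₗ v ≈ᴹ y *ₗ v) → x ≈ y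
    scalar-faithful 0<D {x} {y} eq = coefficient-equal {1} {λ _ → x} {λ _ → y} 0<D (λ v → +ᴹ-congʳ (eq v)) 0 (s≤s z≤n)

    -- Membership is defined for arbitrary maps, since the elements of the code are going to be
    -- composed with maps that need not be linear.
    Code : ℕ → (Carrierᴹ → Carrierᴹ) → Set _
    Code N f = ∃ λ α → ∀ v → f v ≈ᴹ P N α v

    code-cong : ∀ {N f g} → (∀ v → f v ≈ᴹ g v) → Code N f → Code N g
    code-cong eq (α , h) = α , λ v → ≈ᴹ-trans (≈ᴹ-sym (eq v)) (h v)

    code-scale : ∀ {N f} x → Code N f → Code N (λ v → x *ₗ f v)
    code-scale {N} x (α , h) = (λ i → x * α i) , λ v → ≈ᴹ-trans (*ₗ-congˡ (h v)) (P-scale N x α v)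

    code-∘scale : ∀ {N f} x → Code N f → Code N (λ v → f (x *ₗ v))
    code-∘scale {N} x (α , h) = (λ i → α i * σ^ i x) , λ v → ≈ᴹ-trans (h (x *ₗ v)) (P-* N α x v)

    code-monomial : ∀ {N} x i → i < N → Code N (λ v → x *ₗ T^ i v)
    code-monomial {N} x i i<N = pad i (cons x (λ _ → 0#)) , λ v → begin
      x *ₗ T^ i v                                   ≈⟨ +ᴹ-identityʳ _ ⟨
      P 1 (cons x (λ _ → 0#)) (T^ i v)              ≈⟨ P-pad i 1 (cons x (λ _ → 0#)) v ⟩
      P (i ℕ.+ 1) (pad i (cons x (λ _ → 0#))) v     ≡⟨ ≡.cong (λ k → P k (pad i (cons x (λ _ → 0#))) v) (ℕ.+-comm i 1) ⟩
      P (suc i) (pad i (cons x (λ _ → 0#))) v       ≈⟨ P-extend (pad i (cons x (λ _ → 0#))) i<N (λ j i<j _ → reflexive (beyond i j i<j)) v ⟨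
      P N (pad i (cons x (λ _ → 0#))) v             ∎
      where
      beyond : ∀ i j → i < j → pad i (cons x (λ _ → 0#)) j ≡ 0#
      beyond zero    (suc j) _         = ≡.refl
      beyond (suc i) (suc j) (s≤s i<j) = beyond i j i<j

    code-T^ : ∀ {N} i → i < N → Code N (T^ i)
    code-T^ {N} i i<N = code-cong {N} (λ v → *ₗ-identityˡ _) (code-monomial {N} 1# i i<N)

    -- Multiplying an operator of degree i by T ^ k leaves the code as soon as N ≤ k + i < D.
    top-vanishes : ∀ {N α} k i → Code N (λ v → P N α (T^ k v)) → i < N → N ≤ k ℕ.+ i → k ℕ.+ i < D →
                   (∀ j → i < j → j < N → α j ≈ 0#) → α i ≈ 0#
    top-vanishes {N} {α} k i (β , h) i<N N≤k+i k+i<D above = trans (reflexive (≡.sym (≡.trans (cut-< (pad k α) (ℕ.+-monoʳ-< k (ℕ.n<1+n i))) (pad-+ k α i))))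
      (trans (coefficients-unique k+[1+i]≤D (ℕ.≤-trans N≤k+i (ℕ.<⇒≤ k+i<D)) eq (k ℕ.+ i) k+i<D)
        (reflexive (cut-≥ β N≤k+i)))
      where
      eq : ∀ v → P (k ℕ.+ suc i) (pad k α) v ≈ᴹ P N β v
      eq v = ≈ᴹ-trans (≈ᴹ-sym (P-pad k (suc i) α v))
        (≈ᴹ-trans (≈ᴹ-sym (P-extend α i<N above (T^ k v))) (h v))
      k+[1+i]≤D : k ℕ.+ suc i ≤ D
      k+[1+i]≤D = ≡.subst (_≤ D) (≡.sym (ℕ.+-suc k i)) k+i<D

    -- Idealisers of a code

    module Idealisers (_≟_ : Decidable _≈_) (0<e : 0 < e) {N : ℕ} (0<N : 0 < N) (N<D : N < D) where

      σ^-0 : ∀ j {x} → x ≈ 0# → σ^ j x ≈ 0#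
      σ^-0 j x≈0 = trans (σ^-cong j x≈0) (0^ (e ℕ.^ j) (ℕ.m^n>0 e j))
        where instance _ = >-nonZero 0<e

      σ^-≉0 : ∀ j {x} → ¬ (x ≈ 0#) → ¬ (σ^ j x ≈ 0#)
      σ^-≉0 j x≉0 = ^-≉0 x≉0 (e ℕ.^ j)

      σ^-0⁻¹ : ∀ j {x} → σ^ j x ≈ 0# → x ≈ 0#
      σ^-0⁻¹ j {x} eq with x ≟ 0#
      ... | yes x≈0 = x≈0
      ... | no x≉0 = contradiction eq (σ^-≉0 j x≉0)

      private
        -- For i > 0 the hypothesis is applied with k = N - i, which is less than N, so that the
        -- product has exactly the degree N < D. The induction on `k` treats higher coefficients
        -- before lower ones.
        constant : ∀ α → (∀ k i → k < N → (∀ j → i < j → j < N → α j ≈ 0#) → i < N → N ≤ k ℕ.+ i → k ℕ.+ i < D → α i ≈ 0#) →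
                   ∀ v → P N α v ≈ᴹ α 0 *ₗ v
        constant α top v = P-single 0<N (λ i i<N i≢0 → vanish N i (ℕ.n≢0⇒n>0 i≢0) i<N (ℕ.m≤m+n N i)) v
          where
          vanish : ∀ k i → 0 < i → i < N → N ≤ k ℕ.+ i → α i ≈ 0#
          vanish zero    i 0<i i<N N≤i = contradiction N≤i (ℕ.<⇒≱ i<N)
          vanish (suc k) i 0<i i<N N≤ with N ℕ.≤? k ℕ.+ i
          ... | yes N≤k+i = vanish k i 0<i i<N N≤k+i
          ... | no N≰k+i = top (suc k) i
            (ℕ.≤-trans (≡.subst (_≤ suc k ℕ.+ i) (ℕ.+-comm (suc k) 1) (ℕ.+-monoʳ-≤ (suc k) 0<i)) (ℕ.≰⇒> N≰k+i))
            (λ j i<j j<N → vanish k j (ℕ.≤-trans (s≤s z≤n) i<j) j<N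
              (ℕ.≤-trans N≤ (≡.subst (_≤ k ℕ.+ j) (ℕ.+-suc k i) (ℕ.+-monoʳ-≤ k i<j))))
            i<N N≤ (ℕ.≤-<-trans (ℕ.≰⇒> N≰k+i) N<D)

      -- The case i = 0 puts `X` itself into the code, and the other powers rule out its terms of
      -- positive degree.
      left-idealiser : ∀ (X : Carrierᴹ → Carrierᴹ) → (∀ i → i < N → Code N (λ v → X (T^ i v))) → ∃ λ x → ∀ v → X v ≈ᴹ x *ₗ v
      left-idealiser X X∘T^ = α 0 , λ v → ≈ᴹ-trans (X≈P v)
        (constant α (λ k i k<N above i<N → λ N≤ <D → top-vanishes {N} {α} k i
          (code-cong {N} (λ v → X≈P (T^ k v)) (X∘T^ k k<N)) i<N N≤ <D above) v)
        where
        α = proj₁ (X∘T^ 0 0<N)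
        X≈P = proj₂ (X∘T^ 0 0<N)

      -- On this side Tᵏ twists the coefficients by `σ^ k`, which takes the value 0 only at 0.
      right-idealiser : ∀ (X : Carrierᴹ → Carrierᴹ) → (∀ i → i < N → Code N (λ v → T^ i (X v))) → ∃ λ x → ∀ v → X v ≈ᴹ x *ₗ v
      right-idealiser X T^∘X = α 0 , λ v → ≈ᴹ-trans (X≈P v)
        (constant α (λ k i k<N above i<N → λ N≤ <D → σ^-0⁻¹ k (top-vanishes {N} {λ j → σ^ k (α j)} k i
          (code-cong {N} (λ v → ≈ᴹ-trans (T^-cong k (X≈P v)) (T^-P k N α v)) (T^∘X k k<N)) i<N N≤ <D
          (λ j i<j j<N → σ^-0 k (above j i<j j<N)))) v)
        where
        α = proj₁ (T^∘X 0 0<N)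
        X≈P = proj₂ (T^∘X 0 0<N)

      -- Pairs of maps that preserve a code

      module Conjugation
        (φ φ⁻¹ ψ ψ⁻¹ : Carrierᴹ → Carrierᴹ)
        (φ-cong : ∀ {v w} → v ≈ᴹ w → φ v ≈ᴹ φ w) (φ⁻¹-cong : ∀ {v w} → v ≈ᴹ w → φ⁻¹ v ≈ᴹ φ⁻¹ w)
        (φφ⁻¹ : ∀ v → φ (φ⁻¹ v) ≈ᴹ v) (φ⁻¹φ : ∀ v → φ⁻¹ (φ v) ≈ᴹ v)
        (ψ-cong : ∀ {v w} → v ≈ᴹ w → ψ v ≈ᴹ ψ w) (ψ⁻¹-cong : ∀ {v w} → v ≈ᴹ w → ψ⁻¹ v ≈ᴹ ψ⁻¹ w)
        (ψψ⁻¹ : ∀ v → ψ (ψ⁻¹ v) ≈ᴹ v) (ψ⁻¹ψ : ∀ v → ψ⁻¹ (ψ v) ≈ᴹ v)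
        (to-code : ∀ {f} → Code N f → Code N (λ v → φ (f (ψ⁻¹ v))))
        (from-code : ∀ {f} → Code N f → Code N (λ v → φ⁻¹ (f (ψ v))))
        where

        private
          -- With ψ⁻¹ ψ inserted, φ⁻¹ x φ Tⁱ = φ⁻¹ (x φ Tⁱ ψ⁻¹) ψ, which is a transform of a code
          -- element. Hence φ⁻¹ x φ belongs to the left idealiser.
          θ-exists : ∀ x → ∃ λ y → ∀ v → φ⁻¹ (x *ₗ φ v) ≈ᴹ y *ₗ v
          θ-exists x = left-idealiser (λ v → φ⁻¹ (x *ₗ φ v)) λ i i<N →
            code-cong {N} (λ v → φ⁻¹-cong (*ₗ-congˡ (φ-cong (T^-cong i (ψ⁻¹ψ v)))))
              (from-code (code-scale {N} x (to-code (code-T^ {N} i i<N))))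

          -- Here Tⁱ ψ⁻¹ x ψ = φ⁻¹ (φ Tⁱ ψ⁻¹ x) ψ lies in the code.
          θ′-exists : ∀ x → ∃ λ y → ∀ v → ψ⁻¹ (x *ₗ ψ v) ≈ᴹ y *ₗ v
          θ′-exists x = right-idealiser (λ v → ψ⁻¹ (x *ₗ ψ v)) λ i i<N →
            code-cong {N} (λ v → φ⁻¹φ _)
              (from-code (code-∘scale {N} x (to-code (code-T^ {N} i i<N))))

        θ θ′ : Carrier → Carrier
        θ x = proj₁ (θ-exists x)
        θ′ x = proj₁ (θ′-exists x)

        φ⁻¹-* : ∀ x v → φ⁻¹ (x *ₗ v) ≈ᴹ θ x *ₗ φ⁻¹ v
        φ⁻¹-* x v = ≈ᴹ-trans (φ⁻¹-cong (*ₗ-congˡ (≈ᴹ-sym (φφ⁻¹ v)))) (proj₂ (θ-exists x) (φ⁻¹ v))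

        φ-θ : ∀ x v → φ (θ x *ₗ v) ≈ᴹ x *ₗ φ v
        φ-θ x v = ≈ᴹ-trans (φ-cong (≈ᴹ-sym (proj₂ (θ-exists x) v))) (φφ⁻¹ _)

        ψ-θ′ : ∀ x v → ψ (θ′ x *ₗ v) ≈ᴹ x *ₗ ψ v
        ψ-θ′ x v = ≈ᴹ-trans (ψ-cong (≈ᴹ-sym (proj₂ (θ′-exists x) v))) (ψψ⁻¹ _)

        private
          0<D : 0 < D
          0<D = ℕ.<-trans 0<N N<D

        θ-cong : ∀ {x y} → x ≈ y → θ x ≈ θ y
        θ-cong {x} {y} eq = scalar-faithful 0<D (λ v → ≈ᴹ-trans (≈ᴹ-sym (proj₂ (θ-exists x) v))
          (≈ᴹ-trans (φ⁻¹-cong (*ₗ-congʳ eq)) (proj₂ (θ-exists y) v)))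

        θ′-cong : ∀ {x y} → x ≈ y → θ′ x ≈ θ′ y
        θ′-cong {x} {y} eq = scalar-faithful 0<D (λ v → ≈ᴹ-trans (≈ᴹ-sym (proj₂ (θ′-exists x) v))
          (≈ᴹ-trans (ψ⁻¹-cong (*ₗ-congʳ eq)) (proj₂ (θ′-exists y) v)))

        θ-* : ∀ x y → θ (x * y) ≈ θ x * θ y
        θ-* x y = scalar-faithful 0<D (λ v → ≈ᴹ-trans (≈ᴹ-sym (proj₂ (θ-exists (x * y)) v))
          (≈ᴹ-trans (φ⁻¹-cong (*ₗ-assoc x y (φ v))) (≈ᴹ-trans (φ⁻¹-* x _)
          (≈ᴹ-trans (*ₗ-congˡ (proj₂ (θ-exists y) v)) (≈ᴹ-sym (*ₗ-assoc _ _ v))))))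

        θ-1 : θ 1# ≈ 1#
        θ-1 = scalar-faithful 0<D (λ v → ≈ᴹ-trans (≈ᴹ-sym (proj₂ (θ-exists 1#) v))
          (≈ᴹ-trans (φ⁻¹-cong (*ₗ-identityˡ (φ v))) (≈ᴹ-trans (φ⁻¹φ v) (≈ᴹ-sym (*ₗ-identityˡ v)))))

        θ-^ : ∀ x k → θ (x ^ k) ≈ θ x ^ k
        θ-^ x zero    = θ-1
        θ-^ x (suc k) = trans (θ-* x (x ^ k)) (*-congˡ (θ-^ x k))

        θ-injective : ∀ {x y} → θ x ≈ θ y → x ≈ y
        θ-injective {x} {y} eq = scalar-faithful 0<D (λ v → begin
          x *ₗ v               ≈⟨ *ₗ-congˡ (φφ⁻¹ v) ⟨
          x *ₗ φ (φ⁻¹ v)       ≈⟨ φ-θ x (φ⁻¹ v) ⟨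
          φ (θ x *ₗ φ⁻¹ v)     ≈⟨ φ-cong (*ₗ-congʳ eq) ⟩
          φ (θ y *ₗ φ⁻¹ v)     ≈⟨ φ-θ y (φ⁻¹ v) ⟩
          y *ₗ φ (φ⁻¹ v)       ≈⟨ *ₗ-congˡ (φφ⁻¹ v) ⟩
          y *ₗ v               ∎)

        private
          X : ∀ i → i < N → Code N (λ v → φ⁻¹ (T^ i (ψ v)))
          X i i<N = from-code (code-T^ {N} i i<N)

        ξ : ∀ i → i < N → ℕ → Carrier
        ξ i i<N = proj₁ (X i i<N)

        -- The condition under which φ⁻¹ Tⁱ ψ may have a term of degree `j`. It speaks only of
        -- automorphisms of the scalars, so over a finite field it is decidable, and it depends only
        -- on classes modulo the order of σ.
        Relation : ℕ → ℕ → Set _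
        Relation i j = ∀ x → σ^ j (θ′ x) ≈ θ (σ^ i x)

        -- The coefficients of degree `j` are compared in φ⁻¹ Tⁱ ψ θ′(x) = φ⁻¹ Tⁱ x ψ = θ(σⁱ(x)) φ⁻¹
        -- Tⁱ ψ.
        ξ-relation : ∀ {i j} (i<N : i < N) → j < N → ¬ (ξ i i<N j ≈ 0#) → Relation i j
        ξ-relation {i} {j} i<N j<N ξ≉0 x = *-cancelˡ-≉0 ξ≉0 (trans
          (coefficient-equal {N} {λ l → ξ i i<N l * σ^ l (θ′ x)} {λ l → θ (σ^ i x) * ξ i i<N l} (ℕ.<⇒≤ N<D) eq j j<N)
          (*-comm _ _))
          where
          eq : ∀ v → P N (λ l → ξ i i<N l * σ^ l (θ′ x)) v ≈ᴹ P N (λ l → θ (σ^ i x) * ξ i i<N l) v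
          eq v = begin
            P N (λ l → ξ i i<N l * σ^ l (θ′ x)) v    ≈⟨ P-* N (ξ i i<N) (θ′ x) v ⟨
            P N (ξ i i<N) (θ′ x *ₗ v)                ≈⟨ proj₂ (X i i<N) _ ⟨
            φ⁻¹ (T^ i (ψ (θ′ x *ₗ v)))               ≈⟨ φ⁻¹-cong (T^-cong i (ψ-θ′ x v)) ⟩
            φ⁻¹ (T^ i (x *ₗ ψ v))                    ≈⟨ φ⁻¹-cong (T^-* i x (ψ v)) ⟩
            φ⁻¹ (σ^ i x *ₗ T^ i (ψ v))               ≈⟨ φ⁻¹-* (σ^ i x) (T^ i (ψ v)) ⟩
            θ (σ^ i x) *ₗ φ⁻¹ (T^ i (ψ v))           ≈⟨ *ₗ-congˡ (proj₂ (X i i<N) v) ⟩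
            θ (σ^ i x) *ₗ P N (ξ i i<N) v            ≈⟨ P-scale N (θ (σ^ i x)) (ξ i i<N) v ⟩
            P N (λ l → θ (σ^ i x) * ξ i i<N l) v     ∎

        conj-* : ∀ (S : Carrierᴹ → Carrierᴹ) k → (∀ {v w} → v ≈ᴹ w → S v ≈ᴹ S w) → (∀ x v → S (x *ₗ v) ≈ᴹ x ^ k *ₗ S v) →
                 ∀ x v → φ (S (φ⁻¹ (x *ₗ v))) ≈ᴹ x ^ k *ₗ φ (S (φ⁻¹ v))
        conj-* S k S-cong S-* x v = begin
          φ (S (φ⁻¹ (x *ₗ v)))             ≈⟨ φ-cong (S-cong (φ⁻¹-* x v)) ⟩
          φ (S (θ x *ₗ φ⁻¹ v))             ≈⟨ φ-cong (S-* (θ x) (φ⁻¹ v)) ⟩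
          φ (θ x ^ k *ₗ S (φ⁻¹ v))         ≈⟨ φ-cong (*ₗ-congʳ (θ-^ x k)) ⟨
          φ (θ (x ^ k) *ₗ S (φ⁻¹ v))       ≈⟨ φ-θ (x ^ k) _ ⟩
          x ^ k *ₗ φ (S (φ⁻¹ v))           ∎

        Y : Carrierᴹ → Carrierᴹ
        Y v = φ (T (φ⁻¹ v))

        -- Y Tⁱ = φ (T φ⁻¹ Tⁱ ψ) ψ⁻¹. The factor T raises all degrees by 1, so the bracket can leave
        -- the code only through the coefficient of degree N - 1.
        Y-code : ∀ {i} (i<N : i < N) → (∀ {j} → suc j ≡ N → ξ i i<N j ≈ 0#) → Code N (λ v → Y (T^ i v))
        Y-code {i} i<N last≈0 = code-cong {N} (λ v → φ-cong (T-cong (φ⁻¹-cong (T^-cong i (ψψ⁻¹ v)))))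
          (to-code (shifted N ≡.refl))
          where
          shifted : ∀ M → M ≡ N → Code N (λ v → T (φ⁻¹ (T^ i (ψ v))))
          shifted zero    eq = contradiction 0<N (ℕ.<-irrefl eq)
          shifted (suc M) eq = ≡.subst (λ N → Code N (λ v → T (φ⁻¹ (T^ i (ψ v))))) eq
            (cons 0# (λ j → ξ i i<N j ^ e) , λ v → begin
              T (φ⁻¹ (T^ i (ψ v)))                      ≈⟨ T-cong (proj₂ (X i i<N) v) ⟩
              T (P N (ξ i i<N) v)                       ≈⟨ T-cong (P-extend (ξ i i<N) (≡.subst (M ≤_) eq (ℕ.n≤1+n M))
                                                             (λ j M≤j j<N → last≈0 (≡.trans (≡.cong suc (ℕ.≤-antisym (ℕ.≤-pred (≡.subst (suc j ≤_) (≡.sym eq) j<N)) M≤j)) eq)) v) ⟩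
              T (P M (ξ i i<N) v)                       ≈⟨ T-P M (ξ i i<N) v ⟩
              P M (λ j → ξ i i<N j ^ e) (T v)           ≈⟨ +ᴹ-identityˡ _ ⟨
              0ᴹ +ᴹ P M (λ j → ξ i i<N j ^ e) (T v)     ≈⟨ +ᴹ-congʳ (*ₗ-zeroˡ v) ⟨
              P (suc M) (cons 0# (λ j → ξ i i<N j ^ e)) v ∎)

        module _ (T⁻¹ : Carrierᴹ → Carrierᴹ) (T⁻¹-cong : ∀ {v w} → v ≈ᴹ w → T⁻¹ v ≈ᴹ T⁻¹ w) (T⁻¹T : ∀ v → T⁻¹ (T v) ≈ᴹ v)
                 (e′ : ℕ) (σσ⁻¹ : ∀ x → (x ^ e′) ^ e ≈ x) where

          Y⁻¹ : Carrierᴹ → Carrierᴹ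
          Y⁻¹ v = φ (T⁻¹ (φ⁻¹ v))

          -- Dually, T⁻¹ lowers all degrees by 1, and the obstruction is the constant coefficient.
          -- The power `e′` undoes the twist of the remaining coefficients.
          Y⁻¹-code : ∀ {i} (i<N : i < N) → ξ i i<N 0 ≈ 0# → Code N (λ v → Y⁻¹ (T^ i v))
          Y⁻¹-code {i} i<N first≈0 = code-cong {N} (λ v → φ-cong (T⁻¹-cong (φ⁻¹-cong (T^-cong i (ψψ⁻¹ v)))))
            (to-code (shifted N ≡.refl))
            where
            shifted : ∀ M → M ≡ N → Code N (λ v → T⁻¹ (φ⁻¹ (T^ i (ψ v))))
            shifted zero    eq = contradiction 0<N (ℕ.<-irrefl eq)
            shifted (suc M) eq = cut M β , λ v → begin
                T⁻¹ (φ⁻¹ (T^ i (ψ v)))                        ≈⟨ T⁻¹-cong (proj₂ (X i i<N) v) ⟩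
                T⁻¹ (P N (ξ i i<N) v)                         ≡⟨ ≡.cong (λ N → T⁻¹ (P N (ξ i i<N) v)) eq ⟨
                T⁻¹ (ξ i i<N 0 *ₗ v +ᴹ P M (ξ i i<N ∘ suc) (T v))
                  ≈⟨ T⁻¹-cong (≈ᴹ-trans (+ᴹ-congʳ (≈ᴹ-trans (*ₗ-congʳ first≈0) (*ₗ-zeroˡ v))) (+ᴹ-identityˡ _)) ⟩
                T⁻¹ (P M (ξ i i<N ∘ suc) (T v))               ≈⟨ T⁻¹-cong (P-cong M (λ j _ → σσ⁻¹ (ξ i i<N (suc j))) (T v)) ⟨
                T⁻¹ (P M (λ j → β j ^ e) (T v))               ≈⟨ T⁻¹-cong (T-P M β v) ⟨
                T⁻¹ (T (P M β v))                             ≈⟨ T⁻¹T _ ⟩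
                P M β v                                       ≈⟨ P-cut β (≡.subst (M ≤_) eq (ℕ.n≤1+n M)) v ⟨
                P N (cut M β) v                               ∎
              where
              β : ℕ → Carrier
              β j = ξ i i<N (suc j) ^ e′

        -- Degrees modulo n

        module Classes {n : ℕ} (0<n : 0 < n)
          (σ-order : ∀ i j → (∀ x → σ^ i x ≈ σ^ (i ℕ.+ j) x) → n ∣ j) (σ-n : ∀ x → σ^ n x ≈ x)
          {m : ℕ} (order : HasOrder setoid m)
          (T⁻¹ : Carrierᴹ → Carrierᴹ) (T⁻¹-cong : ∀ {v w} → v ≈ᴹ w → T⁻¹ v ≈ᴹ T⁻¹ w)
          (T⁻¹T : ∀ v → T⁻¹ (T v) ≈ᴹ v) (TT⁻¹ : ∀ v → T (T⁻¹ v) ≈ᴹ v) where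

          T^-surjective : ∀ i v → ∃ λ w → T^ i w ≈ᴹ v
          T^-surjective zero    v = v , ≈ᴹ-refl
          T^-surjective (suc i) v = let w , eq = T^-surjective i v in
            T⁻¹ w , ≈ᴹ-trans (T^-cong i (TT⁻¹ w)) eq

          T^-T : ∀ i v → T^ i (T v) ≡ T (T^ i v)
          T^-T zero    v = ≡.refl
          T^-T (suc i) v = T^-T i (T v)

          -- An operator Z which is semilinear like T sends the terms of degree ≡ i modulo n to terms of degree ≡ i + 1.
          module Homogeneous (Z : Carrierᴹ → Carrierᴹ) (Z-cong : ∀ {v w} → v ≈ᴹ w → Z v ≈ᴹ Z w)
            (Z-* : ∀ x v → Z (x *ₗ v) ≈ᴹ x ^ e *ₗ Z v) {i : ℕ} {y : ℕ → Carrier}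
            (Z∘T^ : ∀ v → Z (T^ i v) ≈ᴹ P N y v) where

            support : ∀ {l} → l < N → ¬ (y l ≈ 0#) → ∀ x → σ^ l x ≈ σ^ (suc i) x
            support {l} l<N yl≉0 x = *-cancelˡ-≉0 yl≉0 (trans
              (coefficient-equal {N} {λ l → y l * σ^ l x} {λ l → σ^ (suc i) x * y l} (ℕ.<⇒≤ N<D) eq l l<N) (*-comm _ _))
              where
              eq : ∀ v → P N (λ l → y l * σ^ l x) v ≈ᴹ P N (λ l → σ^ (suc i) x * y l) v
              eq v = begin
                P N (λ l → y l * σ^ l x) v        ≈⟨ P-* N y x v ⟨
                P N y (x *ₗ v)                    ≈⟨ Z∘T^ (x *ₗ v) ⟨
                Z (T^ i (x *ₗ v))                 ≈⟨ Z-cong (T^-* i x v) ⟩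
                Z (σ^ i x *ₗ T^ i v)              ≈⟨ Z-* (σ^ i x) (T^ i v) ⟩
                σ^ i x ^ e *ₗ Z (T^ i v)          ≈⟨ *ₗ-cong (trans (^-assocʳ x (e ℕ.^ i) e) (^-congʳ x (ℕ.*-comm (e ℕ.^ i) e))) (Z∘T^ v) ⟩
                σ^ (suc i) x *ₗ P N y v           ≈⟨ P-scale N (σ^ (suc i) x) y v ⟩
                P N (λ l → σ^ (suc i) x * y l) v  ∎

            support-above : ∀ {l} → l < N → suc i < l → ¬ (y l ≈ 0#) → ∃ λ t → l ≡ suc i ℕ.+ suc t ℕ.* n
            support-above {l} l<N i<l yl≉0 with ℕ.m≤n⇒∃[o]m+o≡n (ℕ.<⇒≤ i<l)
            ... | o , ≡.refl with σ-order (suc i) o (λ x → sym (support l<N yl≉0 x))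
            ...   | divides zero    ≡.refl = contradiction i<l (ℕ.<-irrefl (≡.sym (ℕ.+-identityʳ (suc i))))
            ...   | divides (suc t) eq = t , ≡.cong (suc i ℕ.+_) eq

            support-below : ∀ {l} → l < N → l < suc i → ¬ (y l ≈ 0#) → ∃ λ t → suc i ≡ l ℕ.+ suc t ℕ.* n
            support-below {l} l<N l<i yl≉0 with ℕ.m≤n⇒∃[o]m+o≡n (ℕ.<⇒≤ l<i)
            ... | o , eq′ with σ-order l o (λ x → trans (support l<N yl≉0 x) (σ^-≡ (≡.sym eq′)))
              where
              σ^-≡ : ∀ {i j x} → i ≡ j → σ^ i x ≈ σ^ j x
              σ^-≡ {x = x} eq = ^-congʳ x (≡.cong (e ℕ.^_) eq)
            ...   | divides zero    ≡.refl = contradiction l<i (ℕ.<-irrefl (≡.trans (≡.sym (ℕ.+-identityʳ l)) eq′))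
            ...   | divides (suc t) eq = t , ≡.trans (≡.sym eq′) (≡.cong (l ℕ.+_) eq)

            -- If Z maps all code operators of degree ≡ i into the code, then a term of Z T ^ i of degree
            -- i + 1 + t n, with t > 0, would reach the degree i + 1 + B n ≥ N when multiplied by a power of T ^ n.
            module _ (good : ∀ t → i ℕ.+ t ℕ.* n < N → Code N (λ v → Z (T^ (i ℕ.+ t ℕ.* n) v)))
                     (B : ℕ) (N≤ : N ≤ suc i ℕ.+ B ℕ.* n) (<N+n : suc i ℕ.+ B ℕ.* n < N ℕ.+ n)
                     (<D : suc i ℕ.+ B ℕ.* n < D) where

              private
                descend : ∀ k t → B ≤ suc t ℕ.+ k → suc i ℕ.+ suc t ℕ.* n < N → y (suc i ℕ.+ suc t ℕ.* n) ≈ 0#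
                descend zero    t B≤ l<N = contradiction (ℕ.≤-trans N≤ (ℕ.+-monoʳ-≤ (suc i) (ℕ.*-monoˡ-≤ n
                  (≡.subst (B ≤_) (ℕ.+-identityʳ (suc t)) B≤)))) (ℕ.<⇒≱ l<N)
                descend (suc k) t B≤ l<N with B ℕ.≤? suc t ℕ.+ k
                ... | yes B≤′ = descend k t B≤′ l<N
                ... | no B≰ = top-vanishes {N} {y} (suc k ℕ.* n) l
                    (code-cong {N} (λ v → ≈ᴹ-trans (Z-cong (≈ᴹ-reflexive (≡.trans (≡.cong (λ j → T^ j v) (ℕ.+-comm i (suc k ℕ.* n)))
                      (T^-+ (suc k ℕ.* n) i v)))) (Z∘T^ _)) (good (suc k) i+<N))
                    l<N (≡.subst (N ≤_) (≡.sym shift) N≤) (≡.subst (_< D) (≡.sym shift) <D) above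
                  where
                  l = suc i ℕ.+ suc t ℕ.* n
                  B≡ : suc t ℕ.+ suc k ≡ B
                  B≡ = ℕ.≤-antisym (≡.subst (_≤ B) (≡.sym (ℕ.+-suc (suc t) k)) (ℕ.≰⇒> B≰)) B≤
                  shift : suc k ℕ.* n ℕ.+ l ≡ suc i ℕ.+ B ℕ.* n
                  shift = ≡.trans (solve 4 (λ i t k n → k :* n :+ (i :+ t :* n) := i :+ (t :+ k) :* n) ≡.refl (suc i) (suc t) (suc k) n)
                    (≡.cong (λ B → suc i ℕ.+ B ℕ.* n) B≡)
                    where open ℕ-Solver
                  -- The term to be removed lies t + 1 ≥ 1 steps above degree i + 1, so k + 2 ≤ B.
                  -- This spare step of length n turns the bound N + n into the bound N.
                  i+<N : i ℕ.+ suc k ℕ.* n < N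
                  i+<N = ℕ.+-cancelʳ-< n _ _ (ℕ.≤-<-trans (ℕ.≤-trans
                    (ℕ.≤-reflexive (solve 3 (λ i k n → i :+ k :* n :+ n := i :+ (con 1 :+ k) :* n) ≡.refl i (suc k) n))
                    (ℕ.≤-trans (ℕ.+-monoʳ-≤ i (ℕ.*-monoˡ-≤ n (≡.subst (suc (suc k) ≤_) B≡ (s≤s (ℕ.m≤n+m (suc k) t)))))
                      (ℕ.n≤1+n _))) <N+n)
                    where open ℕ-Solver
                  above : ∀ j → l < j → j < N → y j ≈ 0#
                  above j l<j j<N with y j ≟ 0#
                  ... | yes yj≈0 = yj≈0
                  ... | no yj≉0 with support-above j<N (ℕ.<-trans (ℕ.m<m+n (suc i) (ℕ.<-≤-trans 0<n (ℕ.m≤m+n n (t ℕ.* n)))) l<j) yj≉0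
                  ...   | t′ , ≡.refl = descend k t′ (ℕ.≤-trans B≤ (≡.subst (_≤ suc t′ ℕ.+ k) (≡.sym (ℕ.+-suc (suc t) k))
                            (ℕ.+-monoˡ-≤ k (ℕ.*-cancelʳ-< n (suc t) (suc t′) (ℕ.+-cancelˡ-< (suc i) _ _ l<j))))) j<N

              high-vanishes : ∀ {l} → l < N → suc i < l → y l ≈ 0#
              high-vanishes {l} l<N i<l with y l ≟ 0#
              ... | yes yl≈0 = yl≈0
              ... | no yl≉0 with support-above l<N i<l yl≉0
              ...   | t , ≡.refl = descend B t (ℕ.m≤n+m B (suc t)) l<N

              -- A term below degree i + 1 would differ from it by a positive multiple of n, which
              -- is impossible for i + 1 < n. What remains is Z Tⁱ = κ Tⁱ⁺¹, and Tⁱ is cancelled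
              -- because it is surjective.
              monomial : suc i < n → ∃ λ κ → ∀ v → Z v ≈ᴹ κ *ₗ T v
              -- For N ≤ i + 1 the value `y (suc i)` is meaningless; `cut` makes it 0.
              monomial i<n = cut N y (suc i) , λ v → let w , T^iw≈v = T^-surjective i v in begin
                Z v                               ≈⟨ Z-cong T^iw≈v ⟨
                Z (T^ i w)                        ≈⟨ Z∘T^ w ⟩
                P N y w                           ≈⟨ P-cut y (ℕ.<⇒≤ N<D) w ⟨
                P D (cut N y) w                   ≈⟨ P-single {D} {cut N y} {suc i} i<D (λ l _ l≢ → other l l≢) w ⟩
                cut N y (suc i) *ₗ T^ (suc i) w   ≈⟨ *ₗ-congˡ (≈ᴹ-reflexive (T^-T i w)) ⟩
                cut N y (suc i) *ₗ T (T^ i w)     ≈⟨ *ₗ-congˡ (T-cong T^iw≈v) ⟩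
                cut N y (suc i) *ₗ T v            ∎
                where
                i<D : suc i < D
                i<D = ℕ.≤-<-trans (ℕ.m≤m+n (suc i) (B ℕ.* n)) <D
                vanish : ∀ l → l < N → l ≢ suc i → y l ≈ 0#
                vanish l l<N l≢ with ℕ.<-cmp l (suc i)
                ... | tri≈ _ l≡ _ = contradiction l≡ l≢
                ... | tri> _ _ i<l = high-vanishes l<N i<l
                ... | tri< l<i _ _ with y l ≟ 0#
                ...   | yes yl≈0 = yl≈0
                ...   | no yl≉0 with support-below l<N l<i yl≉0
                ...     | t , eq = contradiction (ℕ.≤-trans (ℕ.m≤m+n n (t ℕ.* n)) (ℕ.≤-trans (ℕ.m≤n+m (suc t ℕ.* n) l) (ℕ.≤-reflexive (≡.sym eq)))) (ℕ.<⇒≱ i<n)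
                other : ∀ l → l ≢ suc i → cut N y l ≈ 0#
                other l l≢ with l ℕ.<? N
                ... | yes l<N = trans (reflexive (cut-< y l<N)) (vanish l l<N l≢)
                ... | no l≮N = reflexive (cut-≥ y (ℕ.≮⇒≥ l≮N))

          σ^-periodic : ∀ i t x → σ^ (i ℕ.+ t ℕ.* n) x ≈ σ^ i x
          σ^-periodic i zero    x = ^-congʳ x (≡.cong (e ℕ.^_) (ℕ.+-identityʳ i))
          σ^-periodic i (suc t) x = trans (^-congʳ x (≡.cong (e ℕ.^_) shift))
            (trans (sym (σ^-+ n (i ℕ.+ t ℕ.* n) x)) (trans (σ-n _) (σ^-periodic i t x)))
            where
            shift : i ℕ.+ suc t ℕ.* n ≡ (i ℕ.+ t ℕ.* n) ℕ.+ n
            shift = solve 3 (λ i t n → i :+ (n :+ t) := i :+ t :+ n) ≡.refl i (t ℕ.* n) n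
              where open ℕ-Solver

          relation-periodic : ∀ i t {j} → Relation (i ℕ.+ t ℕ.* n) j → Relation i j
          relation-periodic i t {j} rel x = trans (rel x) (θ-cong (σ^-periodic i t x))

          relation-distinct : ∀ i o j → Relation i j → Relation (i ℕ.+ o) j → n ∣ o
          relation-distinct i o j rel rel′ = σ-order i o (λ x → θ-injective (trans (sym (rel x)) (rel′ x)))

          relation? : ∀ i j → Dec (Relation i j)
          relation? i j = FiniteSetoid.all? setoid order
            (λ x≈y eq → trans (σ^-cong j (θ′-cong (sym x≈y))) (trans eq (θ-cong (σ^-cong i x≈y))))
            (λ x → σ^ j (θ′ x) ≟ θ (σ^ i x))

          -- The coefficient that obstructs `Y-code` vanishes for the whole class, since the
          -- relation depends on i modulo n only.
          good-class : ∀ i → (∀ {j} → suc j ≡ N → ¬ Relation i j) →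
                       ∀ t → i ℕ.+ t ℕ.* n < N → Code N (λ v → Y (T^ (i ℕ.+ t ℕ.* n) v))
          good-class i ¬rel t i+<N = Y-code i+<N λ {j} eq → vanish j eq
            where
            vanish : ∀ j → suc j ≡ N → ξ (i ℕ.+ t ℕ.* n) i+<N j ≈ 0#
            vanish j eq with ξ (i ℕ.+ t ℕ.* n) i+<N j ≟ 0#
            ... | yes ξ≈0 = ξ≈0
            ... | no ξ≉0 = contradiction (relation-periodic i t {j} (ξ-relation {j = j} i+<N (ℕ.≤-reflexive eq) ξ≉0)) (¬rel eq)

          Y-cong : ∀ {v w} → v ≈ᴹ w → Y v ≈ᴹ Y w
          Y-cong eq = φ-cong (T-cong (φ⁻¹-cong eq))

          Y-* : ∀ x v → Y (x *ₗ v) ≈ᴹ x ^ e *ₗ Y v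
          Y-* = conj-* T e T-cong T-*

          private
            M : ℕ
            M = ℕ.pred N

            good-class-M : ∀ i → ¬ Relation i M → ∀ t → i ℕ.+ t ℕ.* n < N → Code N (λ v → Y (T^ (i ℕ.+ t ℕ.* n) v))
            good-class-M i ¬rel = good-class i (λ {j} eq rel → ¬rel (≡.subst (Relation i) (≡.cong ℕ.pred eq) rel))

            next-multiple : ∀ c → c < N ℕ.+ n → ∃ λ B → N ≤ c ℕ.+ B ℕ.* n × c ℕ.+ B ℕ.* n < N ℕ.+ n
            next-multiple c c< = search N (ℕ.≤-trans (ℕ.m≤m*n N n) (ℕ.m≤n+m (N ℕ.* n) c))
              where
              instance _ = >-nonZero 0<n
              search : ∀ B → N ≤ c ℕ.+ B ℕ.* n → ∃ λ B → N ≤ c ℕ.+ B ℕ.* n × c ℕ.+ B ℕ.* n < N ℕ.+ n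
              search zero    N≤ = 0 , N≤ , ≡.subst (_< N ℕ.+ n) (≡.sym (ℕ.+-identityʳ c)) c<
              search (suc B) N≤ with N ℕ.≤? c ℕ.+ B ℕ.* n
              ... | yes N≤′ = search B N≤′
              ... | no N≰ = suc B , N≤ , ≡.subst (_< N ℕ.+ n) (solve 3 (λ c B n → (c :+ B) :+ n := c :+ (n :+ B)) ≡.refl c (B ℕ.* n) n)
                              (ℕ.+-monoˡ-< n (ℕ.≰⇒> N≰))
                where open ℕ-Solver

          -- A comparison of top degrees along the class of `c` uses a degree in the interval from N
          -- to N + n - 1. The condition keeps this degree below `D`, where coefficients are still
          -- determined by the operator.
          Fits : ℕ → Set
          Fits c = ∀ B → c ℕ.+ B ℕ.* n < N ℕ.+ n → c ℕ.+ B ℕ.* n < D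

          monomial-class : ∀ i → i < N → suc i < n → Fits (suc i) → ¬ Relation i M → ∃ λ κ → ∀ v → Y v ≈ᴹ κ *ₗ T v
          monomial-class i i<N i<n fits ¬rel = H.monomial good B N≤ <N+n (fits B <N+n) i<n
            where
            good = good-class-M i ¬rel
            good₀ : Code N (λ v → Y (T^ i v))
            good₀ = ≡.subst (λ j → Code N (λ v → Y (T^ j v))) (ℕ.+-identityʳ i)
              (good 0 (≡.subst (_< N) (≡.sym (ℕ.+-identityʳ i)) i<N))
            module H = Homogeneous Y Y-cong Y-* {i} {proj₁ good₀} (proj₂ good₀)
            next = next-multiple (suc i) (ℕ.<-≤-trans i<n (ℕ.m≤n+m n N))
            B = proj₁ next
            N≤ = proj₁ (proj₂ next)
            <N+n = proj₂ (proj₂ next)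

          -- The classes of i and i + 1 cannot both be related to degree N - 1, because n does not
          -- divide 1.
          one-of-two-classes : ∀ i → suc i < N → suc (suc i) < n → Fits (suc i) → Fits (suc (suc i)) →
                               ∃ λ κ → ∀ v → Y v ≈ᴹ κ *ₗ T v
          one-of-two-classes i i<N i<n fits fits′ = decide (relation? i M)
            where
            decide : Dec (Relation i M) → ∃ λ κ → ∀ v → Y v ≈ᴹ κ *ₗ T v
            decide (no ¬rel) = monomial-class i (ℕ.<-trans (ℕ.n<1+n i) i<N) (ℕ.<-trans (ℕ.n<1+n (suc i)) i<n) fits ¬rel
            decide (yes rel) = monomial-class (suc i) i<N i<n fits′ (λ rel′ →
              contradiction (∣⇒≤ (relation-distinct i 1 M rel (≡.subst (λ j → Relation j M) (≡.sym (ℕ.+-comm i 1)) rel′)))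
                (ℕ.<⇒≱ (ℕ.<-≤-trans (s≤s (s≤s z≤n)) i<n)))

          -- If N + n ≤ D, every class fits, and 0 and 1 are taken. Otherwise n - 3 and n - 2 are
          -- taken, with target degrees c = n - 2 and c = n - 1: a degree c + B n with B < s is
          -- below s n = D, and with B ≥ s it is at least c + D ≥ c + N + 2 ≥ N + n.
          monomial-n≥3 : ∀ s → 3 ≤ n → 2 ≤ s → D ≡ s ℕ.* n → 2 ≤ N → N ℕ.+ 2 ≤ D → ∃ λ κ → ∀ v → Y v ≈ᴹ κ *ₗ T v
          monomial-n≥3 s 3≤n 2≤s D≡sn 2≤N N+2≤D with N ℕ.+ n ℕ.≤? D
          ... | yes N+n≤D = one-of-two-classes 0 2≤N 3≤n (λ B lt → ℕ.<-≤-trans lt N+n≤D) (λ B lt → ℕ.<-≤-trans lt N+n≤D)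
          ... | no N+n≰D = one-of-two-classes i (ℕ.<-trans (ℕ.≤-trans (ℕ.n≤1+n _) (ℕ.≤-reflexive 3+i≡n)) n<N) (ℕ.≤-reflexive 3+i≡n)
              (fits (suc i) (ℕ.≤-trans (ℕ.n≤1+n _) (ℕ.≤-reflexive 3+i≡n)) (ℕ.≤-reflexive (≡.trans (≡.sym 3+i≡n) (ℕ.+-comm 2 (suc i)))))
              (fits (suc (suc i)) (ℕ.≤-reflexive 3+i≡n) (ℕ.≤-trans (ℕ.≤-reflexive (≡.trans (≡.sym 3+i≡n) (ℕ.+-comm 1 (suc (suc i))))) (ℕ.+-monoʳ-≤ (suc (suc i)) (ℕ.n≤1+n 1))))
            where
            i = n ℕ.∸ 3
            3+i≡n : 3 ℕ.+ i ≡ n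
            3+i≡n = ℕ.m+[n∸m]≡n 3≤n
            n<N : n < N
            n<N = ℕ.+-cancelʳ-< n n N (ℕ.≤-<-trans (ℕ.≤-trans (ℕ.≤-reflexive (≡.cong (n ℕ.+_) (≡.sym (ℕ.+-identityʳ n))))
              (ℕ.≤-trans (ℕ.*-monoˡ-≤ n 2≤s) (ℕ.≤-reflexive (≡.sym D≡sn)))) (ℕ.≰⇒> N+n≰D))
            fits : ∀ c → c < n → n ≤ c ℕ.+ 2 → Fits c
            fits c c<n n≤c+2 B lt with B ℕ.<? s
            ... | yes B<s = ℕ.<-≤-trans (ℕ.+-monoˡ-< (B ℕ.* n) c<n)
                    (≡.subst (suc B ℕ.* n ≤_) (≡.sym D≡sn) (ℕ.*-monoˡ-≤ n B<s))
            ... | no B≮s = contradiction (ℕ.≤-trans (ℕ.+-monoʳ-≤ N n≤c+2)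
                    (ℕ.≤-trans (ℕ.≤-reflexive (solve 2 (λ N c → N :+ (c :+ con 2) := c :+ (N :+ con 2)) ≡.refl N c))
                    (ℕ.+-monoʳ-≤ c (ℕ.≤-trans N+2≤D (≡.subst (_≤ B ℕ.* n) (≡.sym D≡sn) (ℕ.*-monoˡ-≤ n (ℕ.≮⇒≥ B≮s))))))) (ℕ.<⇒≱ lt)
              where open ℕ-Solver

          module _ (n≡2 : n ≡ 2) (D≡N+N : D ≡ N ℕ.+ N) (2≤N : 2 ≤ N) where
            private
              fits : ∀ c → Fits c
              fits c B lt = ℕ.<-≤-trans lt (≡.subst (N ℕ.+ n ≤_) (≡.sym D≡N+N)
                (ℕ.+-monoʳ-≤ N (ℕ.≤-trans (ℕ.≤-reflexive n≡2) 2≤N)))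

              3≤D : 3 ≤ D
              3≤D = ≡.subst (3 ≤_) (≡.sym D≡N+N) (ℕ.≤-trans (ℕ.n≤1+n 3) (ℕ.+-mono-≤ 2≤N 2≤N))

              -- If class 1 is good, Z T has only terms of even degree, and those above degree 2
              -- vanish by comparison of top degrees. So Z T = z₀ + z₂ T². The module is applied to
              -- Y and to Y⁻¹; both are semilinear like T, because σ² = 1.
              module Quadratic (Z : Carrierᴹ → Carrierᴹ) (Z-cong : ∀ {v w} → v ≈ᴹ w → Z v ≈ᴹ Z w)
                (Z-* : ∀ x v → Z (x *ₗ v) ≈ᴹ x ^ e *ₗ Z v)
                (good : ∀ t → 1 ℕ.+ t ℕ.* n < N → Code N (λ v → Z (T^ (1 ℕ.+ t ℕ.* n) v))) where

                y = proj₁ (good 0 2≤N)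
                module H = Homogeneous Z Z-cong Z-* {1} {y} (proj₂ (good 0 2≤N))
                next = next-multiple 2 (ℕ.≤-trans (ℕ.≤-reflexive (≡.cong suc (≡.sym n≡2))) (ℕ.+-monoˡ-≤ n (ℕ.≤-trans (ℕ.n≤1+n 1) 2≤N)))

                high : ∀ {l} → l < N → 2 < l → y l ≈ 0#
                high = H.high-vanishes good (proj₁ next) (proj₁ (proj₂ next)) (proj₂ (proj₂ next))
                  (fits 2 (proj₁ next) (proj₂ (proj₂ next)))

                z : ℕ → Carrier
                z = cut N y

                z₁≈0 : z 1 ≈ 0#
                z₁≈0 = trans (reflexive (cut-< y 2≤N)) (vanish (y 1 ≟ 0#))
                  where
                  vanish : Dec (y 1 ≈ 0#) → y 1 ≈ 0#
                  vanish (yes eq) = eq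
                  vanish (no y₁≉0) = let t , eq = H.support-below 2≤N (ℕ.n<1+n 1) y₁≉0 in
                    contradiction (ℕ.≤-trans (ℕ.≤-reflexive (≡.sym n≡2)) (ℕ.≤-trans (ℕ.m≤m+n n (t ℕ.* n)) (ℕ.≤-reflexive (≡.sym (ℕ.suc-injective eq)))))
                      (ℕ.<⇒≱ (ℕ.n<1+n 1))

                quadratic : ∀ v → Z (T v) ≈ᴹ P 3 z v
                quadratic v = begin
                  Z (T v)      ≈⟨ proj₂ (good 0 2≤N) v ⟩
                  P N y v      ≈⟨ P-cut y (ℕ.<⇒≤ N<D) v ⟨
                  P D z v      ≈⟨ P-extend z 3≤D (λ l 3≤l _ → above l 3≤l) v ⟩
                  P 3 z v      ∎
                  where
                  above : ∀ l → 2 < l → z l ≈ 0#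
                  above l 2<l with l ℕ.<? N
                  ... | yes l<N = trans (reflexive (cut-< y l<N)) (high l<N 2<l)
                  ... | no l≮N = reflexive (cut-≥ y (ℕ.≮⇒≥ l≮N))

                scalar : z 2 ≈ 0# → ∀ v → Z (T v) ≈ᴹ z 0 *ₗ v
                scalar z₂≈0 v = ≈ᴹ-trans (quadratic v) (P-single {3} {z} {0} (s≤s z≤n) (λ
                  { 0 _ 0≢0 → contradiction ≡.refl 0≢0 ; 1 _ _ → z₁≈0 ; 2 _ _ → z₂≈0
                  ; (suc (suc (suc _))) (s≤s (s≤s (s≤s ()))) _ }) v)

                linear : z 0 ≈ 0# → ∀ v → Z v ≈ᴹ z 2 *ₗ T v
                linear z₀≈0 v = begin
                  Z v                     ≈⟨ Z-cong (TT⁻¹ v) ⟨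
                  Z (T (T⁻¹ v))           ≈⟨ quadratic (T⁻¹ v) ⟩
                  P 3 z (T⁻¹ v)           ≈⟨ P-single {3} {z} {2} (s≤s (s≤s (s≤s z≤n))) (λ
                                               { 0 _ _ → z₀≈0 ; 1 _ _ → z₁≈0 ; 2 _ 2≢2 → contradiction ≡.refl 2≢2
                                               ; (suc (suc (suc _))) (s≤s (s≤s (s≤s ()))) _ }) (T⁻¹ v) ⟩
                  z 2 *ₗ T (T (T⁻¹ v))    ≈⟨ *ₗ-congˡ (T-cong (TT⁻¹ v)) ⟩
                  z 2 *ₗ T v              ∎

              σ²≈id : ∀ x → (x ^ e) ^ e ≈ x
              σ²≈id x = trans (^-assocʳ x e e) (trans (^-congʳ x (≡.cong (e ℕ.*_) (≡.sym (ℕ.*-identityʳ e))))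
                (trans (^-congʳ x (≡.cong (e ℕ.^_) (≡.sym n≡2))) (σ-n x)))

              T⁻¹-* : ∀ x v → T⁻¹ (x *ₗ v) ≈ᴹ x ^ e *ₗ T⁻¹ v
              T⁻¹-* x v = begin
                T⁻¹ (x *ₗ v)                        ≈⟨ T⁻¹-cong (*ₗ-cong (σ²≈id x) (TT⁻¹ v)) ⟨
                T⁻¹ ((x ^ e) ^ e *ₗ T (T⁻¹ v))      ≈⟨ T⁻¹-cong (T-* (x ^ e) (T⁻¹ v)) ⟨
                T⁻¹ (T (x ^ e *ₗ T⁻¹ v))            ≈⟨ T⁻¹T _ ⟩
                x ^ e *ₗ T⁻¹ v                      ∎

              -- As N - 1 = 1 + h n belongs to the good class 1, the operator Y T^(N - 1) lies in
              -- the code. Its coefficient of degree N is z₂, hence z₂ = 0.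
              N-even : ∀ h → N ≡ suc h ℕ.* n → ¬ Relation 1 M → ∃ λ κ → ∀ v → Y (T v) ≈ᴹ κ *ₗ v
              N-even h N≡ ¬rel = z 0 , scalar (z₂≈0 (2 ℕ.<? N))
                where
                good = good-class-M 1 ¬rel
                open Quadratic Y Y-cong Y-* good
                N≡′ : h ℕ.* n ℕ.+ 2 ≡ N
                N≡′ = ≡.trans (ℕ.+-comm (h ℕ.* n) 2) (≡.trans (≡.cong (ℕ._+ h ℕ.* n) (≡.sym n≡2)) (≡.sym N≡))
                z₂≈0 : Dec (2 < N) → z 2 ≈ 0#
                z₂≈0 (no 2≮N) = reflexive (cut-≥ y (ℕ.≮⇒≥ 2≮N))
                z₂≈0 (yes 2<N) = trans (reflexive (cut-< y 2<N)) (top-vanishes {N} {y} (h ℕ.* n) 2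
                  (code-cong {N} (λ v → ≈ᴹ-trans (Y-cong (≈ᴹ-reflexive (≡.trans (≡.cong (λ j → T^ j v) (ℕ.+-comm 1 (h ℕ.* n)))
                      (T^-+ (h ℕ.* n) 1 v)))) (proj₂ (good 0 2≤N) _))
                    (good h (ℕ.≤-reflexive (≡.trans (ℕ.+-comm 2 (h ℕ.* n)) N≡′))))
                  2<N (ℕ.≤-reflexive (≡.sym N≡′)) (≡.subst (_< D) (≡.sym N≡′) N<D) (λ j 2<j j<N → high j<N 2<j))

              -- The degrees of class 1 in the code end at N - 2, which is too low to exclude z₂ as
              -- for even N. But now N - 1 is even, so class 1 is not related to degree 0 either,
              -- and Y⁻¹ is as good as Y. With Y T = p₀ + p₂ T² and Y⁻¹ T = r₀ + r₂ T², the
              -- expansion of Y Y⁻¹ T² = T² has the coefficients σ(r₀) p₀ = 0, σ(r₂) p₂ = 0 and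
              -- σ(r₀) p₂ + σ(r₂) p₀ = 1. So p₀ and p₂ cannot both be nonzero.
              N-odd : (∀ v w → φ (v +ᴹ w) ≈ᴹ φ v +ᴹ φ w) → (∀ v w → φ⁻¹ (v +ᴹ w) ≈ᴹ φ⁻¹ v +ᴹ φ⁻¹ w) →
                      ∀ h → N ≡ 1 ℕ.+ h ℕ.* n → Relation 0 M →
                      (∃ λ κ → ∀ v → Y v ≈ᴹ κ *ₗ T v) ⊎ (∃ λ κ → ∀ v → Y (T v) ≈ᴹ κ *ₗ v)
              N-odd φ-+ φ⁻¹-+ h N≡ rel₀ = decide (p 0 ≟ 0#) (p 2 ≟ 0#)
                where
                M≡ : M ≡ h ℕ.* n
                M≡ = ≡.cong ℕ.pred N≡
                ¬rel₁ : ¬ Relation 1 M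
                ¬rel₁ rel₁ = contradiction (∣⇒≤ (relation-distinct 0 1 M rel₀ rel₁)) (ℕ.<⇒≱ (ℕ.≤-reflexive (≡.sym n≡2)))
                ¬rel₁₀ : ¬ Relation 1 0
                ¬rel₁₀ rel₁₀ = contradiction (∣⇒≤ (relation-distinct 0 1 0 rel₀₀ rel₁₀)) (ℕ.<⇒≱ (ℕ.≤-reflexive (≡.sym n≡2)))
                  where
                  rel₀₀ : Relation 0 0
                  rel₀₀ x = trans (sym (trans (^-congʳ (θ′ x) (≡.cong (e ℕ.^_) M≡)) (σ^-periodic 0 h (θ′ x)))) (rel₀ x)
                Z : Carrierᴹ → Carrierᴹ
                Z = Y⁻¹ T⁻¹ T⁻¹-cong T⁻¹T e σ²≈id
                good-Z : ∀ t → 1 ℕ.+ t ℕ.* n < N → Code N (λ v → Z (T^ (1 ℕ.+ t ℕ.* n) v))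
                good-Z t t<N = Y⁻¹-code T⁻¹ T⁻¹-cong T⁻¹T e σ²≈id t<N (vanish (ξ (1 ℕ.+ t ℕ.* n) t<N 0 ≟ 0#))
                  where
                  vanish : Dec (ξ (1 ℕ.+ t ℕ.* n) t<N 0 ≈ 0#) → ξ (1 ℕ.+ t ℕ.* n) t<N 0 ≈ 0#
                  vanish (yes ξ≈0) = ξ≈0
                  vanish (no ξ≉0) = contradiction (relation-periodic 1 t {0} (ξ-relation {j = 0} t<N 0<N ξ≉0)) ¬rel₁₀
                module QY = Quadratic Y Y-cong Y-* (good-class-M 1 ¬rel₁)
                module QZ = Quadratic Z (λ eq → φ-cong (T⁻¹-cong (φ⁻¹-cong eq))) (conj-* T⁻¹ e T⁻¹-cong T⁻¹-*) good-Z
                p r : ℕ → Carrier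
                p = QY.z
                r = QZ.z
                Y-+ : ∀ v w → Y (v +ᴹ w) ≈ᴹ Y v +ᴹ Y w
                Y-+ v w = ≈ᴹ-trans (φ-cong (≈ᴹ-trans (T-cong (φ⁻¹-+ v w)) (T-+ _ _))) (φ-+ _ _)
                Z-terms : ∀ v → Z (T v) ≈ᴹ r 0 *ₗ v +ᴹ r 2 *ₗ T (T v)
                Z-terms v = ≈ᴹ-trans (QZ.quadratic v) (+ᴹ-congˡ (≈ᴹ-trans
                  (+ᴹ-cong (≈ᴹ-trans (*ₗ-congʳ QZ.z₁≈0) (*ₗ-zeroˡ _)) (+ᴹ-identityʳ _)) (+ᴹ-identityˡ _)))
                YZ : ∀ v → Y (Z v) ≈ᴹ v
                YZ v = ≈ᴹ-trans (φ-cong (≈ᴹ-trans (T-cong (φ⁻¹φ _)) (TT⁻¹ _))) (φφ⁻¹ v)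
                α β : ℕ → Carrier
                α = cut 3 (λ j → r 0 ^ e * p j)
                β = pad 2 (λ j → r 2 ^ e * p j)
                product≈T² : ∀ w → P 5 (λ j → α j + β j) w ≈ᴹ P 3 (pad 2 (cons 1# (λ _ → 0#))) w
                product≈T² w = begin
                  P 5 (λ j → α j + β j) w                         ≈⟨ P-+ 5 α β w ⟩
                  P 5 α w +ᴹ P 5 β w                              ≈⟨ +ᴹ-cong (≈ᴹ-trans (P-cut {3} {5} (λ j → r 0 ^ e * p j) (s≤s (s≤s (s≤s z≤n))) w)
                                                                        (≈ᴹ-sym (P-scale 3 (r 0 ^ e) p w)))
                                                                      (≈ᴹ-trans (≈ᴹ-sym (P-pad 2 3 (λ j → r 2 ^ e * p j) w)) (≈ᴹ-sym (P-scale 3 (r 2 ^ e) p (T (T w))))) ⟩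
                  r 0 ^ e *ₗ P 3 p w +ᴹ r 2 ^ e *ₗ P 3 p (T (T w)) ≈⟨ +ᴹ-cong (*ₗ-congˡ (QY.quadratic w)) (*ₗ-congˡ (QY.quadratic (T (T w)))) ⟨
                  r 0 ^ e *ₗ Y (T w) +ᴹ r 2 ^ e *ₗ Y (T (T (T w)))  ≈⟨ +ᴹ-cong (Y-* (r 0) (T w)) (Y-* (r 2) (T (T (T w)))) ⟨
                  Y (r 0 *ₗ T w) +ᴹ Y (r 2 *ₗ T (T (T w)))          ≈⟨ Y-+ _ _ ⟨
                  Y (r 0 *ₗ T w +ᴹ r 2 *ₗ T (T (T w)))              ≈⟨ Y-cong (Z-terms (T w)) ⟨
                  Y (Z (T (T w)))                                  ≈⟨ YZ _ ⟩
                  T (T w)                                          ≈⟨ ≈ᴹ-trans (+ᴹ-identityʳ _) (*ₗ-identityˡ _) ⟨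
                  P 1 (cons 1# (λ _ → 0#)) (T^ 2 w)                ≈⟨ P-pad 2 1 (cons 1# (λ _ → 0#)) w ⟩
                  P 3 (pad 2 (cons 1# (λ _ → 0#))) w               ∎
                5≤D : 5 ≤ D
                5≤D = ≡.subst (5 ≤_) (≡.sym D≡N+N) (ℕ.≤-trans (ℕ.n≤1+n 5) (ℕ.+-mono-≤ 3≤N 3≤N))
                  where
                  3≤N : 3 ≤ N
                  3≤N = odd h N≡
                    where
                    odd : ∀ h → N ≡ 1 ℕ.+ h ℕ.* n → 3 ≤ N
                    odd zero    eq = contradiction (≡.subst (2 ≤_) eq 2≤N) λ { (s≤s ()) }
                    odd (suc h) eq = ≡.subst (3 ≤_) (≡.sym eq) (s≤s (ℕ.≤-trans (ℕ.≤-reflexive (≡.sym n≡2)) (ℕ.m≤m+n n (h ℕ.* n))))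
                compare : ∀ i → i < 5 → cut 5 (λ j → α j + β j) i ≈ cut 3 (pad 2 (cons 1# (λ _ → 0#))) i
                compare i i<5 = coefficients-unique {5} {3} {λ j → α j + β j} {pad 2 (cons 1# (λ _ → 0#))} 5≤D 3≤D product≈T² i (ℕ.≤-trans i<5 5≤D)
                decide : Dec (p 0 ≈ 0#) → Dec (p 2 ≈ 0#) →
                         (∃ λ κ → ∀ v → Y v ≈ᴹ κ *ₗ T v) ⊎ (∃ λ κ → ∀ v → Y (T v) ≈ᴹ κ *ₗ v)
                decide (yes p₀≈0) _ = inj₁ (p 2 , QY.linear p₀≈0)
                decide (no _) (yes p₂≈0) = inj₂ (p 0 , QY.scalar p₂≈0)
                decide (no p₀≉0) (no p₂≉0) = contradiction
                  (trans (sym (compare 2 (s≤s (s≤s (s≤s z≤n)))))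
                    (trans (+-cong (trans (*-congʳ r₀≈0) (zeroˡ _)) (trans (*-congʳ r₂≈0) (zeroˡ _))) (+-identityˡ 0#))) 1≉0
                  where
                  r₀≈0 : r 0 ^ e ≈ 0#
                  r₀≈0 = xy≈0⇒y≈0 p₀≉0 (trans (*-comm _ _) (trans (sym (+-identityʳ _)) (compare 0 (s≤s z≤n))))
                  r₂≈0 : r 2 ^ e ≈ 0#
                  r₂≈0 = xy≈0⇒y≈0 p₂≉0 (trans (*-comm _ _) (trans (sym (+-identityˡ _)) (compare 4 (s≤s (s≤s (s≤s (s≤s (s≤s z≤n))))))))

            -- Class 0 yields Y = κ T at once. If it is excluded, class 1 is available, and the
            -- parity of N decides how it is used.
            monomial-n≡2 : (∀ v w → φ (v +ᴹ w) ≈ᴹ φ v +ᴹ φ w) → (∀ v w → φ⁻¹ (v +ᴹ w) ≈ᴹ φ⁻¹ v +ᴹ φ⁻¹ w) →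
                           (∃ λ κ → ∀ v → Y v ≈ᴹ κ *ₗ T v) ⊎ (∃ λ κ → ∀ v → Y (T v) ≈ᴹ κ *ₗ v)
            monomial-n≡2 φ-+ φ⁻¹-+ = decide (relation? 0 M) (parity N)
              where
              parity : ∀ N → (∃ λ h → N ≡ h ℕ.* n) ⊎ (∃ λ h → N ≡ 1 ℕ.+ h ℕ.* n)
              parity zero = inj₁ (0 , ≡.refl)
              parity (suc N) with parity N
              ... | inj₁ (h , eq) = inj₂ (h , ≡.cong suc eq)
              ... | inj₂ (h , eq) = inj₁ (suc h , ≡.trans (≡.cong suc eq) (≡.cong (ℕ._+ h ℕ.* n) (≡.sym n≡2)))
              decide : Dec (Relation 0 M) → (∃ λ h → N ≡ h ℕ.* n) ⊎ (∃ λ h → N ≡ 1 ℕ.+ h ℕ.* n) →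
                       (∃ λ κ → ∀ v → Y v ≈ᴹ κ *ₗ T v) ⊎ (∃ λ κ → ∀ v → Y (T v) ≈ᴹ κ *ₗ v)
              decide (no ¬rel) _ = inj₁ (monomial-class 0 0<N (ℕ.≤-reflexive (≡.sym n≡2)) (fits 1) ¬rel)
              decide (yes rel) (inj₁ (zero , N≡0)) = contradiction 0<N (ℕ.<-irrefl (≡.sym N≡0))
              decide (yes rel) (inj₁ (suc h , N≡)) = inj₂ (N-even h N≡ (λ rel₁ →
                contradiction (∣⇒≤ (relation-distinct 0 1 M rel rel₁)) (ℕ.<⇒≱ (ℕ.≤-reflexive (≡.sym n≡2)))))
              decide (yes rel) (inj₂ (h , N≡)) = N-odd φ-+ φ⁻¹-+ h N≡ rel

-- The operator T

positive-order : (X : Setoid a b) {Q : ℕ} → HasOrder X Q → Setoid.Carrier X → ∃ λ m → Q ≡ suc m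
positive-order X {zero}  order x with Inverse.to order x
... | ()
positive-order X {suc m} order x = m , ≡.refl

module ParameterTheory (parameters : Parameters) where
  open Parameters parameters
  open import Data.Integer.Base as ℤ using (ℤ; +_; -[1+_])

  1<p : 1 < p
  1<p = ℕ.nonTrivial⇒n>1 p
    where instance _ = prime⇒nonTrivial p-prime

  1<q : 1 < q
  1<q = ℕ.^-monoʳ-< p 1<p 1≤e

  0<n : 0 < n
  0<n = ℕ.<-trans (s≤s z≤n) 2≤n

  0<s : 0 < s
  0<s = ℕ.<-trans (s≤s z≤n) 2≤s

  0<ℓ : 0 < ℓ
  0<ℓ = ℕ.n≢0⇒n>0 (λ ℓ≡0 → contradiction (≡.trans n≡n′ℓ (≡.trans (≡.cong (n′ ℕ.*_) ℓ≡0) (ℕ.*-zeroʳ n′))) (ℕ.>⇒≢ 0<n))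

  0<n′ : 0 < n′
  0<n′ = ℕ.n≢0⇒n>0 (λ n′≡0 → contradiction (≡.trans n≡n′ℓ (≡.cong (ℕ._* ℓ) n′≡0)) (ℕ.>⇒≢ 0<n))

  coprime-h-n : Coprime h n
  coprime-h-n = gcd≡1⇒coprime gcd[h,n]

  n′∣n : n′ ∣ n
  n′∣n = divides ℓ (≡.trans n≡n′ℓ (ℕ.*-comm n′ ℓ))

  coprime-hc-n′ : Coprime (h ℕ.* c) n′
  coprime-hc-n′ {d} (d∣hc , d∣n′) = gcd≡1⇒coprime gcd[c,n′]
    (coprime-divisor {d} {h} {c} (λ { (i∣d , i∣h) → coprime-h-n (i∣h , ∣-trans i∣d (∣-trans d∣n′ n′∣n)) }) d∣hc , d∣n′)

  -- The sign of `c′` decides on which side the multiple of `n` is put.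
  cs≡ℓ-mod-n : ∃₂ λ A B → c ℕ.* s ℕ.+ A ℕ.* n ≡ ℓ ℕ.+ B ℕ.* n
  cs≡ℓ-mod-n = shift c′ ℓ≡cs+c′n
    where
    shift : ∀ c′ → + ℓ ≡ + c ℤ.* + s ℤ.+ c′ ℤ.* + n → ∃₂ λ A B → c ℕ.* s ℕ.+ A ℕ.* n ≡ ℓ ℕ.+ B ℕ.* n
    shift (+ A) eq = A , 0 , ℤ.+-injective (begin
      + (c ℕ.* s ℕ.+ A ℕ.* n)        ≡⟨ ℤ.pos-+ (c ℕ.* s) (A ℕ.* n) ⟩
      + (c ℕ.* s) ℤ.+ + (A ℕ.* n)    ≡⟨ ≡.cong₂ ℤ._+_ (ℤ.pos-* c s) (ℤ.pos-* A n) ⟩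
      + c ℤ.* + s ℤ.+ + A ℤ.* + n    ≡⟨ eq ⟨
      + ℓ                            ≡⟨ ≡.cong +_ (ℕ.+-identityʳ ℓ) ⟨
      + (ℓ ℕ.+ 0)                    ∎)
      where open ≡.≡-Reasoning
    shift -[1+ B ] eq = 0 , suc B , ℤ.+-injective (begin
      + (c ℕ.* s ℕ.+ 0)                       ≡⟨ ≡.cong +_ (ℕ.+-identityʳ (c ℕ.* s)) ⟩
      + (c ℕ.* s)                             ≡⟨ ℤ.pos-* c s ⟩
      + c ℤ.* + s                             ≡⟨ ℤ.+-identityʳ _ ⟨
      + c ℤ.* + s ℤ.+ + 0                     ≡⟨ ≡.cong (λ z → + c ℤ.* + s ℤ.+ z) (ℤ.*-zeroˡ (+ n)) ⟨
      + c ℤ.* + s ℤ.+ + 0 ℤ.* + n             ≡⟨ ≡.cong (λ z → + c ℤ.* + s ℤ.+ z ℤ.* + n) (ℤ.+-inverseˡ (+ suc B)) ⟨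
      + c ℤ.* + s ℤ.+ (-[1+ B ] ℤ.+ + suc B) ℤ.* + n
                                              ≡⟨ ≡.cong (λ z → + c ℤ.* + s ℤ.+ z) (ℤ.*-distribʳ-+ (+ n) -[1+ B ] (+ suc B)) ⟩
      + c ℤ.* + s ℤ.+ (-[1+ B ] ℤ.* + n ℤ.+ + suc B ℤ.* + n)
                                              ≡⟨ ℤ.+-assoc (+ c ℤ.* + s) (-[1+ B ] ℤ.* + n) (+ suc B ℤ.* + n) ⟨
      + c ℤ.* + s ℤ.+ -[1+ B ] ℤ.* + n ℤ.+ + suc B ℤ.* + n  ≡⟨ ≡.cong₂ ℤ._+_ eq (ℤ.pos-* (suc B) n) ⟨
      + ℓ ℤ.+ + (suc B ℕ.* n)                 ≡⟨ ℤ.pos-+ ℓ (suc B ℕ.* n) ⟨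
      + (ℓ ℕ.+ suc B ℕ.* n)                   ∎)
      where open ≡.≡-Reasoning

module SetupFields (S : Setup a₁ b₁ r₁) where
  open Setup S using (parameters; 𝕃; 𝔽ₚ; order-𝕃; order-𝔽ₚ)
  open Parameters parameters
  open ParameterTheory parameters
  open Field 𝕃 hiding (zero)
  open FieldTheory 𝕃

  private
    m+1≡|𝕃| = positive-order setoid order-𝕃 0#

  order-𝕃′ : HasOrder setoid (suc (proj₁ m+1≡|𝕃|))
  order-𝕃′ = ≡.subst (HasOrder setoid) (proj₂ m+1≡|𝕃|) order-𝕃

  open FiniteSetoid setoid order-𝕃 public using (_≟_)

  module Sub (X : Subfield 𝕃 r₁) {Q : ℕ} (order : HasOrder (Subfield.setoid X) Q) where
    open SubfieldTheory 𝕃 _≟_ X public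

    m : ℕ
    m = proj₁ (positive-order (Subfield.setoid X) order (0# , Subfield.0-closed X))

    Q≡1+m : Q ≡ suc m
    Q≡1+m = proj₂ (positive-order (Subfield.setoid X) order (0# , Subfield.0-closed X))

    order′ : HasOrder (Subfield.setoid X) (suc m)
    order′ = ≡.subst (HasOrder (Subfield.setoid X)) Q≡1+m order

    module Finite = FiniteField field′ order′

    fermat : ∀ {x} → Subfield._∈ X x → x ^ Q ≈ x
    fermat {x} x∈ = trans (^-congʳ x Q≡1+m) (trans (sym (^-proj₁ (x , x∈) (suc m))) (Finite.fermat (x , x∈)))

    -- An element outside X fixed by the Q-th power would be the Q + 1-st root of Y ^ Q - Y.
    fixed⇒∈ : ∀ {x} → x ^ Q ≈ x → Subfield._∈ X x
    fixed⇒∈ {x} fix with Fin.any? {n = suc m} (λ i → proj₁ (Finite.from i) ≟ x)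
    ... | yes (i , eq) = Subfield.resp X eq (proj₂ (Finite.from i))
    ... | no ∄ = contradiction vanish (root-bound (suc m)
        (polyFun-+-lower {suc m} {1} (s≤s Finite.0<m) (polyFun-^ (suc m)) (polyFun-scale 1 (- 1#) (polyFun-^ 1))) 1≉0 root root-injective)
      where
      root : Fin (suc (suc m)) → Carrier
      root zero    = x
      root (suc i) = proj₁ (Finite.from i)
      root-injective : ∀ {i j} → root i ≈ root j → i ≡ j
      root-injective {zero}  {zero}  eq = ≡.refl
      root-injective {zero}  {suc j} eq = contradiction (j , sym eq) ∄
      root-injective {suc i} {zero}  eq = contradiction (i , eq) ∄
      root-injective {suc i} {suc j} eq = ≡.cong suc (Finite.from-injective eq)
      fixed : ∀ i → root i ^ Q ≈ root i
      fixed zero    = fix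
      fixed (suc i) = fermat (proj₂ (Finite.from i))
      vanish : ∀ i → root i ^ suc m + - 1# * root i ^ 1 ≈ 0#
      vanish i = trans (+-cong (trans (^-congʳ (root i) (≡.sym Q≡1+m)) (fixed i))
        (trans (sym (-‿distribˡ-* 1# _)) (-‿cong (trans (*-identityˡ _) (*-identityʳ _))))) (-‿inverseʳ _)

  private
    module 𝔽ₚ′ = Sub 𝔽ₚ order-𝔽ₚ

  p×1≈0 : p ×′ 1# ≈ 0#
  p×1≈0 = trans (×.×-congˡ 𝔽ₚ′.Q≡1+m) (trans (sym (𝔽ₚ′.×-proj₁ (suc 𝔽ₚ′.m) (1# , Subfield.1-closed 𝔽ₚ))) 𝔽ₚ′.Finite.order×1≈0)

  open Characteristic 𝕃 p-prime p×1≈0 public using (^p^-+)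

iterate-+ : ∀ {A : Set a} (f : A → A) x i j → iterate f x (i ℕ.+ j) ≡ iterate f (iterate f x i) j
iterate-+ f x zero    j = ≡.refl
iterate-+ f x (suc i) j = iterate-+ f (f x) i j

iterate-suc : ∀ {A : Set a} (f : A → A) x i → iterate f x (suc i) ≡ f (iterate f x i)
iterate-suc f x zero    = ≡.refl
iterate-suc f x (suc i) = iterate-suc f (f x) i

insertAt-fromℕ : ∀ {A : Set a} {m} (xs : Vector A m) x i → Vector.insertAt xs (fromℕ m) x (inject₁ i) ≡ xs i
insertAt-fromℕ xs x zero    = ≡.refl
insertAt-fromℕ xs x (suc i) = insertAt-fromℕ (Vector.tail xs) x i

module SetupOperators (S : Setup a₁ b₁ r₁) where
  open Setup S using (parameters; 𝕃; 𝔽q; 𝕂; 𝔽; order-𝕃; order-𝔽q; order-𝕂; order-𝔽; Elem; σ; γ; N𝕃/𝔽; w;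
    w≉0; u; u≈N[w]; V; Carrierᴹ; _≈ᴹ_; _·_; shift; T)
  open Parameters parameters
  open ParameterTheory parameters
  open Field 𝕃 hiding (zero)
  open FieldTheory 𝕃
  open FrobeniusPowers 𝕃
  open SetupFields S
  private
    open Subfield using (_∈)
    module V = LeftModule V

  module 𝕂₀ = Sub 𝕂 order-𝕂
  module 𝔽₀ = Sub 𝔽 order-𝔽
  module 𝔽q₀ = Sub 𝔽q order-𝔽q

  𝕂′ : Field _ _
  𝕂′ = 𝕂₀.field′

  q^-+ : ∀ j x y → (x + y) ^ (q ℕ.^ j) ≈ x ^ (q ℕ.^ j) + y ^ (q ℕ.^ j)
  q^-+ j x y = ≡.subst (λ m → (x + y) ^ m ≈ x ^ m + y ^ m) (≡.sym (ℕ.^-*-assoc p e j)) (^p^-+ (e ℕ.* j) x y)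

  fixed-𝕂 : ∀ {x} → _∈ 𝕂 x → x ^ (q ℕ.^ n) ≈ x
  fixed-𝕂 = 𝕂₀.fermat

  fixed-𝔽 : ∀ {x} → _∈ 𝔽 x → x ^ (q ℕ.^ s) ≈ x
  fixed-𝔽 = 𝔽₀.fermat

  fixed-𝔽q : ∀ {x} → _∈ 𝔽q x → x ^ q ≈ x
  fixed-𝔽q = 𝔽q₀.fermat

  fixed-𝕃 : ∀ x → x ^ (q ℕ.^ (n′ ℕ.* s)) ≈ x
  fixed-𝕃 x = trans (^-congʳ x (proj₂ (positive-order setoid order-𝕃 0#))) (FiniteField.fermat 𝕃 order-𝕃′ x)

  fixed-mod : ∀ N {x} → x ^ (q ℕ.^ N) ≈ x → ∀ {i j} A B → i ℕ.+ A ℕ.* N ≡ j ℕ.+ B ℕ.* N → x ^ (q ℕ.^ i) ≈ x ^ (q ℕ.^ j)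
  fixed-mod N {x} fix {i} {j} A B eq = trans (sym (reduce i A)) (trans (^-congʳ x (≡.cong (q ℕ.^_) eq)) (reduce j B))
    where
    reduce : ∀ i A → x ^ (q ℕ.^ (i ℕ.+ A ℕ.* N)) ≈ x ^ (q ℕ.^ i)
    reduce i A = trans (^-congʳ x (≡.cong (q ℕ.^_) (ℕ.+-comm i (A ℕ.* N))))
      (trans (sym (^-^-+ q (A ℕ.* N) i x)) (^-congˡ (q ℕ.^ i) (fixed-* q N A fix)))

  fixed-gcd : ∀ {x} → x ^ (q ℕ.^ h) ≈ x → x ^ (q ℕ.^ n) ≈ x → x ^ q ≈ x
  fixed-gcd {x} fix-h fix-n = trans (^-congʳ x (≡.sym (ℕ.*-identityʳ q))) (one (coprime-Bézout coprime-h-n))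
    where
    one : Bézout.Identity 1 h n → x ^ (q ℕ.^ 1) ≈ x
    one (Bézout.+- i j eq) = fixed-cancel q (j ℕ.* n) 1 (fixed-* q n j fix-n)
      (trans (^-congʳ x (≡.cong (q ℕ.^_) (≡.trans (ℕ.+-comm (j ℕ.* n) 1) eq))) (fixed-* q h i fix-h))
    one (Bézout.-+ i j eq) = fixed-cancel q (i ℕ.* h) 1 (fixed-* q h i fix-h)
      (trans (^-congʳ x (≡.cong (q ℕ.^_) (≡.trans (ℕ.+-comm (i ℕ.* h) 1) eq))) (fixed-* q n j fix-n))

  σ-fixed⇒∈𝔽q : ∀ {x} → _∈ 𝕂 x → σ x ≈ x → _∈ 𝔽q x
  σ-fixed⇒∈𝔽q x∈𝕂 fix = 𝔽q₀.fixed⇒∈ (fixed-gcd fix (fixed-𝕂 x∈𝕂))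

  frobenius-injective-𝕂 : ∀ m {x y} → _∈ 𝕂 x → _∈ 𝕂 y → x ^ (q ℕ.^ m) ≈ y ^ (q ℕ.^ m) → x ≈ y
  frobenius-injective-𝕂 m x∈ y∈ = frobenius-injective q 0<n m (fixed-𝕂 x∈) (fixed-𝕂 y∈)

  -- The i-th power of the Frobenius is injective on 𝕂 and can be cancelled; then its j-th power is
  -- the identity on a field with qⁿ elements.
  frobenius-order-𝕂 : ∀ i j → (∀ {x} → _∈ 𝕂 x → x ^ (q ℕ.^ (i ℕ.+ j)) ≈ x ^ (q ℕ.^ i)) → n ∣ j
  frobenius-order-𝕂 i j eq = 𝕂₀.Finite.frobenius-order q (≡.sym 𝕂₀.Q≡1+m) j (λ (x , x∈) → trans (𝕂₀.^-proj₁ (x , x∈) (q ℕ.^ j))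
    (frobenius-injective-𝕂 i (Subfield.resp 𝕂 (𝕂₀.^-proj₁ (x , x∈) (q ℕ.^ j)) (proj₂ ((x , x∈) 𝕂^ (q ℕ.^ j)))) x∈
      (trans (^-^-+ q j i x) (trans (^-congʳ x (≡.cong (q ℕ.^_) (ℕ.+-comm j i))) (eq x∈)))))
    where
    open FieldTheory 𝕂′ using () renaming (_^_ to _𝕂^_)

  σ^-order : ∀ i j → (∀ {x} → _∈ 𝕂 x → x ^ (q ℕ.^ (h ℕ.* (i ℕ.+ j))) ≈ x ^ (q ℕ.^ (h ℕ.* i))) → n ∣ j
  σ^-order i j eq = coprime-divisor (Coprime.sym coprime-h-n) (frobenius-order-𝕂 (h ℕ.* i) (h ℕ.* j)
    (λ {x} x∈ → trans (^-congʳ x (≡.cong (q ℕ.^_) (≡.sym (ℕ.*-distribˡ-+ h i j)))) (eq x∈)))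

  iterate-σ : ∀ x i → iterate σ x i ≈ x ^ (q ℕ.^ (h ℕ.* i))
  iterate-σ x zero    = sym (trans (^-congʳ x (≡.cong (q ℕ.^_) (ℕ.*-zeroʳ h))) (*-identityʳ x))
  iterate-σ x (suc i) = trans (iterate-σ (σ x) i)
    (trans (^-^-+ q h (h ℕ.* i) x) (^-congʳ x (≡.cong (q ℕ.^_) (≡.sym (ℕ.*-suc h i)))))

  iterate-σ-cong : ∀ i {x y} → x ≈ y → iterate σ x i ≈ iterate σ y i
  iterate-σ-cong i eq = trans (iterate-σ _ i) (trans (^-congˡ (q ℕ.^ (h ℕ.* i)) eq) (sym (iterate-σ _ i)))

  iterate-σ-+ : ∀ i x y → iterate σ (x + y) i ≈ iterate σ x i + iterate σ y i
  iterate-σ-+ i x y = trans (iterate-σ _ i) (trans (q^-+ (h ℕ.* i) x y) (sym (+-cong (iterate-σ x i) (iterate-σ y i))))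

  iterate-σ-* : ∀ i x y → iterate σ (x * y) i ≈ iterate σ x i * iterate σ y i
  iterate-σ-* i x y = trans (iterate-σ _ i) (trans (^-distrib-* x y (q ℕ.^ (h ℕ.* i))) (sym (*-cong (iterate-σ x i) (iterate-σ y i))))

  iterate-σ-1 : ∀ i → iterate σ 1# i ≈ 1#
  iterate-σ-1 i = trans (iterate-σ 1# i) (1^ (q ℕ.^ (h ℕ.* i)))

  0<q^ : ∀ j → 0 < q ℕ.^ j
  0<q^ j = ℕ.m^n>0 q j
    where instance _ = >-nonZero (ℕ.<-trans (s≤s z≤n) 1<q)

  iterate-σ-0 : ∀ i → iterate σ 0# i ≈ 0#
  iterate-σ-0 i = trans (iterate-σ 0# i) (0^ _ (0<q^ (h ℕ.* i)))

  iterate-σ-n : ∀ {x} → _∈ 𝕂 x → iterate σ x n ≈ x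
  iterate-σ-n {x} x∈ = trans (iterate-σ x n) (fixed-* q n h (fixed-𝕂 x∈))

  ^-∈ : ∀ (X : Subfield 𝕃 r₁) {x} → _∈ X x → ∀ m → _∈ X (x ^ m)
  ^-∈ X x∈ zero    = Subfield.1-closed X
  ^-∈ X x∈ (suc m) = Subfield.*-closed X x∈ (^-∈ X x∈ m)

  iterate-σ-∈ : ∀ {x} → _∈ 𝕂 x → ∀ i → _∈ 𝕂 (iterate σ x i)
  iterate-σ-∈ x∈ zero    = x∈
  iterate-σ-∈ x∈ (suc i) = iterate-σ-∈ (^-∈ 𝕂 x∈ (q ℕ.^ h)) i

  γ-cong : ∀ {x y} → x ≈ y → γ x ≈ γ y
  γ-cong = ^-congˡ (q ℕ.^ (h ℕ.* c ℕ.* s))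

  γ-+ : ∀ x y → γ (x + y) ≈ γ x + γ y
  γ-+ = q^-+ (h ℕ.* c ℕ.* s)

  γ-* : ∀ x y → γ (x * y) ≈ γ x * γ y
  γ-* x y = ^-distrib-* x y (q ℕ.^ (h ℕ.* c ℕ.* s))

  γ-𝔽 : ∀ {x} → _∈ 𝔽 x → γ x ≈ x
  γ-𝔽 x∈ = fixed-* q s (h ℕ.* c) (fixed-𝔽 x∈)

  -- Here the choice of `c` and `c′` enters: γ raises to the power q^(hcs), and cs ≡ ℓ modulo n.
  -- This makes the last coordinate of `T`, which contains γ, semilinear over 𝕂.
  γ-𝕂 : ∀ {x} → _∈ 𝕂 x → γ x ≈ iterate σ x ℓ
  γ-𝕂 {x} x∈ = trans (fixed-mod n (fixed-𝕂 x∈) {h ℕ.* c ℕ.* s} {h ℕ.* ℓ} (h ℕ.* A) (h ℕ.* B) eq) (sym (iterate-σ x ℓ))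
    where
    A = proj₁ cs≡ℓ-mod-n
    B = proj₁ (proj₂ cs≡ℓ-mod-n)
    eq : h ℕ.* c ℕ.* s ℕ.+ h ℕ.* A ℕ.* n ≡ h ℕ.* ℓ ℕ.+ h ℕ.* B ℕ.* n
    eq = begin
      h ℕ.* c ℕ.* s ℕ.+ h ℕ.* A ℕ.* n    ≡⟨ solve 5 (λ h c s A n → h :* c :* s :+ h :* A :* n := h :* (c :* s :+ A :* n)) ≡.refl h c s A n ⟩
      h ℕ.* (c ℕ.* s ℕ.+ A ℕ.* n)        ≡⟨ ≡.cong (h ℕ.*_) (proj₂ (proj₂ cs≡ℓ-mod-n)) ⟩
      h ℕ.* (ℓ ℕ.+ B ℕ.* n)              ≡⟨ solve 4 (λ h l B n → h :* (l :+ B :* n) := h :* l :+ h :* B :* n) ≡.refl h ℓ B n ⟩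
      h ℕ.* ℓ ℕ.+ h ℕ.* B ℕ.* n          ∎
      where
      open ≡.≡-Reasoning
      open ℕ-Solver

  V𝕂 : LeftModule (Field.ring 𝕂′) a₁ b₁
  V𝕂 = record
    { Carrierᴹ = Carrierᴹ
    ; _≈ᴹ_ = _≈ᴹ_
    ; _+ᴹ_ = V._+ᴹ_
    ; _*ₗ_ = _·_
    ; 0ᴹ   = V.0ᴹ
    ; -ᴹ_  = V.-ᴹ_
    ; isLeftModule = record
      { isLeftSemimodule = record
        { +ᴹ-isCommutativeMonoid = V.+ᴹ-isCommutativeMonoid
        ; isPreleftSemimodule = record
          { *ₗ-cong      = λ x≈y v≈w i → *-cong (iterate-σ-cong (toℕ i) x≈y) (v≈w i)
          ; *ₗ-zeroˡ     = λ v i → trans (*-congʳ (iterate-σ-0 (toℕ i))) (zeroˡ (v i))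
          ; *ₗ-distribʳ  = λ v x y i → trans (*-congʳ (iterate-σ-+ (toℕ i) (proj₁ x) (proj₁ y))) (distribʳ (v i) _ _)
          ; *ₗ-identityˡ = λ v i → trans (*-congʳ (iterate-σ-1 (toℕ i))) (*-identityˡ (v i))
          ; *ₗ-assoc     = λ x y v i → trans (*-congʳ (iterate-σ-* (toℕ i) (proj₁ x) (proj₁ y))) (*-assoc _ _ (v i))
          ; *ₗ-zeroʳ     = λ x i → zeroʳ _
          ; *ₗ-distribˡ  = λ x v w i → distribˡ _ (v i) (w i)
          }
        }
      ; -ᴹ‿cong    = V.-ᴹ‿cong
      ; -ᴹ‿inverse = V.-ᴹ‿inverse
      }
    }

  shift-inject₁ : ∀ {m} (v : Vector Carrier (suc m)) i → shift v (inject₁ i) ≡ v (suc i)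
  shift-inject₁ v i = insertAt-fromℕ (Vector.tail v) _ i

  shift-fromℕ : ∀ {m} (v : Vector Carrier (suc m)) → shift v (fromℕ m) ≡ w * γ (v zero)
  shift-fromℕ {m} v = insertAt-lookup (Vector.tail v) (fromℕ m) _

  shift-cong : ∀ {m} {v v′ : Vector Carrier m} → (∀ i → v i ≈ v′ i) → ∀ i → shift v i ≈ shift v′ i
  shift-cong {suc m} {v} {v′} eq i with view i
  ... | ‵inject₁ j = trans (reflexive (shift-inject₁ v j)) (trans (eq (suc j)) (reflexive (≡.sym (shift-inject₁ v′ j))))
  ... | ‵fromℕ     = trans (reflexive (shift-fromℕ v)) (trans (*-congˡ (γ-cong (eq zero))) (reflexive (≡.sym (shift-fromℕ v′))))

  shift-+ : ∀ {m} (v v′ : Vector Carrier m) i → shift (λ j → v j + v′ j) i ≈ shift v i + shift v′ i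
  shift-+ {suc m} v v′ i with view i
  ... | ‵inject₁ j = reflexive (≡.trans (shift-inject₁ (λ j → v j + v′ j) j) (≡.cong₂ _+_ (≡.sym (shift-inject₁ v j)) (≡.sym (shift-inject₁ v′ j))))
  ... | ‵fromℕ     = trans (reflexive (shift-fromℕ (λ j → v j + v′ j))) (trans (trans (*-congˡ (γ-+ _ _)) (distribˡ _ _ _))
    (reflexive (≡.cong₂ _+_ (≡.sym (shift-fromℕ v)) (≡.sym (shift-fromℕ v′)))))

  *-swap : ∀ x y z → x * (y * z) ≈ y * (x * z)
  *-swap x y z = trans (sym (*-assoc x y z)) (trans (*-congʳ (*-comm x y)) (*-assoc y x z))

  -- Contains both kinds of linearity of `T`: over 𝔽 with constant `f` and `g`, and over 𝕂 with
  -- `f i` = σⁱ(x) and `g i` = σⁱ⁺¹(x). The condition on γ is what the coordinate that wraps round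
  -- demands.
  shift-scale : ∀ {m} (f g : ℕ → Carrier) → (∀ i → f (suc i) ≈ g i) → γ (f 0) ≈ f m → (v : Vector Carrier m) →
                ∀ i → shift (λ j → f (toℕ j) * v j) i ≈ g (toℕ i) * shift v i
  shift-scale {suc m} f g f≈g γf₀ v i with view i
  ... | ‵inject₁ j = trans (reflexive (shift-inject₁ (λ j → f (toℕ j) * v j) j)) (*-cong (trans (f≈g (toℕ j)) (reflexive (≡.cong g (≡.sym (Fin.toℕ-inject₁ j)))))
    (reflexive (≡.sym (shift-inject₁ v j))))
  ... | ‵fromℕ     = begin
    shift (λ j → f (toℕ j) * v j) (fromℕ m)     ≡⟨ shift-fromℕ (λ j → f (toℕ j) * v j) ⟩
    w * γ (f 0 * v zero)                        ≈⟨ *-congˡ (γ-* _ _) ⟩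
    w * (γ (f 0) * γ (v zero))                  ≈⟨ *-swap _ _ _ ⟩
    γ (f 0) * (w * γ (v zero))                  ≈⟨ *-cong (trans γf₀ (trans (f≈g m) (reflexive (≡.cong g (≡.sym (Fin.toℕ-fromℕ m))))))
                                                          (reflexive (≡.sym (shift-fromℕ v))) ⟩
    g (toℕ (fromℕ m)) * shift v (fromℕ m)       ∎
    where open SetoidReasoning setoid

  T-cong : ∀ {v v′} → v ≈ᴹ v′ → T v ≈ᴹ T v′
  T-cong = shift-cong

  T-+ : ∀ v v′ → T (v V.+ᴹ v′) ≈ᴹ T v V.+ᴹ T v′
  T-+ = shift-+

  T-𝔽 : ∀ z v → T (z V.*ₗ v) ≈ᴹ z V.*ₗ T v
  T-𝔽 (z , z∈) = shift-scale (λ _ → z) (λ _ → z) (λ _ → refl) (γ-𝔽 z∈)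

  open FieldTheory 𝕂′ using () renaming (_^_ to _^𝕂_)

  T-𝕂 : ∀ x v → T (x · v) ≈ᴹ (x ^𝕂 (q ℕ.^ h)) · T v
  T-𝕂 x v i = trans (shift-scale (iterate σ (proj₁ x)) (iterate σ (σ (proj₁ x))) (λ _ → refl) (γ-𝕂 (proj₂ x)) v i)
    (*-congʳ (iterate-σ-cong (toℕ i) (sym (𝕂₀.^-proj₁ x (q ℕ.^ h)))))

  head-iterate-shift : ∀ {m} k (v : Vector Carrier (suc m)) i → toℕ i ≡ k → iterate shift v k zero ≡ v i
  head-iterate-shift zero    v zero    eq = ≡.refl
  head-iterate-shift (suc k) v (suc i) eq = ≡.trans
    (head-iterate-shift k (shift v) (inject₁ i) (≡.trans (Fin.toℕ-inject₁ i) (ℕ.suc-injective eq))) (shift-inject₁ v i)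

  -- Coordinate i is the head after i more shifts. If these i shifts are made before the other m,
  -- the head is just the i-th coordinate of `v`, and the m shifts take it round exactly once.
  iterate-shift-full : ∀ {m} (v : Vector Carrier m) i → iterate shift v m i ≡ w * γ (v i)
  iterate-shift-full {suc m} v i = begin
    iterate shift v (suc m) i                                    ≡⟨ head-iterate-shift (toℕ i) (iterate shift v (suc m)) i ≡.refl ⟨
    iterate shift (iterate shift v (suc m)) (toℕ i) zero         ≡⟨ ≡.cong (λ v → v zero) (iterate-+ shift v (suc m) (toℕ i)) ⟨
    iterate shift v (suc m ℕ.+ toℕ i) zero                       ≡⟨ ≡.cong (λ k → iterate shift v k zero) (ℕ.+-comm (suc m) (toℕ i)) ⟩
    iterate shift v (toℕ i ℕ.+ suc m) zero                       ≡⟨ ≡.cong (λ v → v zero) (iterate-+ shift v (toℕ i) (suc m)) ⟩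
    iterate shift (shift (iterate shift v (toℕ i))) m zero       ≡⟨ head-iterate-shift m (shift (iterate shift v (toℕ i))) (fromℕ m) (Fin.toℕ-fromℕ m) ⟩
    shift (iterate shift v (toℕ i)) (fromℕ m)                    ≡⟨ shift-fromℕ (iterate shift v (toℕ i)) ⟩
    w * γ (iterate shift v (toℕ i) zero)                         ≡⟨ ≡.cong (λ x → w * γ x) (head-iterate-shift (toℕ i) v i ≡.refl) ⟩
    w * γ (v i)                                                  ∎
    where open ≡.≡-Reasoning

  -- The j-th power of γ, with an exponent to the base q^s as in `N𝕃/𝔽`, whose factors are the same
  -- up to a permutation.
  γ^ : ℕ → Carrier → Carrier
  γ^ j x = x ^ ((q ℕ.^ s) ℕ.^ (h ℕ.* c ℕ.* j))

  γ-γ^ : ∀ j x → γ (γ^ j x) ≈ γ^ (suc j) x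
  γ-γ^ j x = trans (^-congʳ (γ^ j x) (≡.trans (≡.cong (q ℕ.^_) (ℕ.*-comm (h ℕ.* c) s)) (≡.sym (ℕ.^-*-assoc q s (h ℕ.* c)))))
    (trans (^-^-+ (q ℕ.^ s) (h ℕ.* c ℕ.* j) (h ℕ.* c) x)
      (^-congʳ x (≡.cong ((q ℕ.^ s) ℕ.^_) (≡.trans (ℕ.+-comm (h ℕ.* c ℕ.* j) (h ℕ.* c)) (≡.sym (ℕ.*-suc (h ℕ.* c) j))))))

  γ^-0 : ∀ x → γ^ 0 x ≈ x
  γ^-0 x = trans (^-congʳ x (≡.cong ((q ℕ.^ s) ℕ.^_) (ℕ.*-zeroʳ (h ℕ.* c)))) (*-identityʳ x)

  fixed-𝕃′ : ∀ x → x ^ ((q ℕ.^ s) ℕ.^ n′) ≈ x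
  fixed-𝕃′ x = trans (^-congʳ x (≡.trans (ℕ.^-*-assoc q s n′) (≡.cong (q ℕ.^_) (ℕ.*-comm s n′)))) (fixed-𝕃 x)

  γ^-n′ : ∀ x → γ^ n′ x ≈ x
  γ^-n′ x = fixed-* (q ℕ.^ s) n′ (h ℕ.* c) (fixed-𝕃′ x)

  N-product : ∀ x → product {n′} (λ j → γ^ (toℕ j) x) ≈ N𝕃/𝔽 x
  N-product x = periodic-sum-reindex (h ℕ.* c) n′ coprime-hc-n′ (λ j → x ^ ((q ℕ.^ s) ℕ.^ j)) (λ j →
    trans (^-congʳ x (≡.cong ((q ℕ.^ s) ℕ.^_) (ℕ.+-comm j n′))) (trans (sym (^-^-+ (q ℕ.^ s) n′ j x)) (^-congˡ ((q ℕ.^ s) ℕ.^ j) (fixed-𝕃′ x))))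
    where
    instance _ = >-nonZero 0<n′
    open MonoidSums *-commutativeMonoid

  product-map : (f : Carrier → Carrier) → f 1# ≈ 1# → (∀ x y → f (x * y) ≈ f x * f y) →
                ∀ {m} (g : Fin m → Carrier) → f (product g) ≈ product (f ∘ g)
  product-map f f-1 f-* {zero}  g = f-1
  product-map f f-1 f-* {suc m} g = trans (f-* _ _) (*-congˡ (product-map f f-1 f-* (g ∘ suc)))

  twisted-power : ∀ j x → iterate (λ x → w * γ x) x j ≈ product {j} (λ i → γ^ (toℕ i) w) * γ^ j x
  twisted-power zero    x = trans (sym (γ^-0 x)) (sym (*-identityˡ _))
  twisted-power (suc j) x = begin
    iterate (λ x → w * γ x) x (suc j)              ≡⟨ iterate-suc (λ x → w * γ x) x j ⟩
    w * γ (iterate (λ x → w * γ x) x j)            ≈⟨ *-congˡ (γ-cong (twisted-power j x)) ⟩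
    w * γ (product {j} (λ i → γ^ (toℕ i) w) * γ^ j x)  ≈⟨ *-congˡ (γ-* _ _) ⟩
    w * (γ (product {j} (λ i → γ^ (toℕ i) w)) * γ (γ^ j x))
      ≈⟨ trans (sym (*-assoc _ _ _)) (*-cong (*-cong (sym (γ^-0 w))
           (trans (product-map γ (1^ (q ℕ.^ (h ℕ.* c ℕ.* s))) γ-* {j} (λ i → γ^ (toℕ i) w)) (∏.sum-cong-≋ {j} (λ i → γ-γ^ (toℕ i) w)))) (γ-γ^ j x)) ⟩
    γ^ 0 w * product {j} (λ i → γ^ (suc (toℕ i)) w) * γ^ (suc j) x ∎
    where open SetoidReasoning setoid

  iterate-T-ℓ : ∀ j v i → iterate T v (j ℕ.* ℓ) i ≡ iterate (λ x → w * γ x) (v i) j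
  iterate-T-ℓ zero    v i = ≡.refl
  iterate-T-ℓ (suc j) v i = ≡.trans (≡.cong (λ v → v i) (iterate-+ T v ℓ (j ℕ.* ℓ)))
    (≡.trans (iterate-T-ℓ j (iterate T v ℓ) i) (≡.cong (λ x → iterate (λ x → w * γ x) x j) (iterate-shift-full v i)))

  -- ℓ applications of `T` act on every coordinate as x ↦ w γ(x). Repeating this n′ times collects
  -- the norm of `w`, while γ itself disappears because its n′-th power is the identity.
  T^n : ∀ v → iterate T v n ≈ᴹ u V.*ₗ v
  T^n v i = begin
    iterate T v n i                                       ≡⟨ ≡.cong (λ m → iterate T v m i) n≡n′ℓ ⟩
    iterate T v (n′ ℕ.* ℓ) i                              ≡⟨ iterate-T-ℓ n′ v i ⟩
    iterate (λ x → w * γ x) (v i) n′                      ≈⟨ twisted-power n′ (v i) ⟩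
    product {n′} (λ j → γ^ (toℕ j) w) * γ^ n′ (v i)       ≈⟨ *-cong (trans (N-product w) (sym u≈N[w])) (γ^-n′ (v i)) ⟩
    proj₁ u * v i                                         ∎
    where open SetoidReasoning setoid

  u≉0 : ¬ (proj₁ u ≈ 0#)
  u≉0 u≈0 = product-≉0 {n′} (λ j → w ^ ((q ℕ.^ s) ℕ.^ toℕ j)) (λ j → ^-≉0 w≉0 ((q ℕ.^ s) ℕ.^ toℕ j)) (trans (sym u≈N[w]) u≈0)

  u⁻¹ : Elem 𝔽
  u⁻¹ = proj₁ u ⁻¹ , Subfield.⁻¹-closed 𝔽 u≉0 (proj₂ u)

  u⁻¹*u : ∀ v → u⁻¹ V.*ₗ (u V.*ₗ v) ≈ᴹ v
  u⁻¹*u v i = trans (sym (*-assoc _ _ _)) (trans (*-congʳ (trans (*-comm _ _) (*-inverseʳ _ u≉0))) (*-identityˡ (v i)))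

  T⁻¹ : Carrierᴹ → Carrierᴹ
  T⁻¹ v = u⁻¹ V.*ₗ iterate T v (n ∸ 1)

  iterate-T-cong : ∀ j {v v′} → v ≈ᴹ v′ → iterate T v j ≈ᴹ iterate T v′ j
  iterate-T-cong zero    eq = eq
  iterate-T-cong (suc j) eq = iterate-T-cong j (T-cong eq)

  T⁻¹-cong : ∀ {v v′} → v ≈ᴹ v′ → T⁻¹ v ≈ᴹ T⁻¹ v′
  T⁻¹-cong eq = V.*ₗ-congˡ {u⁻¹} (iterate-T-cong (n ∸ 1) eq)

  private
    T^n′ : ∀ v → iterate T v (suc (n ∸ 1)) ≈ᴹ u V.*ₗ v
    T^n′ v = V.≈ᴹ-trans (V.≈ᴹ-reflexive (≡.cong (iterate T v) (ℕ.suc-pred n))) (T^n v)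
      where instance _ = >-nonZero 0<n

  T⁻¹T : ∀ v → T⁻¹ (T v) ≈ᴹ v
  T⁻¹T v = V.≈ᴹ-trans (V.*ₗ-congˡ {u⁻¹} (T^n′ v)) (u⁻¹*u v)

  TT⁻¹ : ∀ v → T (T⁻¹ v) ≈ᴹ v
  TT⁻¹ v = V.≈ᴹ-trans (T-𝔽 u⁻¹ _) (V.≈ᴹ-trans (V.*ₗ-congˡ {u⁻¹}
    (V.≈ᴹ-trans (V.≈ᴹ-reflexive (≡.sym (iterate-suc T v (n ∸ 1)))) (T^n′ v))) (u⁻¹*u v))

-- Linear independence of the powers of T

module SetupIndependence (S : Setup a₁ b₁ r₁) where
  open Setup S using (parameters; 𝕃; 𝔽q; 𝕂; 𝔽; Elem; σ; u; V; Carrierᴹ; _≈ᴹ_; _·_; T; F-monic;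
    F-irreducible; F[u]≈0)
  open Parameters parameters
  open ParameterTheory parameters
  open Field 𝕃 hiding (zero)
  open FieldTheory 𝕃
  open MonoidSums +-commutativeMonoid
  open FrobeniusPowers 𝕃
  open SetupFields S
  open SetupOperators S
  private
    open Subfield using (_∈)
    module V = LeftModule V
    module 𝕂′ where
      open Field 𝕂′ public
      open FieldTheory 𝕂′ public

  open SkewPolynomials 𝕂′ V𝕂 (q ℕ.^ h) T T-cong T-+ T-𝕂 public

  χ : ℕ → Elem 𝕂 → Carrier
  χ i x = proj₁ x ^ (q ℕ.^ (h ℕ.* i))

  χ-cong : ∀ i {x y : Elem 𝕂} → proj₁ x ≈ proj₁ y → χ i x ≈ χ i y
  χ-cong i = ^-congˡ (q ℕ.^ (h ℕ.* i))

  χ-separate : ∀ c (i j : Fin n) → i ≢ j → ∃ λ y → ¬ (χ (toℕ i ℕ.+ c) y ≈ χ (toℕ j ℕ.+ c) y)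
  χ-separate c i j i≢j = 𝕂₀.Finite.¬∀⇒∃¬ (λ {x} {y} → resp {x} {y}) (λ y → χ (toℕ i ℕ.+ c) y ≟ χ (toℕ j ℕ.+ c) y) (λ all → distinct all (ℕ.<-cmp (toℕ i) (toℕ j)))
    where
    resp : ∀ {x y : Elem 𝕂} → proj₁ x ≈ proj₁ y → χ (toℕ i ℕ.+ c) x ≈ χ (toℕ j ℕ.+ c) x → χ (toℕ i ℕ.+ c) y ≈ χ (toℕ j ℕ.+ c) y
    resp {x} {y} x≈y eq = trans (χ-cong (toℕ i ℕ.+ c) {y} {x} (sym x≈y)) (trans eq (χ-cong (toℕ j ℕ.+ c) {x} {y} x≈y))
    different : ∀ (i j : Fin n) → toℕ i < toℕ j → (∀ y → χ (toℕ i ℕ.+ c) y ≈ χ (toℕ j ℕ.+ c) y) → n ∣ (toℕ j ∸ toℕ i)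
    different i j i<j all = σ^-order (toℕ i ℕ.+ c) (toℕ j ∸ toℕ i) (λ {x} x∈ →
      trans (^-congʳ x (≡.cong (λ m → q ℕ.^ (h ℕ.* m)) (≡.trans (solve 3 (λ i c o → i :+ c :+ o := i :+ o :+ c) ≡.refl (toℕ i) c (toℕ j ∸ toℕ i))
        (≡.cong (ℕ._+ c) (ℕ.m+[n∸m]≡n (ℕ.<⇒≤ i<j)))))) (sym (all (x , x∈))))
      where open ℕ-Solver
    too-small : ∀ (i j : Fin n) → toℕ i < toℕ j → ¬ (n ∣ (toℕ j ∸ toℕ i))
    too-small i j i<j n∣ = contradiction (∣⇒≤ n∣) (ℕ.<⇒≱ (ℕ.≤-<-trans (ℕ.m∸n≤m (toℕ j) (toℕ i)) (Fin.toℕ<n j)))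
      where instance _ = >-nonZero (ℕ.m<n⇒0<n∸m i<j)
    distinct : (∀ y → χ (toℕ i ℕ.+ c) y ≈ χ (toℕ j ℕ.+ c) y) → _ → _
    distinct all (tri≈ _ eq _) = i≢j (Fin.toℕ-injective eq)
    distinct all (tri< lt _ _) = too-small i j lt (different i j lt all)
    distinct all (tri> _ _ gt) = too-small j i gt (different j i gt (λ y → sym (all y)))

  -- The shift by `c` is there because a scalar acts on the c-th coordinate of a vector through σᶜ.
  χ-independent : ∀ c (x : Fin n → Carrier) → (∀ y → sum (λ i → x i * χ (toℕ i ℕ.+ c) y) ≈ 0#) → ∀ i → x i ≈ 0#
  χ-independent c = characters-independent 𝕂′._*_ 𝕂′.1# (λ i → χ (toℕ i ℕ.+ c)) (λ i x y → ^-distrib-* (proj₁ x) (proj₁ y) (q ℕ.^ (h ℕ.* (toℕ i ℕ.+ c))))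
    (λ i → 1^ (q ℕ.^ (h ℕ.* (toℕ i ℕ.+ c)))) (λ {i} {j} → χ-separate c i j)

  trace : Carrier → Carrier
  trace x = sum {n} (λ i → iterate σ x (toℕ i))

  sum-∈ : ∀ (X : Subfield 𝕃 r₁) {m} (f : Fin m → Carrier) → (∀ i → _∈ X (f i)) → _∈ X (sum f)
  sum-∈ X {zero}  f f∈ = Subfield.0-closed X
  sum-∈ X {suc m} f f∈ = Subfield.+-closed X (f∈ zero) (sum-∈ X (f ∘ suc) (f∈ ∘ suc))

  frobenius-sum : ∀ j {m} (f : Fin m → Carrier) → sum f ^ (q ℕ.^ j) ≈ sum (λ i → f i ^ (q ℕ.^ j))
  frobenius-sum j {zero}  f = 0^ _ (0<q^ j)
  frobenius-sum j {suc m} f = trans (q^-+ j _ _) (+-congˡ (frobenius-sum j (f ∘ suc)))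

  trace-∈ : ∀ {x} → _∈ 𝕂 x → _∈ 𝔽q (trace x)
  trace-∈ {x} x∈ = σ-fixed⇒∈𝔽q (sum-∈ 𝕂 {n} (λ i → iterate σ x (toℕ i)) (λ i → iterate-σ-∈ x∈ (toℕ i)))
    (trans (frobenius-sum h {n} (λ i → iterate σ x (toℕ i)))
      (trans (∑.sum-cong-≋ {n} (λ i → reflexive (≡.sym (iterate-suc σ x (toℕ i)))))
        (sum-rotate (iterate σ x) n (iterate-σ-n x∈))))

  𝔽q-inclusion : RingMorphisms.IsRingHomomorphism (Field.rawRing 𝔽q₀.field′) rawRing proj₁
  𝔽q-inclusion = record
    { isSemiringHomomorphism = record
      { isNearSemiringHomomorphism = record
        { +-isMonoidHomomorphism = record
          { isMagmaHomomorphism = record { isRelHomomorphism = record { cong = id } ; homo = λ _ _ → refl }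
          ; ε-homo = refl
          }
        ; *-homo = λ _ _ → refl
        }
      ; 1#-homo = refl
      }
    ; -‿homo = λ _ → refl
    }

  powers-of-u-independent : (x : Fin s → Carrier) → (∀ i → _∈ 𝔽q (x i)) →
    sum (λ i → x i * proj₁ u ^ toℕ i) ≈ 0# → ∀ i → x i ≈ 0#
  powers-of-u-independent x x∈ rel i = powers-independent F-monic F-irreducible F[u]≈0 (λ i → x i , x∈ i) rel i
    where
    open PolynomialTheory 𝔽q₀.field′ (λ x y → proj₁ x ≟ proj₁ y)
    open Evaluation 𝕃 proj₁ 𝔽q-inclusion (proj₁ u)

  -- The relation holds for all conjugates, hence the traces of all multiples of the β t are relations between powers of u.
  σ-conjugates-independent : (β : Fin s → Elem 𝕂) →
    (∀ (c : Fin ℓ) → sum (λ t → iterate σ (proj₁ (β t)) (toℕ c) * proj₁ u ^ toℕ t) ≈ 0#) → ∀ t → proj₁ (β t) ≈ 0#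
  σ-conjugates-independent β rel t = trans (sym (trans (trans (^-congʳ x (≡.cong (q ℕ.^_) (ℕ.*-zeroʳ h))) (*-identityʳ x)) refl))
      (trans (sym (iterate-σ x 0)) (≡.subst (λ i → iterate σ x i ≈ 0#) (Fin.toℕ-fromℕ< 0<n) (conjugates≈0 (Fin.fromℕ< 0<n))))
    where
    x = proj₁ (β t)
    instance _ = >-nonZero 0<ℓ
    R : ℕ → Carrier
    R c = sum {s} (λ t → iterate σ (proj₁ (β t)) c * proj₁ u ^ toℕ t)
    -- γ fixes `u` and acts on 𝕂 as the ℓ-th power of σ, so the ℓ given relations propagate to all
    -- conjugates.
    step : ∀ c → R c ≈ 0# → R (c ℕ.+ ℓ) ≈ 0#
    step c eq = trans (sym (trans (frobenius-sum (h ℕ.* Parameters.c parameters ℕ.* s) {s} (λ t → iterate σ (proj₁ (β t)) c * proj₁ u ^ toℕ t))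
      (∑.sum-cong-≋ {s} (λ t → trans (γ-* _ _) (*-cong
        (trans (γ-𝕂 (iterate-σ-∈ (proj₂ (β t)) c)) (reflexive (≡.sym (iterate-+ σ (proj₁ (β t)) c ℓ))))
        (γ-𝔽 (^-∈ 𝔽 (proj₂ u) (toℕ t))))))))
      (trans (γ-cong eq) (0^ _ (0<q^ (h ℕ.* Parameters.c parameters ℕ.* s))))
    R≈0 : ∀ c → R c ≈ 0#
    R≈0 c = ≡.subst (λ c → R c ≈ 0#) (≡.sym (m≡m%n+[m/n]*n c ℓ)) (steps (c / ℓ))
      where
      steps : ∀ k → R (c % ℓ ℕ.+ k ℕ.* ℓ) ≈ 0#
      steps zero    = ≡.subst (λ c → R c ≈ 0#) (≡.trans (Fin.toℕ-fromℕ< (m%n<n c ℓ)) (≡.sym (ℕ.+-identityʳ (c % ℓ)))) (rel (Fin.fromℕ< (m%n<n c ℓ)))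
      steps (suc k) = ≡.subst (λ c → R c ≈ 0#) (solve 3 (λ c k l → c :+ k :+ l := c :+ (l :+ k)) ≡.refl (c % ℓ) (k ℕ.* ℓ) ℓ) (step (c % ℓ ℕ.+ k ℕ.* ℓ) (steps k))
        where open ℕ-Solver
    trace≈0 : ∀ (y : Elem 𝕂) t → trace (proj₁ y * proj₁ (β t)) ≈ 0#
    trace≈0 y = powers-of-u-independent (λ t → trace (proj₁ y * proj₁ (β t))) (λ t → trace-∈ (Subfield.*-closed 𝕂 (proj₂ y) (proj₂ (β t)))) (begin
      sum {s} (λ t → trace (proj₁ y * proj₁ (β t)) * proj₁ u ^ toℕ t)
        ≈⟨ ∑.sum-cong-≋ {s} (λ t → trans (*-comm _ _) (*-distribˡ-sum {n} (proj₁ u ^ toℕ t) (λ i → iterate σ (proj₁ y * proj₁ (β t)) (toℕ i)))) ⟩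
      sum {s} (λ t → sum {n} (λ i → proj₁ u ^ toℕ t * iterate σ (proj₁ y * proj₁ (β t)) (toℕ i)))
        ≈⟨ ∑.∑-comm {s} {n} (λ t i → proj₁ u ^ toℕ t * iterate σ (proj₁ y * proj₁ (β t)) (toℕ i)) ⟩
      sum {n} (λ i → sum {s} (λ t → proj₁ u ^ toℕ t * iterate σ (proj₁ y * proj₁ (β t)) (toℕ i)))
        ≈⟨ trans (∑.sum-cong-≋ {n} (λ i → begin
             sum {s} (λ t → proj₁ u ^ toℕ t * iterate σ (proj₁ y * proj₁ (β t)) (toℕ i))
               ≈⟨ ∑.sum-cong-≋ {s} (λ t → trans (*-congˡ (iterate-σ-* (toℕ i) (proj₁ y) (proj₁ (β t))))
                    (trans (*-swap _ _ _) (*-congˡ (*-comm _ _)))) ⟩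
             sum {s} (λ t → iterate σ (proj₁ y) (toℕ i) * (iterate σ (proj₁ (β t)) (toℕ i) * proj₁ u ^ toℕ t))
               ≈⟨ *-distribˡ-sum {s} (iterate σ (proj₁ y) (toℕ i)) (λ t → iterate σ (proj₁ (β t)) (toℕ i) * proj₁ u ^ toℕ t) ⟨
             iterate σ (proj₁ y) (toℕ i) * R (toℕ i)
               ≈⟨ trans (*-congˡ (R≈0 (toℕ i))) (zeroʳ _) ⟩
             0# ∎)) (∑.sum-replicate-zero n) ⟩
      0# ∎)
      where open SetoidReasoning setoid
    -- The trace form of 𝕂 is nondegenerate: if the trace of y x vanishes for all y, this is a
    -- relation between the conjugations with the conjugates of x as coefficients.
    conjugates≈0 : ∀ i → iterate σ x (toℕ i) ≈ 0#
    conjugates≈0 = χ-independent 0 (λ i → iterate σ x (toℕ i)) (λ y → trans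
      (∑.sum-cong-≋ {n} (λ i → trans (*-comm _ _) (trans (*-congʳ (trans
        (^-congʳ (proj₁ y) (≡.cong (λ m → q ℕ.^ (h ℕ.* m)) (ℕ.+-identityʳ (toℕ i)))) (sym (iterate-σ (proj₁ y) (toℕ i)))))
        (sym (iterate-σ-* (toℕ i) (proj₁ y) x)))))
      (trace≈0 y t))

  P-coordinate : ∀ m (α : ℕ → Elem 𝕂) v c →
    P m α v c ≈ sum {m} (λ i → iterate σ (proj₁ (α (toℕ i))) (toℕ c) * iterate T v (toℕ i) c)
  P-coordinate zero    α v c = refl
  P-coordinate (suc m) α v c = +-congˡ (P-coordinate m (α ∘ suc) (T v) c)

  iterate-T-n : ∀ t v c → iterate T v (t ℕ.* n) c ≈ proj₁ u ^ t * v c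
  iterate-T-n zero    v c = sym (*-identityˡ _)
  iterate-T-n (suc t) v c = trans (reflexive (≡.cong (λ v → v c) (iterate-+ T v n (t ℕ.* n))))
    (trans (iterate-T-n t (iterate T v n) c) (trans (*-congˡ (T^n v c)) (trans (*-swap _ _ _) (sym (*-assoc _ _ _)))))

  iterate-T-surjective : ∀ i v → ∃ λ v′ → iterate T v′ i ≈ᴹ v
  iterate-T-surjective zero    v = v , V.≈ᴹ-refl
  iterate-T-surjective (suc i) v = let v′ , eq = iterate-T-surjective i v in
    T⁻¹ v′ , V.≈ᴹ-trans (iterate-T-cong i (TT⁻¹ v′)) eq

  -- Replacing `v` by multiples x · v separates the classes of degrees modulo n, by the independence
  -- of the conjugations. Within the class of l the power T^(tn) is multiplication by uᵗ. If `v` is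
  -- chosen such that Tˡ v has all coordinates 1, its coordinates give relations between the powers
  -- of `u` whose coefficients are conjugates of the αᵢ.
  independent : ∀ α → (∀ v → P (s ℕ.* n) α v ≈ᴹ V.0ᴹ) → ∀ i → i < s ℕ.* n → proj₁ (α i) ≈ 0#
  independent α rel i i<sn = ≡.subst (λ j → proj₁ (α j) ≈ 0#)
    (≡.trans (≡.cong₂ (λ l t → l ℕ.+ t ℕ.* n) (Fin.toℕ-fromℕ< (m%n<n i n)) (Fin.toℕ-fromℕ< i/n<s)) (≡.sym (m≡m%n+[m/n]*n i n)))
    (block (Fin.fromℕ< (m%n<n i n)) (Fin.fromℕ< i/n<s))
    where
    instance _ = >-nonZero 0<n
    i/n<s : i / n < s
    i/n<s = ℕ.*-cancelʳ-< n (i / n) s (ℕ.≤-<-trans (≡.subst (i / n ℕ.* n ≤_) (≡.sym (m≡m%n+[m/n]*n i n)) (ℕ.m≤n+m _ (i % n))) i<sn)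
    coefficient : ∀ (v : Carrierᴹ) c l → Carrier
    coefficient v c l = sum {s} (λ t → iterate σ (proj₁ (α (l ℕ.+ toℕ t ℕ.* n))) (toℕ c) * iterate T v (l ℕ.+ toℕ t ℕ.* n) c)
    twist : ∀ (x : Elem 𝕂) v c j → iterate σ (proj₁ (α j 𝕂′.* σ^ j x)) (toℕ c) * iterate T v j c ≈
            χ (j ℕ.+ toℕ c) x * (iterate σ (proj₁ (α j)) (toℕ c) * iterate T v j c)
    twist x v c j = trans (*-congʳ (trans (iterate-σ-* (toℕ c) (proj₁ (α j)) (proj₁ (σ^ j x))) (trans (*-comm _ _) (*-congʳ
      (trans (iterate-σ _ (toℕ c)) (trans (^-congˡ (q ℕ.^ (h ℕ.* toℕ c)) (trans (𝕂₀.^-proj₁ x ((q ℕ.^ h) ℕ.^ j)) (^-congʳ (proj₁ x) (ℕ.^-*-assoc q h j))))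
      (trans (^-^-+ q (h ℕ.* j) (h ℕ.* toℕ c) (proj₁ x)) (^-congʳ (proj₁ x) (≡.cong (q ℕ.^_) (≡.sym (ℕ.*-distribˡ-+ h j (toℕ c))))))))))))
      (*-assoc _ _ _)
    χ-periodic : ∀ (x : Elem 𝕂) l t c → χ (l ℕ.+ t ℕ.* n ℕ.+ c) x ≈ χ (l ℕ.+ c) x
    χ-periodic x l t c = fixed-mod n (fixed-𝕂 (proj₂ x)) 0 (h ℕ.* t)
      (solve 5 (λ h l t n c → h :* (l :+ t :* n :+ c) :+ con 0 :* n := h :* (l :+ c) :+ h :* t :* n) ≡.refl h l t n c)
      where open ℕ-Solver
    relation : ∀ v c (x : Elem 𝕂) → sum {n} (λ l → coefficient v c (toℕ l) * χ (toℕ l ℕ.+ toℕ c) x) ≈ 0#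
    relation v c x = begin
      sum {n} (λ l → coefficient v c (toℕ l) * χ (toℕ l ℕ.+ toℕ c) x)
        ≈⟨ ∑.sum-cong-≋ {n} (λ l → trans (*-comm _ _) (trans
             (*-distribˡ-sum {s} (χ (toℕ l ℕ.+ toℕ c) x) (λ t → iterate σ (proj₁ (α (toℕ l ℕ.+ toℕ t ℕ.* n))) (toℕ c) * iterate T v (toℕ l ℕ.+ toℕ t ℕ.* n) c))
             (∑.sum-cong-≋ {s} (λ t → trans (*-congʳ (sym (χ-periodic x (toℕ l) (toℕ t) (toℕ c)))) (sym (twist x v c (toℕ l ℕ.+ toℕ t ℕ.* n))))))) ⟩
      sum {n} (λ l → sum {s} (λ t → g (toℕ l ℕ.+ toℕ t ℕ.* n)))   ≈⟨ sum-blocks s n g ⟨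
      sum {s ℕ.* n} (λ i → g (toℕ i))                             ≈⟨ P-coordinate (s ℕ.* n) (λ j → α j 𝕂′.* σ^ j x) v c ⟨
      P (s ℕ.* n) (λ j → α j 𝕂′.* σ^ j x) v c                     ≈⟨ P-* (s ℕ.* n) α x v c ⟨
      P (s ℕ.* n) α (x · v) c                                     ≈⟨ rel (x · v) c ⟩
      0#                                                          ∎
      where
      open SetoidReasoning setoid
      g : ℕ → Carrier
      g j = iterate σ (proj₁ (α j 𝕂′.* σ^ j x)) (toℕ c) * iterate T v j c
    block : ∀ (l : Fin n) (t : Fin s) → proj₁ (α (toℕ l ℕ.+ toℕ t ℕ.* n)) ≈ 0#
    block l = σ-conjugates-independent (λ t → α (toℕ l ℕ.+ toℕ t ℕ.* n)) (λ c → trans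
      (∑.sum-cong-≋ {s} (λ t → *-congˡ (sym (trans (reflexive (≡.cong (λ v → v c) (iterate-+ T v (toℕ l) (toℕ t ℕ.* n))))
        (trans (iterate-T-n (toℕ t) (iterate T v (toℕ l)) c) (trans (*-congˡ (proj₂ preimage c)) (*-identityʳ _)))))))
      (χ-independent (toℕ c) (λ l → coefficient v c (toℕ l)) (relation v c) l))
      where
      preimage = iterate-T-surjective (toℕ l) (λ _ → 1#)
      v = proj₁ preimage

-- The image of π is contained in ℋ

module SetupCodes (S : Setup a₁ b₁ r₁) where
  open Setup S using (parameters; 𝕃; 𝕂; Elem; 𝒞; 𝔼; V; _≈ᴹ_; _·_; T) renaming (sum to sumᴹ)
  open Parameters parameters
  open ParameterTheory parameters
  open Field 𝕃 hiding (zero)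
  open FieldTheory 𝕃
  open SetupOperators S
  open SetupIndependence S
  private
    module 𝕂′ where
      open Field 𝕂′ public
      open FieldTheory 𝕂′ public
    module V𝕂 = LeftModule V𝕂
  module V = LeftModule V
  open Endomorphisms 𝔼 V using (End; ⟦_⟧; linear)

  0<sk : 0 < s ℕ.* k
  0<sk = ℕ.<-≤-trans 0<s (ℕ.m≤m*n s k)
    where instance _ = >-nonZero 1≤k

  2≤sk : 2 ≤ s ℕ.* k
  2≤sk = ℕ.≤-trans 2≤s (ℕ.m≤m*n s k)
    where instance _ = >-nonZero 1≤k

  sk+2≤sn : s ℕ.* k ℕ.+ 2 ≤ s ℕ.* n
  sk+2≤sn = ℕ.≤-trans (ℕ.+-monoʳ-≤ (s ℕ.* k) 2≤s) (ℕ.≤-trans (ℕ.≤-reflexive (≡.trans (ℕ.+-comm (s ℕ.* k) s) (≡.sym (ℕ.*-suc s k))))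
    (ℕ.*-monoʳ-≤ s (ℕ.≤-trans (s≤s k≤n-1) (ℕ.≤-reflexive (ℕ.suc-pred n)))))
    where instance _ = >-nonZero 0<n

  sk<sn : s ℕ.* k < s ℕ.* n
  sk<sn = ℕ.≤-trans (ℕ.≤-trans (ℕ.≤-reflexive (ℕ.+-comm 1 (s ℕ.* k))) (ℕ.+-monoʳ-≤ (s ℕ.* k) (ℕ.n≤1+n 1))) sk+2≤sn

  open Independent (s ℕ.* n) independent public

  extend : ∀ {m} → (Fin m → Elem 𝕂) → ℕ → Elem 𝕂
  extend {zero}  α i       = 𝕂′.0#
  extend {suc m} α zero    = α zero
  extend {suc m} α (suc i) = extend (α ∘ suc) i

  sum≈P-extend : ∀ m (α : Fin m → Elem 𝕂) v → sumᴹ (λ i → α i · iterate T v (toℕ i)) ≈ᴹ P m (extend α) v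
  sum≈P-extend zero    α v = V.≈ᴹ-refl
  sum≈P-extend (suc m) α v = V.+ᴹ-congˡ (sum≈P-extend m (α ∘ suc) (T v))

  P≈sum : ∀ m (α : ℕ → Elem 𝕂) v → P m α v ≈ᴹ sumᴹ {m} (λ i → α (toℕ i) · iterate T v (toℕ i))
  P≈sum zero    α v = V.≈ᴹ-refl
  P≈sum (suc m) α v = V.+ᴹ-congˡ (P≈sum m (α ∘ suc) (T v))

  P-additive : ∀ m α v v′ → P m α (v V.+ᴹ v′) ≈ᴹ P m α v V.+ᴹ P m α v′
  P-additive zero    α v v′ = V.≈ᴹ-sym (V.+ᴹ-identityʳ _)
  P-additive (suc m) α v v′ = V.≈ᴹ-trans (V.+ᴹ-cong (V𝕂.*ₗ-distribˡ (α 0) v v′)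
    (V.≈ᴹ-trans (P-congᵛ m (α ∘ suc) (T-+ v v′)) (P-additive m (α ∘ suc) (T v) (T v′)))) (interchange _ _ _ _)
    where
    open import Algebra.Properties.CommutativeSemigroup (CommutativeMonoid.commutativeSemigroup V.+ᴹ-commutativeMonoid) using (interchange)

  ·-𝔽 : ∀ α z v → α · (z V.*ₗ v) ≈ᴹ z V.*ₗ (α · v)
  ·-𝔽 α z v i = *-swap _ _ _

  P-𝔽 : ∀ m α z v → P m α (z V.*ₗ v) ≈ᴹ z V.*ₗ P m α v
  P-𝔽 zero    α z v = V.≈ᴹ-sym (V.*ₗ-zeroʳ z)
  P-𝔽 (suc m) α z v = V.≈ᴹ-trans (V.+ᴹ-cong (·-𝔽 (α 0) z v)
    (V.≈ᴹ-trans (P-congᵛ m (α ∘ suc) (T-𝔽 z v)) (P-𝔽 m (α ∘ suc) z (T v)))) (V.≈ᴹ-sym (V.*ₗ-distribˡ z _ _))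

  polynomial : ℕ → (ℕ → Elem 𝕂) → End
  polynomial m α = linear (P m α) (P-congᵛ m α) (P-additive m α) (P-𝔽 m α)

  ∈⇒code : ∀ A → 𝒞 A → Code (s ℕ.* k) ⟦ A ⟧
  ∈⇒code A (α , eq) = extend α , λ v → V.≈ᴹ-trans (eq v) (sum≈P-extend (s ℕ.* k) α v)

  code⇒∈ : ∀ A → Code (s ℕ.* k) ⟦ A ⟧ → 𝒞 A
  code⇒∈ A (α , eq) = (λ i → α (toℕ i)) , λ v → V.≈ᴹ-trans (eq v) (P≈sum (s ℕ.* k) α v)

  σ^-proj₁ : ∀ i (x : Elem 𝕂) → proj₁ (σ^ i x) ≈ proj₁ x ^ (q ℕ.^ (h ℕ.* i))
  σ^-proj₁ i x = trans (𝕂₀.^-proj₁ x ((q ℕ.^ h) ℕ.^ i)) (^-congʳ (proj₁ x) (ℕ.^-*-assoc q h i))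

  σ-order : ∀ i j → (∀ x → proj₁ (σ^ i x) ≈ proj₁ (σ^ (i ℕ.+ j) x)) → n ∣ j
  σ-order i j eq = σ^-order i j (λ {x} x∈ → trans (sym (σ^-proj₁ (i ℕ.+ j) (x , x∈)))
    (trans (sym (eq (x , x∈))) (σ^-proj₁ i (x , x∈))))

  σ^-n : ∀ (x : Elem 𝕂) → proj₁ (σ^ n x) ≈ proj₁ x
  σ^-n x = trans (σ^-proj₁ n x) (trans (sym (iterate-σ (proj₁ x) n)) (iterate-σ-n (proj₂ x)))

-- The conjugate of T under an automorphism of the code

module Forward (S : Setup a₁ b₁ r₁) (B : Endomorphisms.Basis (Setup.𝔼 S) (Setup.V S) (Setup.n S)) where
  open Setup S using (parameters; 𝕃; 𝔽ₚ; 𝔽q; 𝕂; 𝔽; Elem; 𝒞; 𝔼; ℋ; ℋ⁺; ℋ⁻; σ; u; V; Carrierᴹ; _≈ᴹ_; _·_; T;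
    module WithBasis)
  open Parameters parameters
  open ParameterTheory parameters
  open Field 𝕃 hiding (zero)
  open FieldTheory 𝕃
  open SetupFields S
  open SetupOperators S
  open SetupIndependence S
  open SetupCodes S
  private
    open Subfield using (_∈)
    module 𝕂′ where
      open Field 𝕂′ public
      open FieldTheory 𝕂′ public
    module V𝕂 = LeftModule V𝕂
  open CodeAutomorphisms 𝔼 (λ x → _∈ 𝔽ₚ (proj₁ x)) V n B hiding (π)
  open WithBasis B

  module _ (M N : Invertible) (ρ : Automorphism) where
    private
      module M = Invertible M
      module N = Invertible N
      module ρ = Automorphism ρ

    φ φ⁻¹ ψ ψ⁻¹ : Carrierᴹ → Carrierᴹ
    φ v = ⟦ M.to ⟧ (L ρ v)
    φ⁻¹ v = L (ρ ⁻¹ₐ) (⟦ M.from ⟧ v)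
    ψ v = ⟦ N.from ⟧ (L ρ v)
    ψ⁻¹ v = L (ρ ⁻¹ₐ) (⟦ N.to ⟧ v)

    L-congᵛ : ∀ ρ {v v′} → v ≈ᴹ v′ → L ρ v ≈ᴹ L ρ v′
    L-congᵛ ρ = L-cong ρ ρ (λ _ → refl)

    L-inverseʳ : ∀ v → L ρ (L (ρ ⁻¹ₐ) v) ≈ᴹ v
    L-inverseʳ v = L-inverseˡ (ρ ⁻¹ₐ) v

    φ-cong : ∀ {v v′} → v ≈ᴹ v′ → φ v ≈ᴹ φ v′
    φ-cong eq = End.⟦⟧-cong M.to (L-congᵛ ρ eq)

    φ⁻¹-cong : ∀ {v v′} → v ≈ᴹ v′ → φ⁻¹ v ≈ᴹ φ⁻¹ v′
    φ⁻¹-cong eq = L-congᵛ (ρ ⁻¹ₐ) (End.⟦⟧-cong M.from eq)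

    ψ-cong : ∀ {v v′} → v ≈ᴹ v′ → ψ v ≈ᴹ ψ v′
    ψ-cong eq = End.⟦⟧-cong N.from (L-congᵛ ρ eq)

    ψ⁻¹-cong : ∀ {v v′} → v ≈ᴹ v′ → ψ⁻¹ v ≈ᴹ ψ⁻¹ v′
    ψ⁻¹-cong eq = L-congᵛ (ρ ⁻¹ₐ) (End.⟦⟧-cong N.to eq)

    φφ⁻¹ : ∀ v → φ (φ⁻¹ v) ≈ᴹ v
    φφ⁻¹ v = V.≈ᴹ-trans (End.⟦⟧-cong M.to (L-inverseʳ _)) (M.to∘from v)

    φ⁻¹φ : ∀ v → φ⁻¹ (φ v) ≈ᴹ v
    φ⁻¹φ v = V.≈ᴹ-trans (L-congᵛ (ρ ⁻¹ₐ) (M.from∘to _)) (L-inverseˡ ρ v)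

    ψψ⁻¹ : ∀ v → ψ (ψ⁻¹ v) ≈ᴹ v
    ψψ⁻¹ v = V.≈ᴹ-trans (End.⟦⟧-cong N.from (L-inverseʳ _)) (N.from∘to v)

    ψ⁻¹ψ : ∀ v → ψ⁻¹ (ψ v) ≈ᴹ v
    ψ⁻¹ψ v = V.≈ᴹ-trans (L-congᵛ (ρ ⁻¹ₐ) (N.to∘from _)) (L-inverseˡ ρ v)

    φ-+ : ∀ v v′ → φ (v V.+ᴹ v′) ≈ᴹ φ v V.+ᴹ φ v′
    φ-+ v v′ = V.≈ᴹ-trans (End.⟦⟧-cong M.to (L-+ ρ v v′)) (End.+ᴹ-homo M.to _ _)

    φ⁻¹-+ : ∀ v v′ → φ⁻¹ (v V.+ᴹ v′) ≈ᴹ φ⁻¹ v V.+ᴹ φ⁻¹ v′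
    φ⁻¹-+ v v′ = V.≈ᴹ-trans (L-congᵛ (ρ ⁻¹ₐ) (End.+ᴹ-homo M.from v v′)) (L-+ (ρ ⁻¹ₐ) _ _)

    φ-semilinear : ∀ z v → φ (z V.*ₗ v) ≈ᴹ ρ.to z V.*ₗ φ v
    φ-semilinear z v = V.≈ᴹ-trans (End.⟦⟧-cong M.to (L-semilinear ρ z v)) (End.*ₗ-homo M.to (ρ.to z) (L ρ v))

    module _ (to-𝒞 : ∀ {A} → 𝒞 A → 𝒞 ((M , N , ρ) ⋆ A))
             (from-𝒞 : ∀ {A} → 𝒞 A → ∃ λ A′ → 𝒞 A′ × A ≈ₑ (M , N , ρ) ⋆ A′) where

      to-code : ∀ {f} → Code (s ℕ.* k) f → Code (s ℕ.* k) (λ v → φ (f (ψ⁻¹ v)))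
      to-code (α , eq) = code-cong {s ℕ.* k} (λ v → φ-cong (V.≈ᴹ-sym (eq _)))
        (∈⇒code ((M , N , ρ) ⋆ A) (to-𝒞 {A} (code⇒∈ A (α , λ _ → V.≈ᴹ-refl))))
        where A = polynomial (s ℕ.* k) α

      from-code : ∀ {f} → Code (s ℕ.* k) f → Code (s ℕ.* k) (λ v → φ⁻¹ (f (ψ v)))
      from-code (α , eq) = code-cong {s ℕ.* k}
        (λ v → V.≈ᴹ-sym (V.≈ᴹ-trans (φ⁻¹-cong (V.≈ᴹ-trans (eq _) (A≈ (ψ v))))
          (V.≈ᴹ-trans (φ⁻¹φ _) (End.⟦⟧-cong A′ (ψ⁻¹ψ v)))))
        (∈⇒code A′ (proj₁ (proj₂ preimage)))
        where
        A = polynomial (s ℕ.* k) α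
        preimage = from-𝒞 {A} (code⇒∈ A (α , λ _ → V.≈ᴹ-refl))
        A′ = proj₁ preimage
        A≈ = proj₂ (proj₂ preimage)

      open Idealisers (λ x y → proj₁ x ≟ proj₁ y) (0<q^ h) 0<sk sk<sn
      open Conjugation φ φ⁻¹ ψ ψ⁻¹ φ-cong φ⁻¹-cong φφ⁻¹ φ⁻¹φ ψ-cong ψ⁻¹-cong ψψ⁻¹ ψ⁻¹ψ to-code from-code
      open Classes 0<n σ-order σ^-n 𝕂₀.order′ T⁻¹ T⁻¹-cong T⁻¹T TT⁻¹

      iterate-Y : ∀ j v → iterate Y v j ≈ᴹ φ (iterate T (φ⁻¹ v) j)
      iterate-Y zero    v = V.≈ᴹ-sym (φφ⁻¹ v)
      iterate-Y (suc j) v = V.≈ᴹ-trans (iterate-Y j (Y v)) (φ-cong (iterate-T-cong j (φ⁻¹φ _)))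

      -- Tⁿ is multiplication by `u`, and φ is semilinear with respect to ρ.
      Y^n : ∀ v → iterate Y v n ≈ᴹ ρ.to u V.*ₗ v
      Y^n v = V.≈ᴹ-trans (iterate-Y n v) (V.≈ᴹ-trans (φ-cong (T^n _)) (V.≈ᴹ-trans (φ-semilinear u _) (V.*ₗ-congˡ {ρ.to u} (φφ⁻¹ v))))

      -- On this coordinate scalars from 𝕂 act without a twist, so comparing it alone yields the
      -- equation for ρ(u).
      0ᶠ : Fin ℓ
      0ᶠ = Fin.fromℕ< 0<ℓ

      ·-0ᶠ : ∀ x v → (x · v) 0ᶠ ≈ proj₁ x * v 0ᶠ
      ·-0ᶠ x v = *-congʳ (reflexive (≡.cong (iterate σ (proj₁ x)) (Fin.toℕ-fromℕ< 0<ℓ)))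

      ρu≉0 : ¬ (proj₁ (ρ.to u) ≈ 0#)
      ρu≉0 eq = u≉0 (trans (sym (ρ.from∘to u)) (trans (ρ.from-cong {ρ.to u} {0# , Subfield.0-closed 𝔽} eq)
        (RingHom.0#-homo ρ.from-hom)))
        where
        module RingHom = RingMorphisms.IsRingHomomorphism

      -- The coefficient of (κ T)ʲ in terms of Tʲ; for j = n it is the norm of κ.
      twisted : Elem 𝕂 → ℕ → Elem 𝕂
      twisted κ zero    = 𝕂′.1#
      twisted κ (suc j) = κ 𝕂′.* twisted κ j 𝕂′.^ (q ℕ.^ h)

      twisted-product : ∀ κ j → proj₁ (twisted κ j) ≈ product {j} (λ i → iterate σ (proj₁ κ) (toℕ i))
      twisted-product κ zero    = refl
      twisted-product κ (suc j) = *-congˡ (trans (𝕂₀.^-proj₁ (twisted κ j) (q ℕ.^ h)) (trans (^-congˡ (q ℕ.^ h) (twisted-product κ j))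
        (trans (product-map σ (1^ (q ℕ.^ h)) (λ x y → ^-distrib-* x y (q ℕ.^ h)) {j} (λ i → iterate σ (proj₁ κ) (toℕ i)))
          (∏.sum-cong-≋ {j} (λ i → reflexive (≡.sym (iterate-suc σ (proj₁ κ) (toℕ i))))))))

      twisted-norm-∈ : ∀ κ → _∈ 𝔽q (proj₁ (twisted κ n))
      twisted-norm-∈ κ = σ-fixed⇒∈𝔽q (proj₂ (twisted κ n)) (trans (^-congˡ (q ℕ.^ h) (twisted-product κ n))
        (trans (product-map σ (1^ (q ℕ.^ h)) (λ x y → ^-distrib-* x y (q ℕ.^ h)) {n} (λ i → iterate σ (proj₁ κ) (toℕ i)))
        (trans (∏.sum-cong-≋ {n} (λ i → reflexive (≡.sym (iterate-suc σ (proj₁ κ) (toℕ i)))))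
        (trans (sum-rotate (iterate σ (proj₁ κ)) n (iterate-σ-n (proj₂ κ))) (sym (twisted-product κ n))))))
        where open MonoidSums *-commutativeMonoid

      iterate-monomial : ∀ {κ} → (∀ v → Y v ≈ᴹ κ · T v) → ∀ j v → iterate Y v j ≈ᴹ twisted κ j · iterate T v j
      iterate-monomial {κ} Y≈ zero    v = V.≈ᴹ-sym (V𝕂.*ₗ-identityˡ v)
      iterate-monomial {κ} Y≈ (suc j) v = begin
        iterate Y v (suc j)                                              ≡⟨ iterate-suc Y v j ⟩
        Y (iterate Y v j)                                                ≈⟨ Y-cong (iterate-monomial Y≈ j v) ⟩
        Y (twisted κ j · iterate T v j)                                  ≈⟨ Y≈ _ ⟩
        κ · T (twisted κ j · iterate T v j)                              ≈⟨ V𝕂.*ₗ-congˡ {κ} (T-𝕂 (twisted κ j) (iterate T v j)) ⟩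
        κ · (twisted κ j 𝕂′.^ (q ℕ.^ h) · T (iterate T v j))             ≈⟨ V𝕂.*ₗ-assoc κ (twisted κ j 𝕂′.^ (q ℕ.^ h)) _ ⟨
        twisted κ (suc j) · T (iterate T v j)                            ≡⟨ ≡.cong (twisted κ (suc j) ·_) (iterate-suc T v j) ⟨
        twisted κ (suc j) · iterate T v (suc j)                          ∎
        where open SetoidReasoning V.≈ᴹ-setoid

      monomial⇒ℋ⁺ : (∃ λ κ → ∀ v → Y v ≈ᴹ κ · T v) → ℋ⁺ ρ
      monomial⇒ℋ⁺ (κ , Y≈) = proj₁ (twisted κ n) , twisted-norm-∈ κ ,
        (λ eq → ρu≉0 (trans ρu≈ (trans (*-congʳ eq) (zeroˡ _)))) , ρu≈
        where
        𝟙 : Carrierᴹ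
        𝟙 _ = 1#
        ρu≈ : proj₁ (ρ.to u) ≈ proj₁ (twisted κ n) * proj₁ u
        ρu≈ = begin
          proj₁ (ρ.to u)                                   ≈⟨ *-identityʳ _ ⟨
          proj₁ (ρ.to u) * 1#                              ≈⟨ Y^n 𝟙 0ᶠ ⟨
          iterate Y 𝟙 n 0ᶠ                                 ≈⟨ iterate-monomial Y≈ n 𝟙 0ᶠ ⟩
          (twisted κ n · iterate T 𝟙 n) 0ᶠ                 ≈⟨ ·-0ᶠ (twisted κ n) (iterate T 𝟙 n) ⟩
          proj₁ (twisted κ n) * iterate T 𝟙 n 0ᶠ           ≈⟨ *-congˡ (trans (T^n 𝟙 0ᶠ) (*-identityʳ _)) ⟩
          proj₁ (twisted κ n) * proj₁ u                    ∎
          where open SetoidReasoning setoid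

      -- Y Y T T is evaluated in two ways: it is ρ(u) u because T² = u and Y² = ρ(u), and it is σ(κ)
      -- κ by the hypothesis. The latter is the norm of κ, as n = 2.
      inverse-monomial⇒ℋ⁻ : n ≡ 2 → (∃ λ κ → ∀ v → Y (T v) ≈ᴹ κ · v) → ℋ⁻ ρ
      inverse-monomial⇒ℋ⁻ n≡2 (κ , YT≈) = proj₁ λ′ , λ′∈ , (λ eq → ρu≉0 (trans ρu≈ (trans (*-congʳ eq) (zeroˡ _)))) , ρu≈
        where
        𝟙 : Carrierᴹ
        𝟙 _ = 1#
        λ′ : Elem 𝕂
        λ′ = κ 𝕂′.^ (q ℕ.^ h) 𝕂′.* κ
        σκ≈ : proj₁ (κ 𝕂′.^ (q ℕ.^ h)) ≈ σ (proj₁ κ)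
        σκ≈ = 𝕂₀.^-proj₁ κ (q ℕ.^ h)
        σσκ≈κ : σ (σ (proj₁ κ)) ≈ proj₁ κ
        σσκ≈κ = ≡.subst (λ n → iterate σ (proj₁ κ) n ≈ proj₁ κ) n≡2 (iterate-σ-n (proj₂ κ))
        λ′∈ : _∈ 𝔽q (proj₁ λ′)
        λ′∈ = σ-fixed⇒∈𝔽q (proj₂ λ′) (trans (^-distrib-* (proj₁ (κ 𝕂′.^ (q ℕ.^ h))) (proj₁ κ) (q ℕ.^ h))
          (trans (*-cong (trans (^-congˡ (q ℕ.^ h) σκ≈) σσκ≈κ) (sym σκ≈)) (*-comm _ _)))
        YYTT : ∀ v → Y (Y (T (T v))) ≈ᴹ λ′ · v
        YYTT v = begin
          Y (Y (T (T v)))                       ≈⟨ Y-cong (YT≈ (T v)) ⟩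
          Y (κ · T v)                           ≈⟨ Y-* κ (T v) ⟩
          κ 𝕂′.^ (q ℕ.^ h) · Y (T v)            ≈⟨ V𝕂.*ₗ-congˡ {κ 𝕂′.^ (q ℕ.^ h)} (YT≈ v) ⟩
          κ 𝕂′.^ (q ℕ.^ h) · (κ · v)            ≈⟨ V𝕂.*ₗ-assoc (κ 𝕂′.^ (q ℕ.^ h)) κ v ⟨
          λ′ · v                                ∎
          where open SetoidReasoning V.≈ᴹ-setoid
        ρu*u≈ : proj₁ (ρ.to u) * proj₁ u ≈ proj₁ λ′
        ρu*u≈ = begin
          proj₁ (ρ.to u) * proj₁ u              ≈⟨ *-congˡ (trans (≡.subst (λ n → iterate T 𝟙 n 0ᶠ ≈ proj₁ u * 1#) n≡2 (T^n 𝟙 0ᶠ)) (*-identityʳ _)) ⟨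
          proj₁ (ρ.to u) * T (T 𝟙) 0ᶠ           ≈⟨ ≡.subst (λ n → iterate Y (T (T 𝟙)) n 0ᶠ ≈ proj₁ (ρ.to u) * T (T 𝟙) 0ᶠ) n≡2 (Y^n (T (T 𝟙)) 0ᶠ) ⟨
          Y (Y (T (T 𝟙))) 0ᶠ                    ≈⟨ YYTT 𝟙 0ᶠ ⟩
          (λ′ · 𝟙) 0ᶠ                           ≈⟨ ·-0ᶠ λ′ 𝟙 ⟩
          proj₁ λ′ * 1#                         ≈⟨ *-identityʳ _ ⟩
          proj₁ λ′                              ∎
          where open SetoidReasoning setoid
        ρu≈ : proj₁ (ρ.to u) ≈ proj₁ λ′ * proj₁ u ⁻¹
        ρu≈ = trans (sym (*-identityʳ _)) (trans (*-congˡ (sym (*-inverseʳ (proj₁ u) u≉0))) (trans (sym (*-assoc _ _ _)) (*-congʳ ρu*u≈)))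

      stabiliser⇒ℋ : ℋ ρ
      stabiliser⇒ℋ = decide (n ℕ.≟ 2)
        where
        decide : Dec (n ≡ 2) → ℋ ρ
        decide (no n≢2) = inj₁ (monomial⇒ℋ⁺ (monomial-n≥3 s (ℕ.≤∧≢⇒< 2≤n (λ eq → n≢2 (≡.sym eq))) 2≤s ≡.refl 2≤sk sk+2≤sn))
        decide (yes n≡2) = n≡2-case (monomial-n≡2 n≡2 D≡ 2≤sk φ-+ φ⁻¹-+)
          where
          -- For n = 2 the bounds on `k` leave only 1, so sn is twice the length sk of the code.
          k≡1 : k ≡ 1
          k≡1 = ℕ.≤-antisym (≡.subst (λ n → k ≤ n ∸ 1) n≡2 k≤n-1) 1≤k
          D≡ : s ℕ.* n ≡ s ℕ.* k ℕ.+ s ℕ.* k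
          D≡ = ≡.trans (≡.cong (s ℕ.*_) (≡.trans n≡2 (≡.cong₂ ℕ._+_ (≡.sym k≡1) (≡.sym k≡1)))) (ℕ.*-distribˡ-+ s k k)
          n≡2-case : (∃ λ κ → ∀ v → Y v ≈ᴹ κ · T v) ⊎ (∃ λ κ → ∀ v → Y (T v) ≈ᴹ κ · v) → ℋ ρ
          n≡2-case (inj₁ Y≈)  = inj₁ (monomial⇒ℋ⁺ Y≈)
          n≡2-case (inj₂ YT≈) = inj₂ (n≡2 , inverse-monomial⇒ℋ⁻ n≡2 YT≈)

  π∈ℋ : ∀ x → ℋ (π x)
  π∈ℋ ((M , N , ρ) , to-𝒞 , from-𝒞) = stabiliser⇒ℋ M N ρ (λ {A} A∈ → to-𝒞 {(M , N , ρ) ⋆ A} (A , A∈ , λ _ → V.≈ᴹ-refl)) (λ {A} → from-𝒞 {A})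

-- The image of π contains ℋ

module SetupNorms (S : Setup a₁ b₁ r₁) where
  open Setup S using (parameters; 𝕃; 𝔽q; 𝕂; 𝔽; Elem; σ; γ; w; u; u≈N[w])
  open Parameters parameters
  open ParameterTheory parameters
  open Field 𝕃 hiding (zero)
  open FieldTheory 𝕃
  open FrobeniusPowers 𝕃
  open SetupFields S
  open SetupOperators S
  open MonoidSums *-commutativeMonoid
  private
    open Subfield using (_∈)
    module 𝕂′ where
      open Field 𝕂′ public
      open FieldTheory 𝕂′ public

  -- The number (qʲ - 1) / (q - 1). For j = n it is the exponent of the norm from 𝕂 to 𝔽q as a power
  -- map.
  geometric : ℕ → ℕ
  geometric zero    = 0
  geometric (suc j) = suc (q ℕ.* geometric j)

  geometric-eq : ∀ j → suc ((q ∸ 1) ℕ.* geometric j) ≡ q ℕ.^ j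
  geometric-eq zero    = ≡.cong suc (ℕ.*-zeroʳ (q ∸ 1))
  geometric-eq (suc j) = begin
    suc ((q ∸ 1) ℕ.* suc (q ℕ.* geometric j))   ≡⟨ solve 3 (λ t q g → con 1 :+ t :* (con 1 :+ q :* g) := con 1 :+ t :+ q :* (t :* g)) ≡.refl (q ∸ 1) q (geometric j) ⟩
    suc (q ∸ 1) ℕ.+ q ℕ.* ((q ∸ 1) ℕ.* geometric j)  ≡⟨ ≡.cong (ℕ._+ q ℕ.* ((q ∸ 1) ℕ.* geometric j)) (ℕ.suc-pred q) ⟩
    q ℕ.+ q ℕ.* ((q ∸ 1) ℕ.* geometric j)       ≡⟨ ℕ.*-suc q _ ⟨
    q ℕ.* suc ((q ∸ 1) ℕ.* geometric j)         ≡⟨ ≡.cong (q ℕ.*_) (geometric-eq j) ⟩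
    q ℕ.* q ℕ.^ j                               ∎
    where
    open ≡.≡-Reasoning
    open ℕ-Solver
    instance _ = >-nonZero (ℕ.<-trans (s≤s z≤n) 1<q)

  ^-geometric : ∀ j x → x ^ geometric j ≈ product {j} (λ i → x ^ (q ℕ.^ toℕ i))
  ^-geometric zero    x = refl
  ^-geometric (suc j) x = *-cong (sym (*-identityʳ x)) (trans (sym (^-assocʳ x q (geometric j)))
    (trans (^-geometric j (x ^ q)) (∏.sum-cong-≋ {j} (λ i → ^-assocʳ x q (q ℕ.^ toℕ i)))))

  norm-𝕂 : Carrier → Carrier
  norm-𝕂 x = product {n} (λ i → iterate σ x (toℕ i))

  norm-𝕂-geometric : ∀ {x} → _∈ 𝕂 x → norm-𝕂 x ≈ x ^ geometric n
  norm-𝕂-geometric {x} x∈ = begin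
    norm-𝕂 x                                        ≈⟨ ∏.sum-cong-≋ {n} (λ i → iterate-σ x (toℕ i)) ⟩
    product {n} (λ i → x ^ (q ℕ.^ (h ℕ.* toℕ i)))   ≈⟨ periodic-sum-reindex h n coprime-h-n (λ j → x ^ (q ℕ.^ j))
                                                         (λ j → fixed-mod n (fixed-𝕂 x∈) {j ℕ.+ n} {j} 0 1
                                                           (≡.trans (ℕ.+-identityʳ (j ℕ.+ n)) (≡.cong (j ℕ.+_) (≡.sym (ℕ.*-identityˡ n))))) ⟩
    product {n} (λ i → x ^ (q ℕ.^ toℕ i))           ≈⟨ ^-geometric n x ⟨
    x ^ geometric n                                 ∎
    where
    open SetoidReasoning setoid
    instance _ = >-nonZero 0<n

  𝔽q⊆𝕂 : ∀ {x} → _∈ 𝔽q x → _∈ 𝕂 x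
  𝔽q⊆𝕂 {x} x∈ = 𝕂₀.fixed⇒∈ (trans (^-congʳ x (≡.cong (q ℕ.^_) (≡.sym (ℕ.*-identityʳ n)))) (fixed-* q 1 n (trans (^-congʳ x (ℕ.*-identityʳ q)) (fixed-𝔽q x∈))))

  -- The norm is the power with exponent (qⁿ - 1) / (q - 1). Every nonzero l in 𝔽q satisfies l^(q -
  -- 1) = 1, which is the criterion of `power-surjective`.
  norm-𝕂-surjective : ∀ {l} → _∈ 𝔽q l → ¬ (l ≈ 0#) → ∃ λ (κ : Elem 𝕂) → ¬ (proj₁ κ ≈ 0#) × norm-𝕂 (proj₁ κ) ≈ l
  norm-𝕂-surjective {l} l∈ l≉0 = κ , proj₁ (proj₂ result) ,
    trans (norm-𝕂-geometric (proj₂ κ)) (trans (sym (𝕂₀.^-proj₁ κ (geometric n))) (proj₂ (proj₂ result)))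
    where
    l^[q-1]≈1 : l ^ (q ∸ 1) ≈ 1#
    l^[q-1]≈1 = *-cancelˡ-≉0 l≉0 (trans (^-congʳ l (ℕ.suc-pred q)) (trans (fixed-𝔽q l∈) (sym (*-identityʳ l))))
      where instance _ = >-nonZero (ℕ.<-trans (s≤s z≤n) 1<q)
    result = 𝕂₀.Finite.power-surjective (geometric n) (q ∸ 1)
      (ℕ.suc-injective (≡.trans (≡.sym 𝕂₀.Q≡1+m) (≡.sym (geometric-eq n))))
      {l , 𝔽q⊆𝕂 l∈} l≉0 (trans (𝕂₀.^-proj₁ (l , 𝔽q⊆𝕂 l∈) (q ∸ 1)) l^[q-1]≈1)
    κ = proj₁ result

  γ^-cong : ∀ j {x y} → x ≈ y → γ^ j x ≈ γ^ j y
  γ^-cong j = ^-congˡ ((q ℕ.^ s) ℕ.^ (h ℕ.* c ℕ.* j))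

  γ^-* : ∀ j x y → γ^ j (x * y) ≈ γ^ j x * γ^ j y
  γ^-* j x y = ^-distrib-* x y ((q ℕ.^ s) ℕ.^ (h ℕ.* c ℕ.* j))

  γ^-1# : ∀ j → γ^ j 1# ≈ 1#
  γ^-1# j = 1^ ((q ℕ.^ s) ℕ.^ (h ℕ.* c ℕ.* j))

  γ^1≈γ : ∀ x → γ^ 1 x ≈ γ x
  γ^1≈γ x = trans (sym (γ-γ^ 0 x)) (γ-cong (γ^-0 x))

  0<n′s : 0 < n′ ℕ.* s
  0<n′s = ℕ.<-≤-trans 0<n′ (ℕ.m≤m*n n′ s)
    where instance _ = >-nonZero 0<s

  -- The q-th power map of 𝕃 has order n′ s. Hence n′ s divides s h c j; cancelling s, and then h c,
  -- which is coprime to n′, leaves the claim.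
  γ^-order : ∀ i j → (∀ x → γ^ i x ≈ γ^ (i ℕ.+ j) x) → n′ ∣ j
  γ^-order i j eq = coprime-divisor (Coprime.sym coprime-hc-n′) (*-cancelˡ-∣ s (≡.subst (_∣ s ℕ.* (h ℕ.* c ℕ.* j)) (ℕ.*-comm n′ s)
    (FiniteField.frobenius-order 𝕃 order-𝕃′ q (≡.sym (proj₂ (positive-order setoid order-𝕃₀ 0#))) (s ℕ.* (h ℕ.* c ℕ.* j)) (λ x →
      frobenius-injective q 0<n′s (s ℕ.* (h ℕ.* c ℕ.* i)) (fixed-𝕃 _) (fixed-𝕃 x)
        (trans (^-^-+ q (s ℕ.* (h ℕ.* c ℕ.* j)) (s ℕ.* (h ℕ.* c ℕ.* i)) x)
          (trans (^-congʳ x (≡.trans (≡.cong (q ℕ.^_) (solve 4 (λ s d i j → s :* (d :* j) :+ s :* (d :* i) := s :* (d :* (i :+ j))) ≡.refl s (h ℕ.* c) i j))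
            (≡.sym (ℕ.^-*-assoc q s (h ℕ.* c ℕ.* (i ℕ.+ j))))))
          (trans (sym (eq x)) (^-congʳ x (ℕ.^-*-assoc q s (h ℕ.* c ℕ.* i)))))))))
    )
    where
    open ℕ-Solver
    instance _ = >-nonZero 0<s
    order-𝕃₀ = Setup.order-𝕃 S

  γ^-separate : ∀ {i j : Fin n′} → i ≢ j → ∃ λ y → ¬ (γ^ (toℕ i) y ≈ γ^ (toℕ j) y)
  γ^-separate {i} {j} i≢j = FiniteSetoid.¬∀⇒∃¬ setoid order-𝕃′
    (λ x≈y eq → trans (γ^-cong (toℕ i) (sym x≈y)) (trans eq (γ^-cong (toℕ j) x≈y)))
    (λ y → γ^ (toℕ i) y ≟ γ^ (toℕ j) y) (λ all → distinct all (ℕ.<-cmp (toℕ i) (toℕ j)))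
    where
    too-small : ∀ (i j : Fin n′) → toℕ i < toℕ j → ¬ (∀ y → γ^ (toℕ i) y ≈ γ^ (toℕ j) y)
    too-small i j i<j all = contradiction (∣⇒≤ (γ^-order (toℕ i) (toℕ j ∸ toℕ i) (λ x → trans (all x)
      (^-congʳ x (≡.cong (λ m → (q ℕ.^ s) ℕ.^ (h ℕ.* c ℕ.* m)) (≡.sym (ℕ.m+[n∸m]≡n (ℕ.<⇒≤ i<j))))))))
      (ℕ.<⇒≱ (ℕ.≤-<-trans (ℕ.m∸n≤m (toℕ j) (toℕ i)) (Fin.toℕ<n j)))
      where instance _ = >-nonZero (ℕ.m<n⇒0<n∸m i<j)
    distinct : (∀ y → γ^ (toℕ i) y ≈ γ^ (toℕ j) y) → _ → _
    distinct all (tri≈ _ eq _) = i≢j (Fin.toℕ-injective eq)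
    distinct all (tri< lt _ _) = too-small i j lt all
    distinct all (tri> _ _ gt) = too-small j i gt (λ y → sym (all y))

  norm : Carrier → Carrier
  norm x = product {n′} (λ j → γ^ (toℕ j) x)

  hilbert90-𝕃 : ∀ {x} → norm x ≈ 1# → ∃ λ y → ¬ (y ≈ 0#) × x * γ y ≈ y
  hilbert90-𝕃 {x} norm≈1 =
    let y , y≉0 , eq = Hilbert90.hilbert90 𝕃 order-𝕃′ γ^ γ^-cong
          (λ x y → trans (γ^1≈γ _) (trans (γ-+ x y) (sym (+-cong (γ^1≈γ x) (γ^1≈γ y)))))
          γ^-* γ^-1# γ^-0 (λ j x → trans (γ^1≈γ _) (γ-γ^ j x)) n′ γ^-n′ γ^-separate 0<n′ norm≈1
    in y , y≉0 , trans (*-congˡ (sym (γ^1≈γ y))) eq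

  norm-cong : ∀ {x y} → x ≈ y → norm x ≈ norm y
  norm-cong eq = ∏.sum-cong-≋ {n′} (λ j → γ^-cong (toℕ j) eq)

  norm-* : ∀ x y → norm (x * y) ≈ norm x * norm y
  norm-* x y = trans (∏.sum-cong-≋ {n′} (λ j → γ^-* (toℕ j) x y)) (∏.∑-distrib-+ {n′} (λ j → γ^ (toℕ j) x) (λ j → γ^ (toℕ j) y))

  norm-1 : norm 1# ≈ 1#
  norm-1 = trans (∏.sum-cong-≋ {n′} (λ j → γ^-1# (toℕ j))) (trans (∏.sum-replicate n′) (1^ n′))

  norm-^ : ∀ x j → norm (x ^ j) ≈ norm x ^ j
  norm-^ x zero    = norm-1
  norm-^ x (suc j) = trans (norm-* x (x ^ j)) (*-congˡ (norm-^ x j))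

  norm-w : norm w ≈ proj₁ u
  norm-w = trans (N-product w) (sym u≈N[w])

  norm-𝔽 : ∀ {x} → _∈ 𝔽 x → norm x ≈ x ^ n′
  norm-𝔽 {x} x∈ = trans (∏.sum-cong-≋ {n′} (λ j → trans (^-congʳ x (ℕ.^-*-assoc q s (h ℕ.* c ℕ.* toℕ j)))
    (trans (^-congʳ x (≡.cong (q ℕ.^_) (ℕ.*-comm s (h ℕ.* c ℕ.* toℕ j)))) (fixed-* q s (h ℕ.* c ℕ.* toℕ j) (fixed-𝔽 x∈)))))
    (∏.sum-replicate n′)

  γ^-𝕂 : ∀ {x} → _∈ 𝕂 x → ∀ j → γ^ j x ≈ iterate σ x (j ℕ.* ℓ)
  γ^-𝕂 {x} x∈ zero    = γ^-0 x
  γ^-𝕂 {x} x∈ (suc j) = trans (sym (γ-γ^ j x)) (trans (γ-cong (γ^-𝕂 x∈ j)) (trans (γ-𝕂 (iterate-σ-∈ x∈ (j ℕ.* ℓ)))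
    (reflexive (≡.trans (≡.sym (iterate-+ σ x (j ℕ.* ℓ) ℓ)) (≡.cong (iterate σ x) (ℕ.+-comm (j ℕ.* ℓ) ℓ))))))

  -- As γ is σ ^ ℓ on 𝕂, the norm of ∏_{i < ℓ} σⁱ(κ) over ⟨γ⟩ is the norm of κ over ⟨σ⟩.
  norm-partial : ∀ (κ : Elem 𝕂) → norm (product {ℓ} (λ i → iterate σ (proj₁ κ) (toℕ i))) ≈ norm-𝕂 (proj₁ κ)
  norm-partial (x , x∈) = begin
    norm (product {ℓ} (λ i → iterate σ x (toℕ i)))
      ≈⟨ product-map norm norm-1 norm-* {ℓ} (λ i → iterate σ x (toℕ i)) ⟩
    product {ℓ} (λ i → product {n′} (λ j → γ^ (toℕ j) (iterate σ x (toℕ i))))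
      ≈⟨ ∏.sum-cong-≋ {ℓ} (λ i → ∏.sum-cong-≋ {n′} (λ j → trans (γ^-𝕂 (iterate-σ-∈ x∈ (toℕ i)) (toℕ j))
           (reflexive (≡.sym (iterate-+ σ x (toℕ i) (toℕ j ℕ.* ℓ)))))) ⟩
    product {ℓ} (λ i → product {n′} (λ j → iterate σ x (toℕ i ℕ.+ toℕ j ℕ.* ℓ)))
      ≈⟨ sum-blocks n′ ℓ (iterate σ x) ⟨
    product {n′ ℕ.* ℓ} (λ i → iterate σ x (toℕ i))
      ≡⟨ ≡.cong (λ m → product {m} (λ i → iterate σ x (toℕ i))) n≡n′ℓ ⟨
    norm-𝕂 x ∎
    where open SetoidReasoning setoid

  -- The last two conditions are the coordinates of m T = κ μ T m for m(v)_i = δ_i v_i ^ (p ^ f), with w′ = w ^ (p ^ f).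
  intertwiner : ∀ {w′} → ¬ (w′ ≈ 0#) → (μ : Elem 𝔽) → ¬ (proj₁ μ ≈ 0#) → ∀ {l} → _∈ 𝔽q l → ¬ (l ≈ 0#) →
    norm w′ ≈ l * (proj₁ μ ^ n * proj₁ u) →
    ∃ λ (κ : Elem 𝕂) → ¬ (proj₁ κ ≈ 0#) × ∃ λ (δ : ℕ → Carrier) → (∀ i → ¬ (δ i ≈ 0#)) ×
      (∀ i → δ i ≈ (iterate σ (proj₁ κ) i * proj₁ μ) * δ (suc i)) × δ ℓ * w′ ≈ w * γ (δ 0)
  intertwiner {w′} w′≉0 (μ , μ∈) μ≉0 {l} l∈ l≉0 norm-w′ = κ , κ≉0 , δ , δ≉0 , δ-step , δ-wrap
    where
    open SetoidReasoning setoid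
    κ-result = norm-𝕂-surjective l∈ l≉0
    κ = proj₁ κ-result
    κ≉0 = proj₁ (proj₂ κ-result)
    f : ℕ → Carrier
    f i = iterate σ (proj₁ κ) i * μ
    f≉0 : ∀ i → ¬ (f i ≈ 0#)
    f≉0 i = *-≉0 (λ eq → ^-≉0 κ≉0 (q ℕ.^ (h ℕ.* i)) (trans (sym (iterate-σ (proj₁ κ) i)) eq)) μ≉0
    P : ℕ → Carrier
    P zero    = 1#
    P (suc i) = f i * P i
    P≉0 : ∀ i → ¬ (P i ≈ 0#)
    P≉0 zero    = 1≉0
    P≉0 (suc i) = *-≉0 (f≉0 i) (P≉0 i)
    product-snoc : ∀ m (g : ℕ → Carrier) → product {suc m} (λ i → g (toℕ i)) ≈ g m * product {m} (λ i → g (toℕ i))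
    product-snoc zero    g = refl
    product-snoc (suc m) g = trans (*-congˡ (product-snoc m (g ∘ suc))) (*-swap _ _ _)
    P-eq : ∀ i → P i ≈ product {i} (λ j → iterate σ (proj₁ κ) (toℕ j)) * μ ^ i
    P-eq zero    = sym (*-identityˡ 1#)
    P-eq (suc i) = trans (*-congˡ (P-eq i)) (trans (trans (*-assoc _ _ _) (trans (*-congˡ (*-swap _ _ _)) (sym (*-assoc _ _ _))))
      (*-congʳ (sym (product-snoc i (iterate σ (proj₁ κ))))))
    -- The choice δᵢ = d / P i satisfies the step condition for any d. The condition at ℓ then reads
    -- A γ(d) = d, and Hilbert 90 applies since κ was chosen to make the norm of A equal to 1.
    A : Carrier
    A = (w * P ℓ) * w′ ⁻¹
    norm-P : norm (P ℓ) ≈ l * μ ^ n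
    norm-P = begin
      norm (P ℓ)                                           ≈⟨ norm-cong (P-eq ℓ) ⟩
      norm (product {ℓ} (λ j → iterate σ (proj₁ κ) (toℕ j)) * μ ^ ℓ)  ≈⟨ norm-* _ (μ ^ ℓ) ⟩
      norm (product {ℓ} (λ j → iterate σ (proj₁ κ) (toℕ j))) * norm (μ ^ ℓ)
        ≈⟨ *-cong (trans (norm-partial κ) (proj₂ (proj₂ κ-result)))
             (trans (norm-^ μ ℓ) (trans (^-congˡ ℓ (norm-𝔽 μ∈)) (trans (^-assocʳ μ n′ ℓ) (^-congʳ μ (≡.sym n≡n′ℓ))))) ⟩
      l * μ ^ n                                            ∎
    norm-A : norm A ≈ 1#
    norm-A = begin
      norm ((w * P ℓ) * w′ ⁻¹)                    ≈⟨ trans (norm-* (w * P ℓ) (w′ ⁻¹)) (*-congʳ (norm-* w (P ℓ))) ⟩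
      (norm w * norm (P ℓ)) * norm (w′ ⁻¹)        ≈⟨ *-congʳ (*-cong norm-w norm-P) ⟩
      (proj₁ u * (l * μ ^ n)) * norm (w′ ⁻¹)      ≈⟨ *-congʳ (trans (*-swap _ _ _) (*-congˡ (*-comm _ _))) ⟩
      (l * (μ ^ n * proj₁ u)) * norm (w′ ⁻¹)      ≈⟨ *-congʳ norm-w′ ⟨
      norm w′ * norm (w′ ⁻¹)                      ≈⟨ norm-* w′ (w′ ⁻¹) ⟨
      norm (w′ * w′ ⁻¹)                           ≈⟨ norm-cong (*-inverseʳ w′ w′≉0) ⟩
      norm 1#                                     ≈⟨ norm-1 ⟩
      1#                                          ∎
    hilbert = hilbert90-𝕃 norm-A
    d = proj₁ hilbert
    δ : ℕ → Carrier
    δ i = d * P i ⁻¹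
    δ≉0 : ∀ i → ¬ (δ i ≈ 0#)
    δ≉0 i = *-≉0 (proj₁ (proj₂ hilbert)) (⁻¹-≉0 (P≉0 i))
    δ-step : ∀ i → δ i ≈ f i * δ (suc i)
    δ-step i = *-cancelˡ-≉0 (P≉0 i) (begin
      P i * (d * P i ⁻¹)                          ≈⟨ trans (*-swap _ _ _) (trans (*-congˡ (*-inverseʳ _ (P≉0 i))) (sym (*-congˡ (*-inverseʳ _ (P≉0 (suc i)))))) ⟩
      d * (f i * P i * P (suc i) ⁻¹)              ≈⟨ *-congˡ (trans (*-congʳ (*-comm _ _)) (*-assoc _ _ _)) ⟩
      d * (P i * (f i * P (suc i) ⁻¹))            ≈⟨ *-swap _ _ _ ⟩
      P i * (d * (f i * P (suc i) ⁻¹))            ≈⟨ *-congˡ (*-swap _ _ _) ⟩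
      P i * (f i * (d * P (suc i) ⁻¹))            ∎)
    δ-wrap : δ ℓ * w′ ≈ w * γ (δ 0)
    δ-wrap = begin
      (d * P ℓ ⁻¹) * w′                            ≈⟨ *-congʳ (*-congʳ (proj₂ (proj₂ hilbert))) ⟨
      (((w * P ℓ) * w′ ⁻¹ * γ d) * P ℓ ⁻¹) * w′
        ≈⟨ solve 6 (λ w p w⁻ g p⁻ w′ → (((w :* p) :* w⁻ :* g) :* p⁻) :* w′ := ((w :* g) :* (p :* p⁻)) :* (w′ :* w⁻)) refl
             w (P ℓ) (w′ ⁻¹) (γ d) (P ℓ ⁻¹) w′ ⟩
      ((w * γ d) * (P ℓ * P ℓ ⁻¹)) * (w′ * w′ ⁻¹)  ≈⟨ *-cong (*-congˡ (*-inverseʳ _ (P≉0 ℓ))) (*-inverseʳ w′ w′≉0) ⟩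
      ((w * γ d) * 1#) * 1#                        ≈⟨ trans (*-identityʳ _) (*-identityʳ _) ⟩
      w * γ d                                      ≈⟨ *-congˡ (γ-cong (trans (*-congˡ (trans (sym (*-identityˡ _)) (*-inverseʳ 1# 1≉0))) (*-identityʳ d))) ⟨
      w * γ (d * 1# ⁻¹)                            ∎
      where
      import Algebra.Solver.Ring.NaturalCoefficients.Default as Solver
      open Solver commutativeSemiring

-- Semilinear maps that realise the elements of ℋ

module Backward (S : Setup a₁ b₁ r₁) (B : Endomorphisms.Basis (Setup.𝔼 S) (Setup.V S) (Setup.n S)) where
  open Setup S using (parameters; 𝕃; 𝔽ₚ; 𝕂; 𝔽; Elem; 𝒞; 𝔼; ℋ; σ; γ; w; w≉0; u; V; Carrierᴹ; _≈ᴹ_; _·_; T;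
    shift; module WithBasis)
  open Parameters parameters
  open ParameterTheory parameters
  open Field 𝕃 hiding (zero)
  open FieldTheory 𝕃
  open FrobeniusPowers 𝕃
  open SetupFields S
  open SetupOperators S
  open SetupIndependence S
  open SetupCodes S
  open SetupNorms S
  private
    open Subfield using (_∈)
    module 𝕂′ where
      open Field 𝕂′ public
      open FieldTheory 𝕂′ public
    module 𝔽′ where
      open Field 𝔽₀.field′ public
      open FieldTheory 𝔽₀.field′ public
    module V𝕂 = LeftModule V𝕂
  open CodeAutomorphisms 𝔼 (λ x → _∈ 𝔽ₚ (proj₁ x)) V n B hiding (π; ι; ι-Ker)
  open WithBasis B
  private
    module GL = Group GL

  inverse⇒invertible : (A : End) (g : Carrierᴹ → Carrierᴹ) → (∀ {v v′} → v ≈ᴹ v′ → g v ≈ᴹ g v′) →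
    (∀ v → ⟦ A ⟧ (g v) ≈ᴹ v) → (∀ v → g (⟦ A ⟧ v) ≈ᴹ v) → Invertible
  inverse⇒invertible A g g-cong Ag gA = record
    { to = A
    ; from = linear g g-cong
        (λ v v′ → V.≈ᴹ-trans (g-cong (V.≈ᴹ-sym (V.≈ᴹ-trans (End.+ᴹ-homo A (g v) (g v′)) (V.+ᴹ-cong (Ag v) (Ag v′))))) (gA _))
        (λ z v → V.≈ᴹ-trans (g-cong (V.≈ᴹ-sym (V.≈ᴹ-trans (End.*ₗ-homo A z (g v)) (V.*ₗ-congˡ {z} (Ag v))))) (gA _))
    ; to∘from = Ag
    ; from∘to = gA
    }

  T-power : ℕ → Invertible
  T-power zero    = GL.ε
  T-power (suc j) = T-power j GL.∙ inverse⇒invertible (linear T T-cong T-+ T-𝔽) T⁻¹ T⁻¹-cong TT⁻¹ T⁻¹T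

  T-power-iterate : ∀ j v → ⟦ Invertible.to (T-power j) ⟧ v ≡ iterate T v j
  T-power-iterate zero    v = ≡.refl
  T-power-iterate (suc j) v = T-power-iterate j (T v)

  P-last : ∀ l α v → P (suc l) α v ≈ᴹ P l α v V.+ᴹ α l · iterate T v l
  P-last zero    α v = V.+ᴹ-comm _ _
  P-last (suc l) α v = V.≈ᴹ-trans (V.+ᴹ-congˡ (P-last l (α ∘ suc) (T v))) (V.≈ᴹ-sym (V.+ᴹ-assoc _ _ _))

  snoc : ℕ → (ℕ → Elem 𝕂) → Elem 𝕂 → ℕ → Elem 𝕂
  snoc zero    α x _       = x
  snoc (suc l) α x zero    = α 0
  snoc (suc l) α x (suc i) = snoc l (α ∘ suc) x i

  P-snoc : ∀ l α x v → P (suc l) (snoc l α x) v ≈ᴹ P l α v V.+ᴹ x · iterate T v l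
  P-snoc zero    α x v = V.+ᴹ-comm _ _
  P-snoc (suc l) α x v = V.≈ᴹ-trans (V.+ᴹ-congˡ (P-snoc l (α ∘ suc) x (T v))) (V.≈ᴹ-sym (V.+ᴹ-assoc _ _ _))

  σ^-surjective : ∀ l (x : Elem 𝕂) → ∃ λ (y : Elem 𝕂) → proj₁ (σ^ l y) ≈ proj₁ x
  σ^-surjective l x = σ^ (l ℕ.* (n ∸ 1)) x , trans (σ^-+ l (l ℕ.* (n ∸ 1)) x)
    (trans (𝕂′.^-congʳ x (≡.cong ((q ℕ.^ h) ℕ.^_) (ℕ.+-comm (l ℕ.* (n ∸ 1)) l)))
      (FrobeniusPowers.frobenius-inverse 𝕂′ (q ℕ.^ h) 0<n l {x} (σ^-n x)))

  ·-cong : ∀ x y {v v′} → proj₁ x ≈ proj₁ y → v ≈ᴹ v′ → x · v ≈ᴹ y · v′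
  ·-cong x y x≈y v≈v′ = V𝕂.*ₗ-cong {x} {y} x≈y v≈v′

  ^-^-comm : ∀ x i j → (x ^ i) ^ j ≈ (x ^ j) ^ i
  ^-^-comm x i j = trans (^-assocʳ x i j) (trans (^-congʳ x (ℕ.*-comm i j)) (sym (^-assocʳ x j i)))

  frobenius-exponent : ∀ ρ → ∃ λ f → ∀ z → proj₁ (Automorphism.to ρ z) ≈ proj₁ z ^ (p ℕ.^ f)
  frobenius-exponent ρ = let f , eq = endomorphism in f , λ z → trans (eq z) (𝔽₀.^-proj₁ z (p ℕ.^ f))
    where
    module ρ = Automorphism ρ
    p×1≈0′ : p 𝔽′.×′ 𝔽′.1# 𝔽′.≈ 𝔽′.0#
    p×1≈0′ = trans (𝔽₀.×-proj₁ p 𝔽′.1#) p×1≈0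
    endomorphism : ∃ λ f → ∀ z → ρ.to z 𝔽′.≈ z 𝔽′.^ (p ℕ.^ f)
    endomorphism = FrobeniusAutomorphisms.endomorphism-frobenius 𝔽₀.field′ 𝔽₀.order′ p-prime p×1≈0′
      ρ.to (λ {x} {y} → ρ.to-cong {x} {y}) ρ.+-homo ρ.*-homo ρ.0#-homo ρ.1#-homo

  module _ (ρ : Automorphism) (f : ℕ) (ρ≈F⁺ : ∀ z → proj₁ (Automorphism.to ρ z) ≈ proj₁ z ^ (p ℕ.^ f)) where
    private
      module ρ = Automorphism ρ

      E f⁻¹ : ℕ
      -- p^E is the order of 𝕃, so the power with exponent p^`f⁻¹` inverts the power with exponent
      -- p^f on all of 𝕃.
      E = e ℕ.* (n′ ℕ.* s)
      f⁻¹ = f ℕ.* (E ∸ 1)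

      0<E : 0 < E
      0<E = ℕ.<-≤-trans 1≤e (ℕ.m≤m*n e (n′ ℕ.* s))
        where instance _ = >-nonZero 0<n′s

      fixed-p^E : ∀ x → x ^ (p ℕ.^ E) ≈ x
      fixed-p^E x = trans (^-congʳ x (≡.sym (ℕ.^-*-assoc p e (n′ ℕ.* s)))) (fixed-𝕃 x)

      F⁺ F⁻ : Carrier → Carrier
      F⁺ x = x ^ (p ℕ.^ f)
      F⁻ x = x ^ (p ℕ.^ f⁻¹)

      F⁻F⁺ : ∀ x → F⁻ (F⁺ x) ≈ x
      F⁻F⁺ x = trans (^-^-+ p f f⁻¹ x) (frobenius-inverse p 0<E f (fixed-p^E x))

      F⁺F⁻ : ∀ x → F⁺ (F⁻ x) ≈ x
      F⁺F⁻ x = trans (^-^-comm x (p ℕ.^ f⁻¹) (p ℕ.^ f)) (F⁻F⁺ x)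

      F⁺-cong : ∀ {x y} → x ≈ y → F⁺ x ≈ F⁺ y
      F⁺-cong = ^-congˡ (p ℕ.^ f)

      F⁺-* : ∀ x y → F⁺ (x * y) ≈ F⁺ x * F⁺ y
      F⁺-* x y = ^-distrib-* x y (p ℕ.^ f)

      F⁻-cong : ∀ {x y} → x ≈ y → F⁻ x ≈ F⁻ y
      F⁻-cong = ^-congˡ (p ℕ.^ f⁻¹)

      τ τ⁻¹ : Elem 𝕂 → Elem 𝕂
      τ x = x 𝕂′.^ (p ℕ.^ f)
      τ⁻¹ x = x 𝕂′.^ (p ℕ.^ f⁻¹)

      ττ⁻¹ : ∀ x → proj₁ (τ (τ⁻¹ x)) ≈ proj₁ x
      ττ⁻¹ x = trans (𝕂₀.^-proj₁ (τ⁻¹ x) (p ℕ.^ f)) (trans (F⁺-cong (𝕂₀.^-proj₁ x (p ℕ.^ f⁻¹))) (F⁺F⁻ (proj₁ x)))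

      w′ : Carrier
      w′ = F⁺ w

      norm-w′ : norm w′ ≈ proj₁ (ρ.to u)
      norm-w′ = trans (norm-^ w (p ℕ.^ f)) (trans (F⁺-cong norm-w) (sym (ρ≈F⁺ u)))

      -- The step condition serves the shifted coordinates. The condition on `δ l` serves the last
      -- one, where γ and `F⁺` commute because both are power maps.
      shift-intertwines : ∀ {l} (δ g : ℕ → Carrier) → (∀ i → δ i ≈ g i * δ (suc i)) → (v : Vector Carrier l) → δ l * w′ ≈ w * γ (δ 0) →
        ∀ i → δ (toℕ i) * F⁺ (shift v i) ≈ g (toℕ i) * shift (λ j → δ (toℕ j) * F⁺ (v j)) i
      shift-intertwines {suc l} δ g δ-step v δ-wrap i with view i
      ... | ‵inject₁ j = begin
        δ (toℕ (inject₁ j)) * F⁺ (shift v (inject₁ j))         ≈⟨ *-cong (δ-step _) (F⁺-cong (reflexive (shift-inject₁ v j))) ⟩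
        g (toℕ (inject₁ j)) * δ (suc (toℕ (inject₁ j))) * F⁺ (v (suc j))  ≈⟨ *-assoc _ _ _ ⟩
        g (toℕ (inject₁ j)) * (δ (suc (toℕ (inject₁ j))) * F⁺ (v (suc j)))
          ≈⟨ *-congˡ (trans (*-congʳ (reflexive (≡.cong (δ ∘ suc) (Fin.toℕ-inject₁ j)))) (reflexive (≡.sym (shift-inject₁ (λ j → δ (toℕ j) * F⁺ (v j)) j)))) ⟩
        g (toℕ (inject₁ j)) * shift (λ j → δ (toℕ j) * F⁺ (v j)) (inject₁ j) ∎
        where open SetoidReasoning setoid
      ... | ‵fromℕ = begin
        δ (toℕ (fromℕ l)) * F⁺ (shift v (fromℕ l))             ≈⟨ *-cong (δ-step _) (F⁺-cong (reflexive (shift-fromℕ v))) ⟩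
        g (toℕ (fromℕ l)) * δ (suc (toℕ (fromℕ l))) * F⁺ (w * γ (v zero))
          ≈⟨ trans (*-congˡ (F⁺-* w (γ (v zero)))) (*-assoc _ _ _) ⟩
        g (toℕ (fromℕ l)) * (δ (suc (toℕ (fromℕ l))) * (w′ * F⁺ (γ (v zero))))
          ≈⟨ *-congˡ (trans (sym (*-assoc _ _ _)) (*-cong (trans (*-congʳ (reflexive (≡.cong (δ ∘ suc) (Fin.toℕ-fromℕ l)))) δ-wrap)
               (^-^-comm (v zero) (q ℕ.^ (h ℕ.* c ℕ.* s)) (p ℕ.^ f)))) ⟩
        g (toℕ (fromℕ l)) * ((w * γ (δ 0)) * γ (F⁺ (v zero)))
          ≈⟨ *-congˡ (trans (*-assoc _ _ _) (trans (*-congˡ (sym (γ-* _ _))) (reflexive (≡.sym (shift-fromℕ (λ j → δ (toℕ j) * F⁺ (v j))))))) ⟩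
        g (toℕ (fromℕ l)) * shift (λ j → δ (toℕ j) * F⁺ (v j)) (fromℕ l) ∎
        where open SetoidReasoning setoid

    module Intertwiner (μ : Elem 𝔽) (κ : Elem 𝕂) (κ≉0 : ¬ (proj₁ κ ≈ 0#)) (δ : ℕ → Carrier) (δ≉0 : ∀ i → ¬ (δ i ≈ 0#))
      (δ-step : ∀ i → δ i ≈ (iterate σ (proj₁ κ) i * proj₁ μ) * δ (suc i)) (δ-wrap : δ ℓ * w′ ≈ w * γ (δ 0)) where

      m m⁻¹ : Carrierᴹ → Carrierᴹ
      m v i = δ (toℕ i) * F⁺ (v i)
      m⁻¹ v i = F⁻ (δ (toℕ i) ⁻¹ * v i)

      m-cong : ∀ {v v′} → v ≈ᴹ v′ → m v ≈ᴹ m v′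
      m-cong eq i = *-congˡ (F⁺-cong (eq i))

      m⁻¹-cong : ∀ {v v′} → v ≈ᴹ v′ → m⁻¹ v ≈ᴹ m⁻¹ v′
      m⁻¹-cong eq i = F⁻-cong (*-congˡ (eq i))

      mm⁻¹ : ∀ v → m (m⁻¹ v) ≈ᴹ v
      mm⁻¹ v i = trans (*-congˡ (F⁺F⁻ _)) (trans (sym (*-assoc _ _ _)) (trans (*-congʳ (*-inverseʳ _ (δ≉0 (toℕ i)))) (*-identityˡ _)))

      m⁻¹m : ∀ v → m⁻¹ (m v) ≈ᴹ v
      m⁻¹m v i = trans (F⁻-cong (trans (sym (*-assoc _ _ _)) (trans (*-congʳ (trans (*-comm _ _) (*-inverseʳ _ (δ≉0 (toℕ i))))) (*-identityˡ _)))) (F⁻F⁺ (v i))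

      m-+ : ∀ v v′ → m (v V.+ᴹ v′) ≈ᴹ m v V.+ᴹ m v′
      m-+ v v′ i = trans (*-congˡ (^p^-+ f (v i) (v′ i))) (distribˡ _ _ _)

      m-𝔽 : ∀ z v → m (z V.*ₗ v) ≈ᴹ ρ.to z V.*ₗ m v
      m-𝔽 z v i = trans (*-congˡ (trans (F⁺-* (proj₁ z) (v i)) (*-congʳ (sym (ρ≈F⁺ z))))) (*-swap _ _ _)

      m-𝕂 : ∀ x v → m (x · v) ≈ᴹ τ x · m v
      m-𝕂 x v i = trans (*-congˡ (trans (F⁺-* _ (v i)) (*-congʳ F⁺-iterate))) (*-swap _ _ _)
        where
        F⁺-iterate : F⁺ (iterate σ (proj₁ x) (toℕ i)) ≈ iterate σ (proj₁ (τ x)) (toℕ i)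
        F⁺-iterate = trans (F⁺-cong (iterate-σ (proj₁ x) (toℕ i))) (trans (^-^-comm (proj₁ x) (q ℕ.^ (h ℕ.* toℕ i)) (p ℕ.^ f))
          (trans (sym (iterate-σ (F⁺ (proj₁ x)) (toℕ i))) (iterate-σ-cong (toℕ i) (sym (𝕂₀.^-proj₁ x (p ℕ.^ f))))))

      m-T : ∀ v → m (T v) ≈ᴹ κ · (μ V.*ₗ T (m v))
      m-T v i = trans (shift-intertwines δ (λ i → iterate σ (proj₁ κ) i * proj₁ μ) δ-step v δ-wrap i) (*-assoc _ _ _)

      m-0 : m V.0ᴹ ≈ᴹ V.0ᴹ
      m-0 i = trans (*-congˡ (0^ _ (ℕ.m^n>0 p f))) (zeroʳ _)
        where instance _ = >-nonZero (ℕ.<-trans (s≤s z≤n) 1<p)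

      -- Chosen so that `M` composed with L_ρ is `m`; it is linear because `m` is semilinear with
      -- respect to ρ.
      M : Invertible
      M = inverse⇒invertible
        (linear (λ v → m (L (ρ ⁻¹ₐ) v)) (λ eq → m-cong (L-cong (ρ ⁻¹ₐ) (ρ ⁻¹ₐ) (λ _ → refl) eq))
          (λ v v′ → V.≈ᴹ-trans (m-cong (L-+ (ρ ⁻¹ₐ) v v′)) (m-+ _ _))
          (λ z v → V.≈ᴹ-trans (m-cong (L-semilinear (ρ ⁻¹ₐ) z v)) (V.≈ᴹ-trans (m-𝔽 _ _) (λ i → *-congʳ (ρ.to∘from z)))))
        (λ v → L ρ (m⁻¹ v)) (λ eq → L-cong ρ ρ (λ _ → refl) (m⁻¹-cong eq))
        (λ v → V.≈ᴹ-trans (m-cong (L-inverseˡ ρ _)) (mm⁻¹ v))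
        (λ v → V.≈ᴹ-trans (L-cong ρ ρ (λ _ → refl) (m⁻¹m _)) (L-inverseˡ (ρ ⁻¹ₐ) v))

      -- The identity m P(α) m⁻¹ Tʲ = P(β), stated without inverses: `v` stands for m⁻¹ Tʲ v′. In
      -- this form it can be proved by recursion on the length of P.
      Transfer : ℕ → (ℕ → Elem 𝕂) → (ℕ → Elem 𝕂) → Set _
      Transfer j α β = ∀ v v′ → m v ≈ᴹ iterate T v′ j → m (P (s ℕ.* k) α v) ≈ᴹ P (s ℕ.* k) β v′

      stabilises : ∀ j → (∀ α → ∃ λ β → Transfer j α β) → (∀ β → ∃ λ α → Transfer j α β) → ∃ λ x → π x ≈ₐ ρ
      stabilises j forward backward = ((M , N , ρ) , (λ {A} → to-𝒞 {A}) , (λ {A} → from-𝒞 {A})) , λ _ → refl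
        where
        N : Invertible
        -- As M L_ρ = m, the product M A^ρ N becomes m A m⁻¹ Tʲ.
        N = (M GL.⁻¹) GL.∙ T-power j
        act : ∀ A v → ⟦ (M , N , ρ) ⋆ A ⟧ v ≈ᴹ m (⟦ A ⟧ (m⁻¹ (iterate T v j)))
        act A v = m-cong (V.≈ᴹ-trans (L-inverseˡ ρ _) (End.⟦⟧-cong A (V.≈ᴹ-trans (L-inverseˡ ρ _)
          (m⁻¹-cong (V.≈ᴹ-reflexive (T-power-iterate j v))))))
        to-𝒞 : ∀ {A} → image endSetoid ((M , N , ρ) ⋆_) 𝒞 A → 𝒞 A
        to-𝒞 {A} (A′ , A′∈ , A≈) = code⇒∈ A (β , λ v → V.≈ᴹ-trans (A≈ v) (V.≈ᴹ-trans (act A′ v)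
          (V.≈ᴹ-trans (m-cong (proj₂ A′-code _)) (transfer _ v (mm⁻¹ _)))))
          where
          A′-code = ∈⇒code A′ A′∈
          β = proj₁ (forward (proj₁ A′-code))
          transfer = proj₂ (forward (proj₁ A′-code))
        from-𝒞 : ∀ {A} → 𝒞 A → image endSetoid ((M , N , ρ) ⋆_) 𝒞 A
        from-𝒞 {A} A∈ = A′ , code⇒∈ A′ (α , λ _ → V.≈ᴹ-refl) , λ v → V.≈ᴹ-trans (proj₂ A-code v)
          (V.≈ᴹ-sym (V.≈ᴹ-trans (act A′ v) (transfer _ v (mm⁻¹ _))))
          where
          A-code = ∈⇒code A A∈
          α = proj₁ (backward (proj₁ A-code))
          transfer = proj₂ (backward (proj₁ A-code))
          A′ = polynomial (s ℕ.* k) α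

      private
        P-untwist : ∀ l β (x : Elem 𝕂) → ¬ (proj₁ x ≈ 0#) → ∀ v → P l (λ i → β i 𝕂′.* (σ^ i x) 𝕂′.⁻¹) (x · v) ≈ᴹ P l β v
        P-untwist l β x x≉0 v = V.≈ᴹ-trans (P-* l (λ i → β i 𝕂′.* (σ^ i x) 𝕂′.⁻¹) x v) (P-cong l (λ i _ →
          trans (*-assoc _ _ _) (trans (*-congˡ (trans (*-comm _ _) (𝕂′.*-inverseʳ (σ^ i x) (𝕂′.^-≉0 {x} x≉0 ((q ℕ.^ h) ℕ.^ i))))) (*-identityʳ _))) v)

        forward⁺ : (∀ v → m (T v) ≈ᴹ κ · T (m v)) → ∀ l α → ∃ λ β → ∀ v → m (P l α v) ≈ᴹ P l β (m v)
        forward⁺ mT zero    α = α , λ v → m-0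
        forward⁺ mT (suc l) α = let β , eq = forward⁺ mT l (α ∘ suc) in
          cons (τ (α 0)) (λ i → β i 𝕂′.* σ^ i κ) , λ v → V.≈ᴹ-trans (m-+ _ _) (V.+ᴹ-cong (m-𝕂 (α 0) v)
            (V.≈ᴹ-trans (eq (T v)) (V.≈ᴹ-trans (P-congᵛ l β (mT v)) (P-* l β κ (T (m v))))))

        backward⁺ : (∀ v → m (T v) ≈ᴹ κ · T (m v)) → ∀ l β → ∃ λ α → ∀ v → m (P l α v) ≈ᴹ P l β (m v)
        backward⁺ mT zero    β = β , λ v → m-0
        backward⁺ mT (suc l) β =
          let β′ = λ i → β (suc i) 𝕂′.* (σ^ i κ) 𝕂′.⁻¹
              α , eq = backward⁺ mT l β′ in
          cons (τ⁻¹ (β 0)) α , λ v → V.≈ᴹ-trans (m-+ _ _) (V.+ᴹ-cong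
            (V.≈ᴹ-trans (m-𝕂 (τ⁻¹ (β 0)) v) (·-cong (τ (τ⁻¹ (β 0))) (β 0) (ττ⁻¹ (β 0)) V.≈ᴹ-refl))
            (V.≈ᴹ-trans (eq (T v)) (V.≈ᴹ-trans (P-congᵛ l β′ (mT v)) (P-untwist l (β ∘ suc) κ κ≉0 (T (m v))))))

        -- The image of κ under the inverse of `σ^ l`, by which the scalar κ moves to the right past
        -- Tˡ.
        root : ∀ l → Elem 𝕂
        root l = proj₁ (σ^-surjective l κ)

        root≉0 : ∀ l → ¬ (proj₁ (root l) ≈ 0#)
        root≉0 l eq = κ≉0 (trans (sym (proj₂ (σ^-surjective l κ))) (trans (𝕂′.^-congˡ ((q ℕ.^ h) ℕ.^ l) {root l} {𝕂′.0#} eq) (𝕂′.0^ ((q ℕ.^ h) ℕ.^ l) (ℕ.m^n>0 (q ℕ.^ h) l))))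
          where instance _ = >-nonZero (0<q^ h)

        m-T⁻ : (∀ v → m (T v) ≈ᴹ κ · T⁻¹ (m v)) → ∀ l v v′ → m v ≈ᴹ iterate T v′ (suc l) → m (T v) ≈ᴹ iterate T (root l · v′) l
        m-T⁻ mT l v v′ eq = V.≈ᴹ-trans (mT v) (V.≈ᴹ-trans (V𝕂.*ₗ-congˡ {κ} (V.≈ᴹ-trans (T⁻¹-cong (V.≈ᴹ-trans eq (V.≈ᴹ-reflexive (iterate-suc T v′ l)))) (T⁻¹T _)))
          (V.≈ᴹ-sym (V.≈ᴹ-trans (T^-* l (root l) v′) (·-cong (σ^ l (root l)) κ (proj₂ (σ^-surjective l κ)) V.≈ᴹ-refl))))

        -- Every T in front of m⁻¹ consumes one factor of Tˡ, so αᵢ ends up in degree l - i. The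
        -- coefficients therefore come out in reverse order and are collected by `snoc`.
        forward⁻ : (∀ v → m (T v) ≈ᴹ κ · T⁻¹ (m v)) → ∀ l α → ∃ λ β → ∀ v v′ → m v ≈ᴹ iterate T v′ l → m (P (suc l) α v) ≈ᴹ P (suc l) β v′
        forward⁻ mT zero    α = (λ _ → τ (α 0)) , λ v v′ eq → V.≈ᴹ-trans (m-+ _ _)
          (V.+ᴹ-cong (V.≈ᴹ-trans (m-𝕂 (α 0) v) (V𝕂.*ₗ-congˡ {τ (α 0)} eq)) m-0)
        forward⁻ mT (suc l) α = let β , h = forward⁻ mT l (α ∘ suc) in
          snoc (suc l) (λ i → β i 𝕂′.* σ^ i (root l)) (τ (α 0)) , λ v v′ eq → V.≈ᴹ-trans (m-+ _ _)
            (V.≈ᴹ-trans (V.+ᴹ-cong (V.≈ᴹ-trans (m-𝕂 (α 0) v) (V𝕂.*ₗ-congˡ {τ (α 0)} eq))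
                (V.≈ᴹ-trans (h (T v) (root l · v′) (m-T⁻ mT l v v′ eq)) (P-* (suc l) β (root l) v′)))
              (V.≈ᴹ-trans (V.+ᴹ-comm _ _) (V.≈ᴹ-sym (P-snoc (suc l) (λ i → β i 𝕂′.* σ^ i (root l)) (τ (α 0)) v′))))

        -- Because of the reversal, the lowest coefficient of α is read off from the highest one of
        -- β.
        backward⁻ : (∀ v → m (T v) ≈ᴹ κ · T⁻¹ (m v)) → ∀ l β → ∃ λ α → ∀ v v′ → m v ≈ᴹ iterate T v′ l → m (P (suc l) α v) ≈ᴹ P (suc l) β v′
        backward⁻ mT zero    β = (λ _ → τ⁻¹ (β 0)) , λ v v′ eq → V.≈ᴹ-trans (m-+ _ _)
          (V.+ᴹ-cong (V.≈ᴹ-trans (m-𝕂 (τ⁻¹ (β 0)) v) (·-cong (τ (τ⁻¹ (β 0))) (β 0) (ττ⁻¹ (β 0)) eq)) m-0)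
        backward⁻ mT (suc l) β = let α , h = backward⁻ mT l (λ i → β i 𝕂′.* (σ^ i (root l)) 𝕂′.⁻¹) in
          cons (τ⁻¹ (β (suc l))) α , λ v v′ eq → V.≈ᴹ-trans (m-+ _ _)
            (V.≈ᴹ-trans (V.+ᴹ-cong (V.≈ᴹ-trans (m-𝕂 (τ⁻¹ (β (suc l))) v) (·-cong (τ (τ⁻¹ (β (suc l)))) (β (suc l)) (ττ⁻¹ (β (suc l))) eq))
                (V.≈ᴹ-trans (h (T v) (root l · v′) (m-T⁻ mT l v v′ eq)) (P-untwist (suc l) β (root l) (root≉0 l) v′)))
              (V.≈ᴹ-trans (V.+ᴹ-comm _ _) (V.≈ᴹ-sym (P-last (suc l) β v′))))

      stabilises⁺ : proj₁ μ ≈ 1# → ∃ λ x → π x ≈ₐ ρ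
      stabilises⁺ μ≈1 = stabilises 0
        (λ α → let β , eq = forward⁺ mT (s ℕ.* k) α in β , λ v v′ mv≈v′ → V.≈ᴹ-trans (eq v) (P-congᵛ (s ℕ.* k) β mv≈v′))
        (λ β → let α , eq = backward⁺ mT (s ℕ.* k) β in α , λ v v′ mv≈v′ → V.≈ᴹ-trans (eq v) (P-congᵛ (s ℕ.* k) β mv≈v′))
        where
        mT : ∀ v → m (T v) ≈ᴹ κ · T (m v)
        mT v = V.≈ᴹ-trans (m-T v) (V𝕂.*ₗ-congˡ {κ} (λ i → trans (*-congʳ μ≈1) (*-identityˡ _)))

      stabilises⁻ : n ≡ 2 → proj₁ μ ≈ proj₁ u ⁻¹ → ∃ λ x → π x ≈ₐ ρ
      stabilises⁻ n≡2 μ≈u⁻¹ = stabilises (s ℕ.* k ∸ 1)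
        (λ α → ≡.subst (λ N → ∃ λ β → ∀ v v′ → m v ≈ᴹ iterate T v′ (s ℕ.* k ∸ 1) → m (P N α v) ≈ᴹ P N β v′) N≡ (forward⁻ mT (s ℕ.* k ∸ 1) α))
        (λ β → ≡.subst (λ N → ∃ λ α → ∀ v v′ → m v ≈ᴹ iterate T v′ (s ℕ.* k ∸ 1) → m (P N α v) ≈ᴹ P N β v′) N≡ (backward⁻ mT (s ℕ.* k ∸ 1) β))
        where
        N≡ : suc (s ℕ.* k ∸ 1) ≡ s ℕ.* k
        N≡ = ℕ.suc-pred (s ℕ.* k)
          where instance _ = >-nonZero 0<sk
        mT : ∀ v → m (T v) ≈ᴹ κ · T⁻¹ (m v)
        mT v = V.≈ᴹ-trans (m-T v) (V𝕂.*ₗ-congˡ {κ} (λ i → *-cong μ≈u⁻¹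
          (reflexive (≡.cong (λ j → iterate T (m v) j i) (≡.cong (_∸ 1) (≡.sym n≡2))))))

    private
      Coefficients : Elem 𝔽 → Set _
      Coefficients μ = ∃ λ (κ : Elem 𝕂) → ¬ (proj₁ κ ≈ 0#) × ∃ λ (δ : ℕ → Carrier) → (∀ i → ¬ (δ i ≈ 0#)) ×
        (∀ i → δ i ≈ (iterate σ (proj₁ κ) i * proj₁ μ) * δ (suc i)) × δ ℓ * w′ ≈ w * γ (δ 0)

      image⁺ : ∀ μ → proj₁ μ ≈ 1# → Coefficients μ → ∃ λ x → π x ≈ₐ ρ
      image⁺ μ μ≈1 (κ , κ≉0 , δ , δ≉0 , δ-step , δ-wrap) = Intertwiner.stabilises⁺ μ κ κ≉0 δ δ≉0 δ-step δ-wrap μ≈1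

      image⁻ : ∀ μ → n ≡ 2 → proj₁ μ ≈ proj₁ u ⁻¹ → Coefficients μ → ∃ λ x → π x ≈ₐ ρ
      image⁻ μ n≡2 μ≈u⁻¹ (κ , κ≉0 , δ , δ≉0 , δ-step , δ-wrap) = Intertwiner.stabilises⁻ μ κ κ≉0 δ δ≉0 δ-step δ-wrap n≡2 μ≈u⁻¹

    -- The norm of w′ is ρ(u), and `intertwiner` needs it in the form l μⁿ u: this is l u for μ = 1,
    -- and l u⁻¹ for n = 2 and μ = u⁻¹.
    ℋ⇒image′ : ℋ ρ → ∃ λ x → π x ≈ₐ ρ
    ℋ⇒image′ (inj₁ (l , l∈ , l≉0 , ρu≈lu)) = image⁺ 𝔽′.1# refl (intertwiner (^-≉0 w≉0 (p ℕ.^ f)) 𝔽′.1# 1≉0 l∈ l≉0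
      (trans norm-w′ (trans ρu≈lu (*-congˡ (sym (trans (*-congʳ (1^ n)) (*-identityˡ _)))))))
    ℋ⇒image′ (inj₂ (n≡2 , l , l∈ , l≉0 , ρu≈lu⁻¹)) = image⁻ u⁻¹ n≡2 refl (intertwiner (^-≉0 w≉0 (p ℕ.^ f)) u⁻¹ (⁻¹-≉0 u≉0) l∈ l≉0
      (trans norm-w′ (trans ρu≈lu⁻¹ (*-congˡ (sym u⁻ⁿu≈u⁻¹)))))
      where
      u⁻ⁿu≈u⁻¹ : (proj₁ u ⁻¹) ^ n * proj₁ u ≈ proj₁ u ⁻¹
      u⁻ⁿu≈u⁻¹ = trans (*-congʳ (trans (^-congʳ (proj₁ u ⁻¹) n≡2) (*-congˡ (*-identityʳ _)))) (trans (*-assoc _ _ _)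
        (trans (*-congˡ (trans (*-comm _ _) (*-inverseʳ _ u≉0))) (*-identityʳ _)))

  ℋ⇒image : ∀ ρ → ℋ ρ → ∃ λ x → π x ≈ₐ ρ
  ℋ⇒image ρ = ℋ⇒image′ ρ (proj₁ (frobenius-exponent ρ)) (proj₂ (frobenius-exponent ρ))

-- The kernel of π and the exact sequence

module KernelTheory (E : CommutativeRing a₁ b₁) (P : Pred (CommutativeRing.Carrier E) r₁)
  (V : LeftModule (CommutativeRing.ring E) a₂ b₂) (m : ℕ) (B : Endomorphisms.Basis E V m)
  (𝒟 : Pred (Endomorphisms.End E V) a₃) (𝒟-resp : ∀ A A′ → Endomorphisms._≈ₑ_ E V A A′ → 𝒟 A → 𝒟 A′)
  where

  open CodeAutomorphisms E P V m B hiding (Aut; Aut-E; π; ι; ι-Ker; Ker-π)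
  open LeftModule V using (≈ᴹ-refl; ≈ᴹ-sym; ≈ᴹ-trans)
  private
    module Code = CodeAutomorphisms E P V m B
    module E = CommutativeRing E
    module I = Invertible
    Aut = Code.Aut 𝒟 𝒟-resp
    Aut-E = Code.Aut-E 𝒟 𝒟-resp
    π = Code.π 𝒟 𝒟-resp
    ι = Code.ι 𝒟 𝒟-resp
    ι-Ker = Code.ι-Ker 𝒟 𝒟-resp
    Ker-π = Code.Ker-π 𝒟 𝒟-resp
    module Aut = Group Aut
    module Aut-E = Group Aut-E

  ι-monomorphism : GroupMorphisms.IsGroupMonomorphism Aut-E.rawGroup Aut.rawGroup ι
  ι-monomorphism = record
    { isGroupHomomorphism = record
      { isMonoidHomomorphism = record
        { isMagmaHomomorphism = record
          { isRelHomomorphism = record { cong = λ (eq , eq′) → eq , eq′ , λ _ → E.refl }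
          ; homo = λ ((M , N) , _) ((M′ , N′) , _) →
              (λ v → End.⟦⟧-cong (I.to M) (≈ᴹ-sym (conj-id (I.to M′) v))) ,
              (λ v → ≈ᴹ-sym (conj-id (I.to N′) _)) ,
              (λ _ → E.refl)
          }
        ; ε-homo = (λ _ → ≈ᴹ-refl) , (λ _ → ≈ᴹ-refl) , (λ _ → E.refl)
        }
      ; ⁻¹-homo = λ ((M , N) , _) →
          (λ v → ≈ᴹ-sym (conj-id (I.from M) v)) , (λ v → ≈ᴹ-sym (conj-id (I.from N) v)) , (λ _ → E.refl)
      }
    ; injective = λ (eq , eq′ , _) → eq , eq′
    }

  -- `ρ` is only pointwise equal to the identity, so the stabiliser condition is transported along
  -- A^ρ = A.
  kernel⇒ι : ∀ y → π y ≈ₐ idₐ → ∃ λ x → ι x Aut.≈ y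
  kernel⇒ι ((M , N , ρ) , to-𝒟 , from-𝒟) ρ≈id =
    ((M , N) ,
      (λ (A , A∈ , eq) → to-𝒟 (A , A∈ , λ v → ≈ᴹ-trans (eq v) (≈ᴹ-sym (drop A v)))) ,
      (λ A∈ → let A , A∈′ , eq = from-𝒟 A∈ in A , A∈′ , λ v → ≈ᴹ-trans (eq v) (drop A v))) ,
    (λ _ → ≈ᴹ-refl) , (λ _ → ≈ᴹ-refl) , λ x → E.sym (ρ≈id x)
    where
    drop : ∀ A → M ⟨ conj ρ A ⟩ N ≈ₑ M ⟨ A ⟩ N
    drop A v = End.⟦⟧-cong (I.to M) (≈ᴹ-trans (conj-cong ρ idₐ A A ρ≈id (λ _ → ≈ᴹ-refl) _) (conj-id A _))

  ι-Ker-isomorphism : IsIso Aut-E Ker-π ι-Ker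
  ι-Ker-isomorphism = record
    { isGroupMonomorphism = record
      { isGroupHomomorphism = record
        { isMonoidHomomorphism = record
          { isMagmaHomomorphism = record
            { isRelHomomorphism = record { cong = λ {x} {y} → ι.⟦⟧-cong {x} {y} } ; homo = ι.homo }
          ; ε-homo = ι.ε-homo
          }
        ; ⁻¹-homo = ι.⁻¹-homo
        }
      ; injective = λ (eq , eq′ , _) → eq , eq′
      }
    ; surjective = λ (y , πy≈id) → let x , ιx≈y = kernel⇒ι y πy≈id in
        x , λ {z} z≈x → Aut.trans {ι z} {ι x} {y} (ι.⟦⟧-cong {z} {x} z≈x) ιx≈y
    }
    where module ι = GroupMorphisms.IsGroupHomomorphism (GroupMorphisms.IsGroupMonomorphism.isGroupHomomorphism ι-monomorphism)

  module _ (ℋ : Pred Automorphism a₄) (image⇔ : ∀ ρ → (∃ λ x → π x ≈ₐ ρ) ⇔ ℋ ρ) where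
    private
      module Γ = Group automorphismGroup

      image⇒ : ∀ {ρ} x → π x ≈ₐ ρ → ℋ ρ
      image⇒ {ρ} x eq = Equivalence.to (image⇔ ρ) (x , eq)

      preimage : ∀ {ρ} → ℋ ρ → ∃ λ x → π x ≈ₐ ρ
      preimage {ρ} = Equivalence.from (image⇔ ρ)

    -- Closure is inherited from the homomorphism π, without any computation inside ℋ.
    image-isSubgroup : IsSubgroup automorphismGroup ℋ
    image-isSubgroup = record
      { resp = λ {ρ} {τ} ρ≈τ ρ∈ → let x , eq = preimage ρ∈ in image⇒ x (Γ.trans {π x} {ρ} {τ} eq ρ≈τ)
      ; ε-closed = image⇒ Aut.ε (λ _ → E.refl)
      ; ∙-closed = λ {ρ} {τ} ρ∈ τ∈ → let x , eq = preimage ρ∈ ; y , eq′ = preimage τ∈ in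
          image⇒ (x Aut.∙ y) (Γ.∙-cong {π x} {ρ} {π y} {τ} eq eq′)
      ; ⁻¹-closed = λ {ρ} ρ∈ → let x , eq = preimage ρ∈ in image⇒ (x Aut.⁻¹) (Γ.⁻¹-cong {π x} {ρ} eq)
      }

    π∈image : ∀ x → ℋ (π x)
    π∈image x = image⇒ x (λ _ → E.refl)

    short-exact : IsShortExact Aut-E Aut (subgroup automorphismGroup image-isSubgroup) ι (λ x → π x , π∈image x)
    short-exact = record
      { f-mono = ι-monomorphism
      ; g-hom = record
        { isMonoidHomomorphism = record
          { isMagmaHomomorphism = record
            { isRelHomomorphism = record { cong = λ (_ , _ , eq) → eq }
            ; homo = λ _ _ _ → E.refl
            }
          ; ε-homo = λ _ → E.refl
          }
        ; ⁻¹-homo = λ _ _ → E.refl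
        }
      ; g-surjective = λ (ρ , ρ∈) → let x , eq = preimage ρ∈ in
          x , λ {z} (_ , _ , z≈x) → Γ.trans {π z} {π x} {ρ} z≈x eq
      ; exact = λ y → mk⇔ (kernel⇒ι y) (λ (x , _ , _ , eq) → Γ.sym {idₐ} {π y} eq)
      }

ℋ-resp : (S : Setup a₁ b₁ r₁) → let open Setup S in ∀ {ρ τ} → ρ ≈ₐ τ → ℋ ρ → ℋ τ
ℋ-resp S ρ≈τ (inj₁ (l , l∈ , l≉0 , eq))        = inj₁ (l , l∈ , l≉0 , Field.trans (Setup.𝕃 S) (Field.sym (Setup.𝕃 S) (ρ≈τ (Setup.u S))) eq)
ℋ-resp S ρ≈τ (inj₂ (n≡2 , l , l∈ , l≉0 , eq)) = inj₂ (n≡2 , l , l∈ , l≉0 , Field.trans (Setup.𝕃 S) (Field.sym (Setup.𝕃 S) (ρ≈τ (Setup.u S))) eq)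

theorem6p11 : ∀ {a b r : Level} (S : Setup a b r) →
    let open Setup S in
    (B : Endomorphisms.Basis 𝔼 V n) →
    let open WithBasis B in
    (∀ ρ → (∃ λ x → π x ≈ₐ ρ) ⇔ ℋ ρ) ×
    IsIso Aut-𝔼[𝒞] Ker-π ι-Ker ×
    Σ (IsSubgroup Aut𝔽ₚ[𝔽] ℋ) λ ℋ-subgroup →
    Σ (∀ x → ℋ (π x)) λ π∈ℋ →
    IsShortExact Aut-𝔼[𝒞] Aut[𝒞] (subgroup Aut𝔽ₚ[𝔽] ℋ-subgroup) ι (λ x → π x , π∈ℋ x)
theorem6p11 S B = image⇔ , ι-Ker-isomorphism , image-isSubgroup ℋ image⇔ , π∈image ℋ image⇔ , short-exact ℋ image⇔
  where
  open Setup S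
  open WithBasis B using (π)
  open KernelTheory 𝔼 (λ x → Subfield._∈ 𝔽ₚ (proj₁ x)) V n B 𝒞 𝒞-resp
  image⇔ : ∀ ρ → (∃ λ x → π x ≈ₐ ρ) ⇔ ℋ ρ
  image⇔ ρ = mk⇔ (λ (x , eq) → ℋ-resp S {π x} {ρ} eq (Forward.π∈ℋ S B x)) (Backward.ℋ⇒image S B ρ)
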